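{- Let $q,b$ be complex numbers with $|q|<1$ and $b\neq -q^{ -N}$ for any positive integer $N$. Then for all positive integers $m$ and $n$, $$\sum_{0\leq a_1\leq a_2\leq \dots \leq a_n}^{'}\frac{q^{m(a_1+a_2+\dots +a_n)}}{\prod_{j=0}^{n-1}\prod_{k=1}^{m+1}\left(1+bq^{jm+k+a_{j+1}}\right)}=\frac{1}{(q^m;q^m)_n\,(-bq;q)_{mn}},$$ where the sum is over all $n$-tuples $(a_1,\dots,a_n)$ of integers satisfying $0\leq a_1\leq a_2\leq\dots\leq a_n$, and the notation $\sum^{'}$ means that, for each $i$ with $1\le i\le n-1$ and $a_{i+1}=a_i$, the factor $1+bq^{im+1+a_i}$ (which arises in the double product both from $(j,k)=(i-1,m+1)$ and from $(j,k)=(i,1)$) is included just once in the denominator product.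
   Context: Notation: $(x;q)_0=1$ and $(x;q)_n=\prod_{j=0}^{n-1}(1-xq^{j})$ for $n\ge 1$; thus $(q^m;q^m)_n=\prod_{j=1}^{n}(1-q^{mj})$ and $(-bq;q)_{mn}=\prod_{j=1}^{mn}(1+bq^{j})$. The condition $b\ne -q^{ -N}$ means $1+bq^N\neq 0$. Equivalently, the summand for the tuple $(a_1,\dots,a_n)$ in the primed sum is the displayed fraction multiplied by $\prod_{1\le i\le n-1,\ a_{i+1}=a_i}(1+bq^{im+1+a_i})$. -}

module Defs where

open import Algebra.Bundles.Raw using (RawRing)
import Algebra.Definitions.RawSemiring as RawSemiringOps
open import Data.Bool.Base using (if_then_else_)
open import Data.Fin.Base as Fin using (Fin; toℕ; inject₁)
open import Data.List.Base as List using (List)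
open import Data.List.Relation.Binary.Subset.Propositional using (_⊆_)
open import Data.List.Relation.Unary.Unique.Propositional using (Unique)
open import Data.Nat.Base as ℕ using (ℕ; zero; suc; z≤n; s≤s)
import Data.Nat.Properties as ℕₚ
open import Data.Product.Base using (Σ; ∃; _×_; _,_; proj₁; proj₂)
open import Data.Rational.Base as ℚ using (ℚ; 0ℚ; 1ℚ; ½; mkℚ)
open import Data.Integer.Base as ℤ using (+_; -[1+_])
import Data.Integer.Properties as ℤₚ
import Data.Rational.Base as Rat
import Data.Rational.Unnormalised.Base as ℚᵘ
import Data.Rational.Unnormalised.Properties as ℚᵘₚ
import Data.Rational.Properties as ℚₚ
open import Data.Rational.Solver using (module +-*-Solver)
open import Data.Sum.Base using (_⊎_; inj₁; inj₂)
open import Data.Vec.Base as Vec using (Vec; lookup)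
open import Data.Vec.Relation.Unary.Linked using (Linked)
open import Level using (0ℓ)
open import Relation.Binary.PropositionalEquality
  using (_≡_; _≢_; refl; sym; trans; cong; cong₂; subst; subst₂)
open import Relation.Nullary using (¬_; Dec; yes; no; contradiction; does)

------------------------------------------------------------------------
-- Arithmetic of ℚ

module ℚ-Lemmas where
  private
    variable
      p p′ q q′ ε : ℚ

  open Rat using (_+_; _*_; _-_; -_; _<_; _≤_; ∣_∣; _⊔_)
  open +-*-Solver

  0<½ : 0ℚ < ½
  0<½ = ℚₚ.positive⁻¹ ½

  0<1 : 0ℚ < 1ℚ
  0<1 = ℚₚ.positive⁻¹ 1ℚ

  pos* : 0ℚ < p → 0ℚ < q → 0ℚ < p * q
  pos* {p} {q} 0<p 0<q =
    ℚₚ.positive⁻¹ (p * q) ⦃ ℚₚ.pos*pos⇒pos p ⦃ ℚ.positive 0<p ⦄ q ⦃ ℚ.positive 0<q ⦄ ⦄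

  nonNeg* : 0ℚ ≤ p → 0ℚ ≤ q → 0ℚ ≤ p * q
  nonNeg* {p} {q} 0≤p 0≤q =
    ℚₚ.nonNegative⁻¹ (p * q)
      ⦃ ℚₚ.nonNeg*nonNeg⇒nonNeg p ⦃ ℚ.nonNegative 0≤p ⦄ q ⦃ ℚ.nonNegative 0≤q ⦄ ⦄

  *-mono : 0ℚ ≤ p → 0ℚ ≤ q′ → p ≤ p′ → q ≤ q′ → p * q ≤ p′ * q′
  *-mono {p} {q′} {p′} {q} 0≤p 0≤q′ p≤p′ q≤q′ =
    ℚₚ.≤-trans (ℚₚ.*-monoˡ-≤-nonNeg p ⦃ ℚ.nonNegative 0≤p ⦄ q≤q′)
              (ℚₚ.*-monoʳ-≤-nonNeg q′ ⦃ ℚ.nonNegative 0≤q′ ⦄ p≤p′)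

  pos+ : 0ℚ < p → 0ℚ ≤ q → 0ℚ < p + q
  pos+ {p} {q} 0<p 0≤q = subst (_< p + q) (ℚₚ.+-identityˡ 0ℚ) (ℚₚ.+-mono-<-≤ 0<p 0≤q)

  nonNeg+ : 0ℚ ≤ p → 0ℚ ≤ q → 0ℚ ≤ p + q
  nonNeg+ {p} {q} 0≤p 0≤q = subst (_≤ p + q) (ℚₚ.+-identityˡ 0ℚ) (ℚₚ.+-mono-≤ 0≤p 0≤q)

  half : ∀ p → p * ½ + p * ½ ≡ p
  half p = trans (sym (ℚₚ.*-distribˡ-+ p ½ ½)) (ℚₚ.*-identityʳ p)

  p≤p+nonNeg : 0ℚ ≤ q → p ≤ p + q
  p≤p+nonNeg {q} {p} 0≤q = subst (_≤ p + q) (ℚₚ.+-identityʳ p) (ℚₚ.+-monoʳ-≤ p 0≤q)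

  p≤∣p∣ : ∀ p → p ≤ ∣ p ∣
  p≤∣p∣ p with ℚₚ.≤-total 0ℚ p
  ... | inj₁ 0≤p = ℚₚ.≤-reflexive (sym (ℚₚ.0≤p⇒∣p∣≡p 0≤p))
  ... | inj₂ p≤0 = ℚₚ.≤-trans p≤0 (ℚₚ.0≤∣p∣ p)

  ∣p-q∣-sym : ∀ p q → ∣ p - q ∣ ≡ ∣ q - p ∣
  ∣p-q∣-sym p q = trans (cong ∣_∣ (solve 2 (λ p q → p :- q := :- (q :- p)) refl p q))
                       (ℚₚ.∣-p∣≡∣p∣ (q - p))

  -- p < q + ε is the one-sided form of ∣ p - q ∣ < ε.
  ∣-∣<⇒< : ∣ p - q ∣ < ε → p < q + ε
  ∣-∣<⇒< {p} {q} {ε} h =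
    subst (_< q + ε) (solve 2 (λ p q → q :+ (p :- q) := p) refl p q)
      (ℚₚ.+-monoʳ-< q (ℚₚ.≤-<-trans (p≤∣p∣ (p - q)) h))

  p<q+ε⇒p-q<ε : p < q + ε → p - q < ε
  p<q+ε⇒p-q<ε {p} {q} {ε} h =
    subst (p - q <_) (solve 2 (λ q e → (q :+ e) :- q := e) refl q ε)
      (ℚₚ.+-monoˡ-< (- q) h)

  <⇒∣-∣< : p < q + ε → q < p + ε → ∣ p - q ∣ < ε
  <⇒∣-∣< {p} {q} {ε} h k with ℚₚ.∣p∣≡p∨∣p∣≡-p (p - q)
  ... | inj₁ eq = subst (_< ε) (sym eq) (p<q+ε⇒p-q<ε h)
  ... | inj₂ eq = subst (_< ε)
        (sym (trans eq (solve 2 (λ p q → :- (p :- q) := q :- p) refl p q)))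
        (p<q+ε⇒p-q<ε k)

  ∣∣<-trans₂ : ∀ {a b c d} → ∣ a ∣ ≤ ∣ b ∣ + ∣ c ∣ → ∣ b ∣ < d * ½ → ∣ c ∣ < d * ½ → ∣ a ∣ < d
  ∣∣<-trans₂ {d = d} h k l =
    ℚₚ.≤-<-trans h (subst (_ <_) (half d) (ℚₚ.+-mono-< k l))

  square-cancel-< : 0ℚ ≤ q → p * p < q * q → p < q
  square-cancel-< {q} {p} 0≤q h with p ℚₚ.<? q
  ... | yes p<q = p<q
  ... | no p≮q = contradiction
        (ℚₚ.<-≤-trans h (*-mono 0≤q (ℚₚ.≤-trans 0≤q q≤p) q≤p q≤p))
        (ℚₚ.<-irrefl refl)
    where q≤p = ℚₚ.≮⇒≥ p≮q

  -- The reciprocal, with value 0 at 0.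
  inv₀ : ℚ → ℚ
  inv₀ p with p ℚₚ.≟ 0ℚ
  ... | yes _  = 0ℚ
  ... | no p≢0 = (ℚ.1/ p) ⦃ ℚ.≢-nonZero p≢0 ⦄

  *-inv₀ : p ≢ 0ℚ → p * inv₀ p ≡ 1ℚ
  *-inv₀ {p} p≢0 with p ℚₚ.≟ 0ℚ
  ... | yes p≡0 = contradiction p≡0 p≢0
  ... | no p≢0′ = ℚₚ.*-inverseʳ p ⦃ ℚ.≢-nonZero p≢0′ ⦄

  pos⇒≢0 : 0ℚ < p → p ≢ 0ℚ
  pos⇒≢0 0<p p≡0 = ℚₚ.<⇒≢ 0<p (sym p≡0)

  inv₀-pos : 0ℚ < p → 0ℚ < inv₀ p
  inv₀-pos {p} 0<p with p ℚₚ.≟ 0ℚ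
  ... | yes p≡0 = contradiction p≡0 (pos⇒≢0 0<p)
  ... | no p≢0′ = ℚₚ.positive⁻¹ _ ⦃ ℚₚ.1/pos⇒pos p ⦃ ℚ.positive 0<p ⦄ ⦄

  inv₀-antimono : 0ℚ < p → p ≤ q → inv₀ q ≤ inv₀ p
  inv₀-antimono {p} {q} 0<p p≤q = begin
    inv₀ q                  ≡⟨ sym (ℚₚ.*-identityˡ _) ⟩
    1ℚ * inv₀ q             ≡⟨ cong (_* inv₀ q) (sym (*-inv₀ (pos⇒≢0 0<p))) ⟩
    (p * inv₀ p) * inv₀ q   ≤⟨ ℚₚ.*-monoʳ-≤-nonNeg (inv₀ q) ⦃ nn q 0<q ⦄
                                (ℚₚ.*-monoʳ-≤-nonNeg (inv₀ p) ⦃ nn p 0<p ⦄ p≤q) ⟩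
    (q * inv₀ p) * inv₀ q   ≡⟨ solve 3 (λ a b c → (a :* b) :* c := b :* (a :* c))
                                refl q (inv₀ p) (inv₀ q) ⟩
    inv₀ p * (q * inv₀ q)   ≡⟨ cong (inv₀ p *_) (*-inv₀ (pos⇒≢0 0<q)) ⟩
    inv₀ p * 1ℚ             ≡⟨ ℚₚ.*-identityʳ _ ⟩
    inv₀ p                  ∎
    where
    open ℚₚ.≤-Reasoning
    0<q = ℚₚ.<-≤-trans 0<p p≤q
    nn : ∀ r → 0ℚ < r → ℚ.NonNegative (inv₀ r)
    nn r 0<r = ℚ.nonNegative (ℚₚ.<⇒≤ (inv₀-pos 0<r))

open ℚ-Lemmas

------------------------------------------------------------------------
-- Cauchy sequences of rationals

Eventually : (ℕ → Set) → Set
Eventually P = ∃ λ N → ∀ n → N ℕ.≤ n → P n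

Cauchy : (ℕ → ℚ) → Set
Cauchy x = ∀ ε → 0ℚ ℚ.< ε →
  ∃ λ N → ∀ m n → N ℕ.≤ m → N ℕ.≤ n → ℚ.∣ x m ℚ.- x n ∣ ℚ.< ε

module Cauchy-Lemmas where
  open Rat using (_+_; _*_; _-_; -_; ∣_∣)
  open +-*-Solver
  private
    ⊔≤⇒ˡ : ∀ {a b n} → a ℕ.⊔ b ℕ.≤ n → a ℕ.≤ n
    ⊔≤⇒ˡ {a} {b} = ℕₚ.m⊔n≤o⇒m≤o a b
    ⊔≤⇒ʳ : ∀ {a b n} → a ℕ.⊔ b ℕ.≤ n → b ℕ.≤ n
    ⊔≤⇒ʳ {a} {b} = ℕₚ.m⊔n≤o⇒n≤o a b

  +-cauchy : ∀ x y → Cauchy x → Cauchy y → Cauchy (λ n → x n + y n)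
  +-cauchy x y cx cy ε 0<ε =
    let 0<ε/2 = pos* 0<ε 0<½
        M , hx = cx (ε * ½) 0<ε/2
        N , hy = cy (ε * ½) 0<ε/2
    in M ℕ.⊔ N , λ m n M≤m M≤n →
      ∣∣<-trans₂
        (subst (λ r → ∣ r ∣ ℚ.≤ ∣ x m - x n ∣ + ∣ y m - y n ∣)
          (solve 4 (λ a b c d → (a :- b) :+ (c :- d) := (a :+ c) :- (b :+ d))
            refl (x m) (x n) (y m) (y n))
          (ℚₚ.∣p+q∣≤∣p∣+∣q∣ (x m - x n) (y m - y n)))
        (hx m n (⊔≤⇒ˡ M≤m) (⊔≤⇒ˡ M≤n))
        (hy m n (⊔≤⇒ʳ {M} M≤m) (⊔≤⇒ʳ {M} M≤n))

  neg-cauchy : ∀ x → Cauchy x → Cauchy (λ n → - x n)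
  neg-cauchy x cx ε 0<ε =
    let N , h = cx ε 0<ε
    in N , λ m n N≤m N≤n → subst (ℚ._< ε)
      (trans (sym (ℚₚ.∣-p∣≡∣p∣ (x m - x n)))
        (cong ∣_∣ (solve 2 (λ a b → :- (a :- b) := :- a :- :- b) refl (x m) (x n))))
      (h m n N≤m N≤n)

  bounded : ∀ x → Cauchy x →
    ∃ λ B → 0ℚ ℚ.< B × Eventually λ n → ∣ x n ∣ ℚ.≤ B
  bounded x cx =
    let N , h = cx 1ℚ 0<1
    in 1ℚ + ∣ x N ∣ , pos+ 0<1 (ℚₚ.0≤∣p∣ (x N)) , N , λ n N≤n →
      ℚₚ.≤-trans
        (subst (λ r → ∣ r ∣ ℚ.≤ ∣ x n - x N ∣ + ∣ x N ∣)
          (solve 2 (λ a b → (a :- b) :+ b := a) refl (x n) (x N))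
          (ℚₚ.∣p+q∣≤∣p∣+∣q∣ (x n - x N) (x N)))
        (ℚₚ.+-monoˡ-≤ ∣ x N ∣ (ℚₚ.<⇒≤ (h n N N≤n ℕₚ.≤-refl)))

  *-cauchy : ∀ x y → Cauchy x → Cauchy y → Cauchy (λ n → x n * y n)
  *-cauchy x y cx cy ε 0<ε =
    let B , 0<B , M , bx = bounded x cx
        C , 0<C , N , by = bounded y cy
        0<B+C = pos+ 0<B (ℚₚ.<⇒≤ 0<C)
        η = ε * inv₀ (B + C)
        0<η = pos* 0<ε (inv₀-pos 0<B+C)
        K , hx = cx η 0<η
        L , hy = cy η 0<η
    in (M ℕ.⊔ N) ℕ.⊔ (K ℕ.⊔ L) , λ m n ≤m ≤n →
      let M≤m = ⊔≤⇒ˡ {M} {N} (⊔≤⇒ˡ {M ℕ.⊔ N} ≤m)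
          N≤n = ⊔≤⇒ʳ {M} {N} (⊔≤⇒ˡ {M ℕ.⊔ N} ≤n)
          K≤m = ⊔≤⇒ˡ {K} {L} (⊔≤⇒ʳ {M ℕ.⊔ N} ≤m)
          K≤n = ⊔≤⇒ˡ {K} {L} (⊔≤⇒ʳ {M ℕ.⊔ N} ≤n)
          L≤m = ⊔≤⇒ʳ {K} {L} (⊔≤⇒ʳ {M ℕ.⊔ N} ≤m)
          L≤n = ⊔≤⇒ʳ {K} {L} (⊔≤⇒ʳ {M ℕ.⊔ N} ≤n)
          open ℚₚ.≤-Reasoning
      in begin-strict
        ∣ x m * y m - x n * y n ∣
          ≡⟨ cong ∣_∣ (solve 4 (λ a b c d → a :* b :- c :* d := a :* (b :- d) :+ (a :- c) :* d)
               refl (x m) (y m) (x n) (y n)) ⟩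
        ∣ x m * (y m - y n) + (x m - x n) * y n ∣
          ≤⟨ ℚₚ.∣p+q∣≤∣p∣+∣q∣ (x m * (y m - y n)) ((x m - x n) * y n) ⟩
        ∣ x m * (y m - y n) ∣ + ∣ (x m - x n) * y n ∣
          ≡⟨ cong₂ _+_ (ℚₚ.∣p*q∣≡∣p∣*∣q∣ (x m) (y m - y n)) (ℚₚ.∣p*q∣≡∣p∣*∣q∣ (x m - x n) (y n)) ⟩
        ∣ x m ∣ * ∣ y m - y n ∣ + ∣ x m - x n ∣ * ∣ y n ∣
          ≤⟨ ℚₚ.+-mono-≤
               (ℚₚ.*-monoʳ-≤-nonNeg ∣ y m - y n ∣ ⦃ ℚₚ.∣-∣-nonNeg (y m - y n) ⦄ (bx m M≤m))
               (ℚₚ.*-monoˡ-≤-nonNeg ∣ x m - x n ∣ ⦃ ℚₚ.∣-∣-nonNeg (x m - x n) ⦄ (by n N≤n)) ⟩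
        B * ∣ y m - y n ∣ + ∣ x m - x n ∣ * C
          <⟨ ℚₚ.+-mono-<
               (ℚₚ.*-monoʳ-<-pos B ⦃ ℚ.positive 0<B ⦄ (hy m n L≤m L≤n))
               (ℚₚ.*-monoˡ-<-pos C ⦃ ℚ.positive 0<C ⦄ (hx m n K≤m K≤n)) ⟩
        B * η + η * C
          ≡⟨ solve 4 (λ b c e i → b :* (e :* i) :+ (e :* i) :* c := e :* ((b :+ c) :* i))
               refl B C ε (inv₀ (B + C)) ⟩
        ε * ((B + C) * inv₀ (B + C))
          ≡⟨ cong (ε *_) (*-inv₀ (pos⇒≢0 0<B+C)) ⟩
        ε * 1ℚ
          ≡⟨ ℚₚ.*-identityʳ ε ⟩
        ε ∎

  inv-cauchy : ∀ x {c} → 0ℚ ℚ.< c → Eventually (λ n → c ℚ.≤ x n) →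
    Cauchy x → Cauchy (λ n → inv₀ (x n))
  inv-cauchy x {c} 0<c (M , c≤x) cx ε 0<ε =
    let 0<cc = pos* 0<c 0<c
        N , h = cx (ε * (c * c)) (pos* 0<ε 0<cc)
    in M ℕ.⊔ N , λ m n ≤m ≤n →
      let c≤xm = c≤x m (⊔≤⇒ˡ ≤m)
          c≤xn = c≤x n (⊔≤⇒ˡ ≤n)
          0<xm = ℚₚ.<-≤-trans 0<c c≤xm
          0<xn = ℚₚ.<-≤-trans 0<c c≤xn
          0<im = inv₀-pos 0<xm
          0<in = inv₀-pos 0<xn
          0<ic = inv₀-pos 0<c
          i = inv₀ c
          im = inv₀ (x m)
          in′ = inv₀ (x n)
          0<imin = pos* 0<im 0<in
          open ℚₚ.≤-Reasoning
      in begin-strict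
        ∣ im - in′ ∣
          ≡⟨ cong ∣_∣ (cong₂ _-_ (sym (ℚₚ.*-identityʳ im)) (sym (ℚₚ.*-identityʳ in′))) ⟩
        ∣ im * 1ℚ - in′ * 1ℚ ∣
          ≡⟨ cong ∣_∣ (cong₂ (λ a b → im * a - in′ * b)
               (sym (*-inv₀ (pos⇒≢0 0<xn))) (sym (*-inv₀ (pos⇒≢0 0<xm)))) ⟩
        ∣ im * (x n * in′) - in′ * (x m * im) ∣
          ≡⟨ cong ∣_∣ (solve 4 (λ a b c d → a :* (d :* b) :- b :* (c :* a) := (d :- c) :* (a :* b))
               refl im in′ (x m) (x n)) ⟩
        ∣ (x n - x m) * (im * in′) ∣
          ≡⟨ ℚₚ.∣p*q∣≡∣p∣*∣q∣ (x n - x m) (im * in′) ⟩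
        ∣ x n - x m ∣ * ∣ im * in′ ∣
          ≡⟨ cong (∣ x n - x m ∣ *_) (ℚₚ.0≤p⇒∣p∣≡p (ℚₚ.<⇒≤ 0<imin)) ⟩
        ∣ x n - x m ∣ * (im * in′)
          <⟨ ℚₚ.*-monoˡ-<-pos (im * in′) ⦃ ℚ.positive 0<imin ⦄
               (h n m (⊔≤⇒ʳ {M} ≤n) (⊔≤⇒ʳ {M} ≤m)) ⟩
        ε * (c * c) * (im * in′)
          ≤⟨ ℚₚ.*-monoˡ-≤-nonNeg (ε * (c * c))
               ⦃ ℚ.nonNegative (ℚₚ.<⇒≤ (pos* 0<ε 0<cc)) ⦄
               (*-mono (ℚₚ.<⇒≤ 0<im) (ℚₚ.<⇒≤ 0<ic)
                 (inv₀-antimono 0<c c≤xm) (inv₀-antimono 0<c c≤xn)) ⟩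
        ε * (c * c) * (i * i)
          ≡⟨ solve 3 (λ e c i → e :* (c :* c) :* (i :* i) := e :* ((c :* i) :* (c :* i)))
               refl ε c i ⟩
        ε * ((c * i) * (c * i))
          ≡⟨ cong (λ r → ε * (r * r)) (*-inv₀ (pos⇒≢0 0<c)) ⟩
        ε * (1ℚ * 1ℚ)
          ≡⟨ ℚₚ.*-identityʳ ε ⟩
        ε ∎

open Cauchy-Lemmas

------------------------------------------------------------------------
-- Square roots of rationals by bisection

module Bisection where
  open Rat using (_+_; _*_; _-_; -_; ∣_∣; _⊔_)
  open +-*-Solver

  width : ℚ → ℕ → ℚ
  width p zero    = p + 1ℚ
  width p (suc n) = width p n * ½

  -- Lower endpoint after n bisections of [0 , p + 1] towards the root of p.
  lower : ℚ → ℕ → ℚ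
  lower p zero    = 0ℚ
  lower p (suc n) =
    let mid = lower p n + width p (suc n)
    in if does (mid * mid ℚₚ.≤? p) then mid else lower p n

  lower-elim : ∀ (P : ℚ → Set) p n →
    (let mid = lower p n + width p (suc n) in
    (mid * mid ℚ.≤ p → P mid) → (p ℚ.< mid * mid → P (lower p n)) → P (lower p (suc n)))
  lower-elim P p n f g = if-elim (mid * mid ℚₚ.≤? p) f (λ h → g (ℚₚ.≰⇒> h))
    where
    mid = lower p n + width p (suc n)
    if-elim : ∀ {A : Set} (A? : Dec A) → (A → P mid) → (¬ A → P (lower p n)) →
      P (if does A? then mid else lower p n)
    if-elim (yes a) f g = f a
    if-elim (no ¬a) f g = g ¬a

  width-pos : ∀ {p} → 0ℚ ℚ.≤ p → ∀ n → 0ℚ ℚ.< width p n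
  width-pos {p} 0≤p zero = subst (0ℚ ℚ.<_) (ℚₚ.+-comm 1ℚ p) (pos+ 0<1 0≤p)
  width-pos 0≤p (suc n) = pos* (width-pos 0≤p n) 0<½

  lower-nonNeg : ∀ {p} → 0ℚ ℚ.≤ p → ∀ n → 0ℚ ℚ.≤ lower p n
  lower-nonNeg 0≤p zero = ℚₚ.≤-refl
  lower-nonNeg {p} 0≤p (suc n) = lower-elim (0ℚ ℚ.≤_) p n
    (λ _ → nonNeg+ (lower-nonNeg 0≤p n) (ℚₚ.<⇒≤ (width-pos 0≤p (suc n))))
    (λ _ → lower-nonNeg 0≤p n)

  lower²≤ : ∀ {p} → 0ℚ ℚ.≤ p → ∀ n → lower p n * lower p n ℚ.≤ p
  lower²≤ 0≤p zero = 0≤p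
  lower²≤ {p} 0≤p (suc n) = lower-elim (λ r → r * r ℚ.≤ p) p n (λ h → h) (λ _ → lower²≤ 0≤p n)

  <upper² : ∀ {p} → 0ℚ ℚ.≤ p → ∀ n →
    p ℚ.< (lower p n + width p n) * (lower p n + width p n)
  <upper² {p} 0≤p zero =
    subst (p ℚ.<_)
      (solve 1 (λ p → (con 1ℚ :+ (p :+ p :* p)) :+ p :=
                      (con 0ℚ :+ (p :+ con 1ℚ)) :* (con 0ℚ :+ (p :+ con 1ℚ))) refl p)
      (subst (ℚ._< (1ℚ + (p + p * p)) + p) (ℚₚ.+-identityˡ p)
        (ℚₚ.+-monoˡ-< p (pos+ 0<1 (nonNeg+ 0≤p (nonNeg* 0≤p 0≤p)))))
  <upper² {p} 0≤p (suc n) =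
    lower-elim (λ r → p ℚ.< (r + width p (suc n)) * (r + width p (suc n))) p n
      (λ _ → subst (λ r → p ℚ.< r * r)
        (trans (cong (λ r → lower p n + r) (sym (half (width p n))))
               (sym (ℚₚ.+-assoc (lower p n) (width p (suc n)) (width p (suc n)))))
        (<upper² 0≤p n))
      (λ h → h)

  private
    fromℕ : ℕ → ℚ
    fromℕ zero    = 0ℚ
    fromℕ (suc n) = 1ℚ + fromℕ n

    fromℕ-nonNeg : ∀ n → 0ℚ ℚ.≤ fromℕ n
    fromℕ-nonNeg zero = ℚₚ.≤-refl
    fromℕ-nonNeg (suc n) = nonNeg+ (ℚₚ.<⇒≤ 0<1) (fromℕ-nonNeg n)

    toℚᵘ-fromℕ : ∀ n → ℚ.toℚᵘ (fromℕ n) ℚᵘ.≃ ℚᵘ.mkℚᵘ (+ n) 0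
    toℚᵘ-fromℕ zero = ℚᵘₚ.≃-refl
    toℚᵘ-fromℕ (suc n) = ℚᵘₚ.≃-trans (ℚₚ.toℚᵘ-homo-+ 1ℚ (fromℕ n))
      (ℚᵘₚ.≃-trans (ℚᵘₚ.+-congʳ ℚᵘ.1ℚᵘ (toℚᵘ-fromℕ n))
        (ℚᵘ.*≡* (cong (ℤ._* + 1) (cong (λ k → + 1 ℤ.+ k) (ℤₚ.*-identityʳ (+ n))))))

    archimedean : ∀ p → ∃ λ n → p ℚ.≤ fromℕ n
    archimedean p@(mkℚ -[1+ a ] d c) = 0 , ℚₚ.<⇒≤ (ℚₚ.negative⁻¹ p)
    archimedean (mkℚ (+ a) d c) = a , ℚₚ.toℚᵘ-cancel-≤
      (ℚᵘₚ.≤-respʳ-≃ (ℚᵘₚ.≃-sym (toℚᵘ-fromℕ a))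
        (ℚᵘ.*≤* (ℤₚ.*-monoˡ-≤-nonNeg (+ a) (ℤ.+≤+ (s≤s z≤n)))))

    ½^ : ℕ → ℚ
    ½^ zero = 1ℚ
    ½^ (suc n) = ½^ n * ½

    ½^-pos : ∀ n → 0ℚ ℚ.< ½^ n
    ½^-pos zero = 0<1
    ½^-pos (suc n) = pos* (½^-pos n) 0<½

    *½≤ : ∀ {p} → 0ℚ ℚ.≤ p → p * ½ ℚ.≤ p
    *½≤ {p} 0≤p = subst (p * ½ ℚ.≤_) (half p) (p≤p+nonNeg (nonNeg* 0≤p (ℚₚ.<⇒≤ 0<½)))

    ½^-antimono : ∀ {m n} → m ℕ.≤′ n → ½^ n ℚ.≤ ½^ m
    ½^-antimono ℕ.≤′-refl = ℚₚ.≤-refl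
    ½^-antimono {n = suc n} (ℕ.≤′-step h) =
      ℚₚ.≤-trans (*½≤ (ℚₚ.<⇒≤ (½^-pos n))) (½^-antimono h)

    n½^n≤1 : ∀ n → fromℕ n * ½^ n ℚ.≤ 1ℚ
    n½^n≤1 zero = ℚₚ.<⇒≤ 0<1
    n½^n≤1 (suc n) = begin
      (1ℚ + fromℕ n) * (½^ n * ½)
        ≡⟨ solve 3 (λ a b c → (con 1ℚ :+ a) :* (b :* c) := (b :+ a :* b) :* c)
             refl (fromℕ n) (½^ n) ½ ⟩
      (½^ n + fromℕ n * ½^ n) * ½
        ≤⟨ ℚₚ.*-monoʳ-≤-nonNeg ½ (ℚₚ.+-mono-≤ (½^-antimono {0} {n} (ℕₚ.≤⇒≤′ z≤n)) (n½^n≤1 n)) ⟩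
      (1ℚ + 1ℚ) * ½
        ≡⟨⟩
      1ℚ ∎
      where open ℚₚ.≤-Reasoning

    *½^→0 : ∀ {B ε} → 0ℚ ℚ.< B → 0ℚ ℚ.< ε → Eventually λ n → B * ½^ n ℚ.< ε
    *½^→0 {B} {ε} 0<B 0<ε = suc N , λ n N<n → begin-strict
      B * ½^ n
        ≤⟨ ℚₚ.*-monoˡ-≤-nonNeg B ⦃ ℚ.nonNegative (ℚₚ.<⇒≤ 0<B) ⦄ (½^-antimono (ℕₚ.≤⇒≤′ N<n)) ⟩
      B * ½^ (suc N)
        ≡⟨ cong (_* ½^ (suc N)) (sym (ℚₚ.*-identityʳ B)) ⟩
      B * 1ℚ * ½^ (suc N)
        ≡⟨ cong (λ r → B * r * ½^ (suc N)) (sym (*-inv₀ (pos⇒≢0 0<ε))) ⟩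
      B * (ε * inv₀ ε) * ½^ (suc N)
        ≡⟨ solve 4 (λ b e i h → b :* (e :* i) :* h := e :* ((b :* i) :* h))
             refl B ε (inv₀ ε) (½^ (suc N)) ⟩
      ε * ((B * inv₀ ε) * ½^ (suc N))
        <⟨ ℚₚ.*-monoʳ-<-pos ε ⦃ ℚ.positive 0<ε ⦄
             (ℚₚ.*-monoˡ-<-pos (½^ (suc N)) ⦃ ℚ.positive (½^-pos (suc N)) ⦄
               (ℚₚ.≤-<-trans B/ε≤N N<1+N)) ⟩
      ε * (fromℕ (suc N) * ½^ (suc N))
        ≤⟨ ℚₚ.*-monoˡ-≤-nonNeg ε ⦃ ℚ.nonNegative (ℚₚ.<⇒≤ 0<ε) ⦄ (n½^n≤1 (suc N)) ⟩
      ε * 1ℚ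
        ≡⟨ ℚₚ.*-identityʳ ε ⟩
      ε ∎
      where
      open ℚₚ.≤-Reasoning
      N = proj₁ (archimedean (B * inv₀ ε))
      B/ε≤N = proj₂ (archimedean (B * inv₀ ε))
      N<1+N : fromℕ N ℚ.< fromℕ (suc N)
      N<1+N = subst (ℚ._< 1ℚ + fromℕ N) (ℚₚ.+-identityˡ (fromℕ N)) (ℚₚ.+-monoˡ-< (fromℕ N) 0<1)

    width-½^ : ∀ p n → width p n ≡ (p + 1ℚ) * ½^ n
    width-½^ p zero = sym (ℚₚ.*-identityʳ (p + 1ℚ))
    width-½^ p (suc n) = trans (cong (_* ½) (width-½^ p n)) (ℚₚ.*-assoc (p + 1ℚ) (½^ n) ½)

  width→0 : ∀ x → Cauchy x → ∀ {ε} → 0ℚ ℚ.< ε →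
    Eventually λ n → width (x n ⊔ 0ℚ) n ℚ.< ε
  width→0 x cx {ε} 0<ε =
    let B , 0<B , M , bx = bounded x cx
        0<B+1 = pos+ 0<B (ℚₚ.<⇒≤ 0<1)
        N , h = *½^→0 0<B+1 0<ε
    in M ℕ.⊔ N , λ n ≤n →
      let x⊔0≤B = ℚₚ.⊔-lub
            (ℚₚ.≤-trans (p≤∣p∣ (x n)) (bx n (ℕₚ.m⊔n≤o⇒m≤o M N ≤n))) (ℚₚ.<⇒≤ 0<B)
      in subst (ℚ._< ε) (sym (width-½^ (x n ⊔ 0ℚ) n))
        (ℚₚ.≤-<-trans
          (ℚₚ.*-monoʳ-≤-nonNeg (½^ n) ⦃ ℚ.nonNegative (ℚₚ.<⇒≤ (½^-pos n)) ⦄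
            (ℚₚ.+-monoˡ-≤ 1ℚ x⊔0≤B))
          (h n (ℕₚ.m⊔n≤o⇒n≤o M N ≤n)))

  private
    ⊔0-< : ∀ {p q η} → 0ℚ ℚ.< η → p ℚ.< q + η → (p ⊔ 0ℚ) ℚ.≤ (q ⊔ 0ℚ) + η
    ⊔0-< {p} {q} {η} 0<η h = ℚₚ.⊔-lub
      (ℚₚ.≤-trans (ℚₚ.<⇒≤ h) (ℚₚ.+-monoˡ-≤ η (ℚₚ.p≤p⊔q q 0ℚ)))
      (nonNeg+ (ℚₚ.p≤q⊔p q 0ℚ) (ℚₚ.<⇒≤ 0<η))

  -- Two approximate roots differ by less than ε if their arguments differ by
  -- at most (ε/2)² and the second bracket is shorter than ε/2.
  lower-close : ∀ {p q ε} → 0ℚ ℚ.≤ p → 0ℚ ℚ.≤ q → 0ℚ ℚ.< ε → ∀ m n →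
    p ℚ.≤ q + ε * ½ * (ε * ½) → width q n ℚ.< ε * ½ → lower p m ℚ.< lower q n + ε
  lower-close {p} {q} {ε} 0≤p 0≤q 0<ε m n p≤q+η w<h =
    square-cancel-< (nonNeg+ 0≤l (ℚₚ.<⇒≤ 0<ε)) (begin-strict
      lower p m * lower p m                 ≤⟨ lower²≤ 0≤p m ⟩
      p                                     ≤⟨ p≤q+η ⟩
      q + h * h                             <⟨ ℚₚ.+-monoˡ-< (h * h) (<upper² 0≤q n) ⟩
      (l + width q n) * (l + width q n) + h * h
        ≤⟨ ℚₚ.+-monoˡ-≤ (h * h) (*-mono 0≤l+w 0≤l+h l+w≤l+h l+w≤l+h) ⟩
      (l + h) * (l + h) + h * h
        ≤⟨ p≤p+nonNeg (nonNeg* (nonNeg+ 0≤l+h 0≤l+h) 0≤h) ⟩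
      ((l + h) * (l + h) + h * h) + ((l + h) + (l + h)) * h
        ≡⟨ solve 2 (λ l h → ((l :+ h) :* (l :+ h) :+ h :* h) :+ ((l :+ h) :+ (l :+ h)) :* h
                          := (l :+ (h :+ h)) :* (l :+ (h :+ h))) refl l h ⟩
      (l + (h + h)) * (l + (h + h))         ≡⟨ cong (λ r → (l + r) * (l + r)) (half ε) ⟩
      (l + ε) * (l + ε)                     ∎)
    where
    open ℚₚ.≤-Reasoning
    h = ε * ½
    l = lower q n
    0≤h = ℚₚ.<⇒≤ (pos* 0<ε 0<½)
    0≤l = lower-nonNeg 0≤q n
    0≤l+w = nonNeg+ 0≤l (ℚₚ.<⇒≤ (width-pos 0≤q n))
    0≤l+h = nonNeg+ 0≤l 0≤h
    l+w≤l+h = ℚₚ.+-monoʳ-≤ l (ℚₚ.<⇒≤ w<h)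

  √-cauchy : ∀ x → Cauchy x → Cauchy (λ n → lower (x n ⊔ 0ℚ) n)
  √-cauchy x cx ε 0<ε =
    let 0<h = pos* 0<ε 0<½
        0<η = pos* 0<h 0<h
        M , hx = cx (ε * ½ * (ε * ½)) 0<η
        N , hw = width→0 x cx 0<h
        close : ∀ m n → M ℕ.⊔ N ℕ.≤ m → M ℕ.⊔ N ℕ.≤ n →
          lower (x m ⊔ 0ℚ) m ℚ.< lower (x n ⊔ 0ℚ) n + ε
        close = λ m n ≤m ≤n → lower-close (ℚₚ.p≤q⊔p (x m) 0ℚ) (ℚₚ.p≤q⊔p (x n) 0ℚ) 0<ε m n
          (⊔0-< {x m} {x n} 0<η (∣-∣<⇒< {x m} {x n}
            (hx m n (ℕₚ.m⊔n≤o⇒m≤o M N ≤m) (ℕₚ.m⊔n≤o⇒m≤o M N ≤n))))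
          (hw n (ℕₚ.m⊔n≤o⇒n≤o M N ≤n))
    in M ℕ.⊔ N , λ m n ≤m ≤n → <⇒∣-∣< (close m n ≤m ≤n) (close n m ≤n ≤m)

------------------------------------------------------------------------
-- Real numbers

module Real where
  record ℝ : Set where
    constructor mkℝ
    field
      seq    : ℕ → ℚ
      cauchy : Cauchy seq
  open ℝ public

  infix 4 _≈_ _<_

  _≈_ : ℝ → ℝ → Set
  x ≈ y = ∀ ε → 0ℚ ℚ.< ε → Eventually λ n → ℚ.∣ seq x n ℚ.- seq y n ∣ ℚ.< ε

  _<_ : ℝ → ℝ → Set
  x < y = ∃ λ ε → 0ℚ ℚ.< ε × Eventually λ n → seq x n ℚ.+ ε ℚ.≤ seq y n

  fromℚ : ℚ → ℝ
  fromℚ p = mkℝ (λ _ → p) λ ε 0<ε → 0 , λ _ _ _ _ →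
    subst (λ r → ℚ.∣ r ∣ ℚ.< ε) (sym (ℚₚ.+-inverseʳ p)) 0<ε

  0ℝ 1ℝ : ℝ
  0ℝ = fromℚ 0ℚ
  1ℝ = fromℚ 1ℚ

  infixl 6 _+_ _-_
  infixl 7 _*_
  infix 8 -_

  _+_ : ℝ → ℝ → ℝ
  x + y = mkℝ (λ n → seq x n ℚ.+ seq y n) (+-cauchy (seq x) (seq y) (cauchy x) (cauchy y))

  -_ : ℝ → ℝ
  - x = mkℝ (λ n → ℚ.- seq x n) (neg-cauchy (seq x) (cauchy x))

  _-_ : ℝ → ℝ → ℝ
  x - y = x + - y

  _*_ : ℝ → ℝ → ℝ
  x * y = mkℝ (λ n → seq x n ℚ.* seq y n) (*-cauchy (seq x) (seq y) (cauchy x) (cauchy y))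

  -- Every x with 0 < x has a reciprocal; its terms with seq x n = 0 are set to 0.
  recip : (x : ℝ) → 0ℝ < x → ℝ
  recip x (c , 0<c , N , c≤x) = mkℝ (λ n → inv₀ (seq x n))
    (inv-cauchy (seq x) 0<c
      (N , λ n N≤n → subst (ℚ._≤ seq x n) (ℚₚ.+-identityˡ c) (c≤x n N≤n))
      (cauchy x))

  -- The nonnegative square root; √ x = 0 for x ≤ 0.
  √ : ℝ → ℝ
  √ x = mkℝ (λ n → Bisection.lower (seq x n ℚ.⊔ 0ℚ) n)
            (Bisection.√-cauchy (seq x) (cauchy x))

open Real public using (ℝ; 0ℝ; 1ℝ; _<_; √)

------------------------------------------------------------------------
-- Complex numbers

infix 5 _+i_
record ℂ : Set where
  constructor _+i_
  field
    re im : ℝ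
open ℂ public

0ℂ 1ℂ : ℂ
0ℂ = 0ℝ +i 0ℝ
1ℂ = 1ℝ +i 0ℝ

infix 4 _≈_ _#0
infixl 6 _+_ _-_
infixl 7 _*_ _/_
infix 8 -_

_≈_ : ℂ → ℂ → Set
z ≈ w = re z Real.≈ re w × im z Real.≈ im w

_+_ : ℂ → ℂ → ℂ
z + w = (re z Real.+ re w) +i (im z Real.+ im w)

-_ : ℂ → ℂ
- z = (Real.- re z) +i (Real.- im z)

_-_ : ℂ → ℂ → ℂ
z - w = z + - w

_*_ : ℂ → ℂ → ℂ
z * w = (re z Real.* re w Real.- im z Real.* im w) +i
        (re z Real.* im w Real.+ im z Real.* re w)

∣_∣² : ℂ → ℝ
∣ z ∣² = re z Real.* re z Real.+ im z Real.* im z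

∣_∣ : ℂ → ℝ
∣ z ∣ = √ ∣ z ∣²

-- z ≠ 0 in the positive (apartness) form, which is what division requires.
_#0 : ℂ → Set
z #0 = 0ℝ < ∣ z ∣²

recip : (z : ℂ) → z #0 → ℂ
recip z z#0 = (re z Real.* r) +i (Real.- (im z Real.* r))
  where r = Real.recip ∣ z ∣² z#0

_/_ : ℂ → Σ ℂ _#0 → ℂ
z / (w , w#0) = z * recip w w#0

ℂ-rawRing : RawRing 0ℓ 0ℓ
ℂ-rawRing = record
  { Carrier = ℂ ; _≈_ = _≈_ ; _+_ = _+_ ; _*_ = _*_ ; -_ = -_ ; 0# = 0ℂ ; 1# = 1ℂ }

open RawSemiringOps (RawRing.rawSemiring ℂ-rawRing) public
  using (_^_) renaming (product to ∏)

1#0 : 1ℂ #0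
1#0 = 1ℚ , 0<1 , 0 , λ _ _ → ℚₚ.≤-refl

*-#0 : ∀ {z w} → z #0 → w #0 → (z * w) #0
*-#0 {z} {w} (c , 0<c , M , hz) (d , 0<d , N , hw) =
  c ℚ.* d , pos* 0<c 0<d , M ℕ.⊔ N , λ n ≤n →
    subst₂ ℚ._≤_ (sym (ℚₚ.+-identityˡ (c ℚ.* d)))
      (solve 4 (λ a b x y →
          (a :* a :+ b :* b) :* (x :* x :+ y :* y) :=
          (a :* x :- b :* y) :* (a :* x :- b :* y) :+ (a :* y :+ b :* x) :* (a :* y :+ b :* x))
        refl (Real.seq (re z) n) (Real.seq (im z) n) (Real.seq (re w) n) (Real.seq (im w) n))
      (bound n (ℕₚ.m⊔n≤o⇒m≤o M N ≤n) (ℕₚ.m⊔n≤o⇒n≤o M N ≤n))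
  where
  open +-*-Solver
  ∣z∣²ₙ = Real.seq ∣ z ∣²
  ∣w∣²ₙ = Real.seq ∣ w ∣²
  bound : ∀ n → M ℕ.≤ n → N ℕ.≤ n → c ℚ.* d ℚ.≤ ∣z∣²ₙ n ℚ.* ∣w∣²ₙ n
  bound n M≤n N≤n =
    *-mono (ℚₚ.<⇒≤ 0<c) (ℚₚ.≤-trans (ℚₚ.<⇒≤ 0<d) d≤)
      (subst (ℚ._≤ ∣z∣²ₙ n) (ℚₚ.+-identityˡ c) (hz n M≤n)) d≤
    where d≤ = subst (ℚ._≤ ∣w∣²ₙ n) (ℚₚ.+-identityˡ d) (hw n N≤n)

∏-#0 : ∀ {n} (z : Fin n → ℂ) → (∀ i → z i #0) → ∏ z #0
∏-#0 {zero}  z h = 1#0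
∏-#0 {suc n} z h =
  *-#0 {z Fin.zero} {∏ λ i → z (Fin.suc i)} (h Fin.zero)
    (∏-#0 (λ i → z (Fin.suc i)) (λ i → h (Fin.suc i)))

------------------------------------------------------------------------
-- Unordered summation

sumOver : {I : Set} → (I → ℂ) → List I → ℂ
sumOver f F = List.foldr _+_ 0ℂ (List.map f F)

-- The finite partial sums converge to s along the directed set of finite
-- subsets of I (represented by duplicate-free lists).
HasSum : {I : Set} → (I → ℂ) → ℂ → Set
HasSum {I} f s = ∀ ε → 0ℝ < ε → ∃ λ (F₀ : List I) →
  ∀ (F : List I) → Unique F → F₀ ⊆ F → ∣ sumOver f F - s ∣ < ε

------------------------------------------------------------------------
-- The series

-- (x ; q) n = (1 - x) (1 - x q) ⋯ (1 - x qⁿ⁻¹)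
qPochhammer : ℂ → ℂ → ℕ → ℂ
qPochhammer x q n = ∏ {n} λ j → 1ℂ - x * q ^ toℕ j

-- Tuples 0 ≤ a₁ ≤ ⋯ ≤ aₙ.  The field sorted is irrelevant so that equality
-- of tuples is equality of their entries.
record Tuple (n : ℕ) : Set where
  constructor tuple
  field
    entries : Vec ℕ n
    .sorted : Linked ℕ._≤_ entries

module Series (q b : ℂ) (b≠ : ∀ N → 1 ℕ.≤ N → (1ℂ + b * q ^ N) #0) (m : ℕ) where

  factor : ℕ → ℂ
  factor N = 1ℂ + b * q ^ N

  module _ {n : ℕ} (a : Vec ℕ n) where

    -- With a₁ , … , aₙ stored at the indices 0 , … , n - 1 and k shifted to
    -- start from 0.
    denominatorFactor : Fin n → Fin (suc m) → ℂ
    denominatorFactor j k = factor (toℕ j ℕ.* m ℕ.+ suc (toℕ k) ℕ.+ lookup a j)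

    denominator : ℂ
    denominator = ∏ λ j → ∏ λ k → denominatorFactor j k

    denominator#0 : denominator #0
    denominator#0 = ∏-#0 _ λ j → ∏-#0 (denominatorFactor j) λ k →
      b≠ _ (ℕₚ.≤-trans (ℕₚ.≤-trans (s≤s z≤n) (ℕₚ.m≤n+m (suc (toℕ k)) (toℕ j ℕ.* m)))
                       (ℕₚ.m≤m+n _ (lookup a j)))

  -- The product over 1 ≤ i < n with aᵢ₊₁ = aᵢ of 1 + b q^(i m + 1 + aᵢ), which
  -- occurs twice in the denominator; the index i here is shifted to start
  -- from 0.
  repeated : ∀ {n} → Vec ℕ (suc n) → ℂ
  repeated {n} a = ∏ {n} λ i →
    if does (lookup a (Fin.suc i) ℕₚ.≟ lookup a (inject₁ i))
    then factor (suc (toℕ i) ℕ.* m ℕ.+ 1 ℕ.+ lookup a (inject₁ i))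
    else 1ℂ

  -- Multiplying by the repeated factors leaves each of them once in the
  -- denominator, as the primed sum requires.
  term : ∀ {n} → Tuple (suc n) → ℂ
  term (tuple a _) =
    (q ^ (m ℕ.* Vec.sum a) / (denominator a , denominator#0 a)) * repeated a

{-# OPTIONS --safe #-}
module Submission where

-- Write F N = 1 + b q^N.  Summing over a_n first, with L = m the sum over
-- a_n ≥ a of q^(L a_n) / (F (Y + a_n) ⋯ F (Y + L + a_n)) telescopes because
--
--   F (Y + L + a) - q^L F (Y + a) = 1 - q^L,
--
-- and correcting the term a_n = a for the repeated factor only removes F (Y + a)
-- from the denominator of the result.  What remains is a sum over a_{n-1} of the
-- same shape with L = 2m, and so on: the tail sums have the closed forms
-- closed (unrestricted first index) and closed′ (with the repeated factor).
--
-- For convergence, everything is evaluated at a fixed position k of the Cauchy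
-- sequences, where it becomes an exact statement about Gaussian rationals.  For
-- all large k, uniformly, |q^N| ≤ B τ^(2N) with τ < 1 and the factors and their
-- inverses are bounded by B.  Then the partial sum over the tuples with entries
-- < d differs from the closed form by O(τ^d), and since a term is
-- O(τ^(2 (a_1 + ⋯ + a_n))), any further terms contribute only O(τ^d).

open import Algebra.Bundles using (CommutativeRing; CommutativeSemiring)
import Algebra.Definitions.RawSemiring as RawSemiringOps
import Algebra.Properties.AbelianGroup as AbelianGroupₚ
import Algebra.Properties.Ring as Ringₚ
import Algebra.Properties.Semiring.Exp as Exp
import Algebra.Solver.Ring.NaturalCoefficients.Default as SemiringSolver
open import Algebra.Structures using (IsCommutativeMonoid; IsCommutativeRing)
open import Data.Bool.Base using (Bool; if_then_else_; true; false)
open import Data.Fin.Base as Fin using (Fin; toℕ; inject₁)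
open import Data.Integer.Base as ℤ using (-[1+_])
import Data.Integer.Properties as ℤₚ
open import Data.List.Base as List using (List; []; _∷_; _++_; map)
open import Data.List.Membership.Propositional using (_∈_; _∉_)
open import Data.List.Membership.Propositional.Properties
  using (∈-∃++; ∈-++⁺ˡ; ∈-++⁺ʳ; ∈-++⁻; ∈-map⁺; ∈-map⁻)
import Data.List.Properties as Listₚ
open import Data.List.Relation.Binary.Disjoint.Propositional using (Disjoint)
open import Data.List.Relation.Binary.Permutation.Propositional
  using (_↭_; ↭-refl; ↭-trans; ↭-prep; ↭-sym; ↭⇒↭ₛ)
open import Data.List.Relation.Binary.Permutation.Propositional.Properties as Permₚ
  using (∈-resp-↭; shift)
import Data.List.Relation.Binary.Permutation.Setoid.Properties as Permₛ
open import Data.List.Relation.Binary.Subset.Propositional using (_⊆_)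
import Data.List.Relation.Binary.Subset.Propositional.Properties as Subsetₚ
open import Data.List.Relation.Unary.All as ListAll using ([]; _∷_)
open import Data.List.Relation.Unary.AllPairs using ([]; _∷_)
open import Data.List.Relation.Unary.Any using (here; there)
open import Data.List.Relation.Unary.Unique.Propositional using (Unique)
open import Data.List.Relation.Unary.Unique.Propositional.Properties as Uniqueₚ
  using (Unique[x∷xs]⇒x∉xs)
open import Data.Nat.Base as ℕ using (ℕ; zero; suc; z≤n; s≤s)
open import Data.Nat.ListAction using () renaming (sum to sumℕ)
import Data.Nat.Properties as ℕₚ
import Data.Nat.Solver as ℕSolver
open import Data.Product.Base using (∃; _×_; _,_; proj₁; proj₂; Σ-syntax)
open import Data.Rational.Base as ℚ using (ℚ; 0ℚ; 1ℚ; ½; mkℚ)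
import Data.Rational.Base as Rat
import Data.Rational.Properties as ℚₚ
import Data.Rational.Solver as ℚSolver
import Data.Rational.Unnormalised.Base as ℚᵘ
import Data.Rational.Unnormalised.Properties as ℚᵘₚ
open import Data.Sum.Base using (_⊎_; inj₁; inj₂)
open import Data.Vec.Base as Vec using (Vec; []; _∷_; lookup)
import Data.Vec.Properties as Vecₚ
open import Data.Vec.Relation.Unary.All as VecAll using ([]; _∷_)
open import Data.Vec.Relation.Unary.Linked as Linked using (Linked; []; [-]; _∷_; linked?)
open import Function.Base using (_∘_)
open import Relation.Binary.PropositionalEquality
  using (_≡_; _≢_; refl; sym; trans; cong; cong₂; subst; subst₂; setoid; isEquivalence;
    module ≡-Reasoning)
open import Relation.Nullary using (yes; no; contradiction; does)
open import Relation.Nullary.Decidable using (dec-true; dec-false; recompute)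
open import Defs using (Cauchy; Eventually; module ℚ-Lemmas; module Cauchy-Lemmas; module Bisection)
open ℚ-Lemmas

-- The laws of arithmetic in ℂ are available only up to the equivalence `_≈_` of Cauchy sequences,
-- whereas at a fixed position k they are equalities of rationals, and finite identities can be
-- rewritten there. The price is uniformity. In `HasSum` the finite set F₀ is fixed before F, and
-- before the position k from which the strict inequality has to hold, so the constants must not
-- depend on k. The hypothesis on b yields a lower bound for 1 + b q^N only for each N separately,
-- from a position on that depends on N, and infinitely many such positions need not have a common
-- bound. Hence only finitely many N are treated in this way; for all others |b q^N| ≤ 1/2 gives a
-- lower bound directly.
--
-- The decay rate has the exponent 2N because a tail estimate spends the decay twice: once to make
-- the terms small and once to make them summable.

module _ {A : Set} where

  -- Duplicate-free lists

  Unique-resp-↭ : {xs ys : List A} → xs ↭ ys → Unique xs → Unique ys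
  Unique-resp-↭ p = Permₛ.Unique-resp-↭ (setoid A) (↭⇒↭ₛ p)

  -- Splits a sum over a larger finite set into the sum over the smaller one and a remainder. Used
  -- to detach a box from F, and to compare sums of nonnegative terms.
  Unique-⊆⇒↭ : {xs ys : List A} → Unique xs → xs ⊆ ys → ∃ λ zs → ys ↭ xs ++ zs
  Unique-⊆⇒↭ {ys = ys} [] _ = ys , ↭-refl
  Unique-⊆⇒↭ {x ∷ xs} (x∉ ∷ u) xs⊆ys
    with us , vs , refl ← ∈-∃++ (xs⊆ys (here refl)) =
    let zs , p = Unique-⊆⇒↭ u xs⊆us++vs
    in zs , ↭-trans (shift x us vs) (↭-prep x p)
    where
    xs⊆us++vs : xs ⊆ us ++ vs
    xs⊆us++vs y∈xs with ∈-resp-↭ (shift x us vs) (xs⊆ys (there y∈xs))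
    ... | here refl = contradiction refl (ListAll.lookup x∉ y∈xs)
    ... | there y∈  = y∈

  Unique-++⇒Disjoint : ∀ {ys} (xs : List A) → Unique (xs ++ ys) → Disjoint xs ys
  Unique-++⇒Disjoint (x ∷ xs) u@(_ ∷ _) (here refl , y∈ys) =
    Unique[x∷xs]⇒x∉xs u (∈-++⁺ʳ xs y∈ys)
  Unique-++⇒Disjoint (x ∷ xs) (_ ∷ u) (there y∈xs , y∈ys) =
    Unique-++⇒Disjoint xs u (y∈xs , y∈ys)

  Unique-++ʳ : ∀ (xs : List A) {ys} → Unique (xs ++ ys) → Unique ys
  Unique-++ʳ []       u       = u
  Unique-++ʳ (_ ∷ xs) (_ ∷ u) = Unique-++ʳ xs u

-- Boxes of sorted vectors

-- The sorted vectors with all entries in [a , a + d).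
box : ∀ r → ℕ → ℕ → List (Vec ℕ r)
box zero    a d       = [] ∷ []
box (suc r) a zero    = []
box (suc r) a (suc d) = map (a ∷_) (box r a (suc d)) ++ box (suc r) (suc a) d

Sorted : ∀ {r} → Vec ℕ r → Set
Sorted = Linked ℕ._≤_

-- `Sorted (a ∷ v)` packs the lower bound a together with the ordering of v, so that the induction
-- needs no separate statement about the head.
∈-box⁻ : ∀ r a d {v} → v ∈ box r a d → Sorted (a ∷ v)
∈-box⁻ zero a d (here refl) = [-]
∈-box⁻ (suc r) a (suc d) v∈ with ∈-++⁻ (map (a ∷_) (box r a (suc d))) v∈
... | inj₁ v∈ˡ with v , v∈′ , refl ← ∈-map⁻ (a ∷_) v∈ˡ = ℕₚ.≤-refl ∷ ∈-box⁻ r a (suc d) v∈′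
... | inj₂ v∈ʳ with ∈-box⁻ (suc r) (suc a) d v∈ʳ
...   | a<x ∷ s = ℕₚ.<⇒≤ a<x ∷ s

∈-box⁺ : ∀ r a d {v} → Sorted (a ∷ v) → VecAll.All (ℕ._< a ℕ.+ d) v → v ∈ box r a d
∈-box⁺ zero a d {[]} _ _ = here refl
∈-box⁺ (suc r) a zero (a≤x ∷ _) (x<a+0 ∷ _) =
  contradiction (subst (_ ℕ.<_) (ℕₚ.+-identityʳ a) x<a+0) (ℕₚ.≤⇒≯ a≤x)
∈-box⁺ (suc r) a (suc d) {x ∷ v} (a≤x ∷ s) (x< ∷ v<) with ℕₚ.m≤n⇒m<n∨m≡n a≤x
... | inj₁ a<x = ∈-++⁺ʳ (map (a ∷_) (box r a (suc d)))
      (∈-box⁺ (suc r) (suc a) d (a<x ∷ s)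
        (subst (λ n → VecAll.All (ℕ._< n) (x ∷ v)) (ℕₚ.+-suc a d) (x< ∷ v<)))
... | inj₂ refl = ∈-++⁺ˡ (∈-map⁺ (a ∷_) (∈-box⁺ r a (suc d) s v<))

head-box : ∀ r a d {x} {v : Vec ℕ r} → x ∷ v ∈ box (suc r) a d → a ℕ.≤ x
head-box r a d v∈ with ∈-box⁻ (suc r) a d v∈
... | a≤x ∷ _ = a≤x

box-Unique : ∀ r a d → Unique (box r a d)
box-Unique zero    a d       = [] ∷ []
box-Unique (suc r) a zero    = []
box-Unique (suc r) a (suc d) = Uniqueₚ.++⁺
  (Uniqueₚ.map⁺ Vecₚ.∷-injectiveʳ (box-Unique r a (suc d)))
  (box-Unique (suc r) (suc a) d)
  disjoint
  where
  disjoint : Disjoint (map (a ∷_) (box r a (suc d))) (box (suc r) (suc a) d)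
  disjoint (v∈ , v∈′) with v , _ , refl ← ∈-map⁻ (a ∷_) v∈ =
    contradiction (head-box r (suc a) d v∈′) (ℕₚ.<-irrefl refl)

0∷-Sorted : ∀ {r} {v : Vec ℕ r} → Sorted v → Sorted (0 ∷ v)
0∷-Sorted []        = [-]
0∷-Sorted [-]       = z≤n ∷ [-]
0∷-Sorted s@(_ ∷ _) = z≤n ∷ s

entries<⊎≤sum : ∀ d {r} (v : Vec ℕ r) → VecAll.All (ℕ._< d) v ⊎ d ℕ.≤ Vec.sum v
entries<⊎≤sum d [] = inj₁ []
entries<⊎≤sum d (x ∷ v) with x ℕₚ.<? d | entries<⊎≤sum d v
... | yes x<d | inj₁ v<d = inj₁ (x<d ∷ v<d)
... | yes x<d | inj₂ d≤ = inj₂ (ℕₚ.≤-trans d≤ (ℕₚ.m≤n+m _ x))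
... | no x≮d  | _ = inj₂ (ℕₚ.≤-trans (ℕₚ.≮⇒≥ x≮d) (ℕₚ.m≤m+n x _))

-- A single entry ≥ d already makes the sum ≥ d. This turns lying outside a box into a factor τ^d.
∉-box⇒≤sum : ∀ {r} d (v : Vec ℕ r) → Sorted v → v ∉ box r 0 d → d ℕ.≤ Vec.sum v
∉-box⇒≤sum {r} d v s v∉ with entries<⊎≤sum d v
... | inj₁ v<d = contradiction (∈-box⁺ r 0 d (0∷-Sorted s) v<d) v∉
... | inj₂ d≤ = d≤

box-bound : ∀ {r} (vs : List (Vec ℕ r)) → (∀ {v} → v ∈ vs → Sorted v) →
  ∃ λ d → vs ⊆ box r 0 d
box-bound [] _ = 0 , λ ()
box-bound {r} (v ∷ vs) s = d , sub
  where
  -- Exceeds the sum of each listed vector, so the second alternative of `entries<⊎≤sum` cannot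
  -- occur.
  d = suc (sumℕ (map Vec.sum (v ∷ vs)))
  sum≤ : ∀ {w} ws → w ∈ ws → Vec.sum {r} w ℕ.≤ sumℕ (map Vec.sum ws)
  sum≤ (_ ∷ ws) (here refl) = ℕₚ.m≤m+n _ _
  sum≤ (_ ∷ ws) (there w∈) = ℕₚ.≤-trans (sum≤ ws w∈) (ℕₚ.m≤n+m _ _)
  sub : (v ∷ vs) ⊆ box r 0 d
  sub {w} w∈ with entries<⊎≤sum d w
  ... | inj₁ w<d = ∈-box⁺ r 0 d (0∷-Sorted (s w∈)) w<d
  ... | inj₂ d≤ = contradiction (sum≤ (v ∷ vs) w∈) (ℕₚ.<⇒≱ d≤)

-- Powers of rationals and their decay

module ℚ-Powers where
  open Rat hiding (ℚ; 0ℚ; 1ℚ; ½; mkℚ)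
  open Exp (CommutativeRing.semiring ℚₚ.+-*-commutativeRing) public using (_^_; ^-homo-*; ^-assocʳ)
  open ℚSolver.+-*-Solver

  *-monoˡ-≤ : ∀ {r p q} → 0ℚ ≤ r → p ≤ q → r * p ≤ r * q
  *-monoˡ-≤ {r} 0≤r = ℚₚ.*-monoˡ-≤-nonNeg r ⦃ ℚ.nonNegative 0≤r ⦄

  *-monoʳ-≤ : ∀ {r p q} → 0ℚ ≤ r → p ≤ q → p * r ≤ q * r
  *-monoʳ-≤ {r} 0≤r = ℚₚ.*-monoʳ-≤-nonNeg r ⦃ ℚ.nonNegative 0≤r ⦄

  0≤1 : 0ℚ ≤ 1ℚ
  0≤1 = ℚₚ.<⇒≤ 0<1

  p≤q⇒0≤q-p : ∀ {p q} → p ≤ q → 0ℚ ≤ q - p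
  p≤q⇒0≤q-p {p} {q} p≤q = subst (_≤ q - p) (ℚₚ.+-inverseʳ p) (ℚₚ.+-monoˡ-≤ (- p) p≤q)

  p<q⇒0<q-p : ∀ {p q} → p < q → 0ℚ < q - p
  p<q⇒0<q-p {p} {q} p<q = subst (_< q - p) (ℚₚ.+-inverseʳ p) (ℚₚ.+-monoˡ-< (- p) p<q)

  ^-nonNeg : ∀ {τ} → 0ℚ ≤ τ → ∀ n → 0ℚ ≤ τ ^ n
  ^-nonNeg 0≤τ zero    = 0≤1
  ^-nonNeg 0≤τ (suc n) = nonNeg* 0≤τ (^-nonNeg 0≤τ n)

  ^-mono-≤ : ∀ {σ τ} → 0ℚ ≤ σ → σ ≤ τ → ∀ n → σ ^ n ≤ τ ^ n
  ^-mono-≤ 0≤σ σ≤τ zero    = ℚₚ.≤-refl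
  ^-mono-≤ 0≤σ σ≤τ (suc n) = *-mono 0≤σ (^-nonNeg (ℚₚ.≤-trans 0≤σ σ≤τ) n) σ≤τ (^-mono-≤ 0≤σ σ≤τ n)

  ^-antimono-≤ : ∀ {τ} → 0ℚ ≤ τ → τ ≤ 1ℚ → ∀ {m n} → m ℕ.≤ n → τ ^ n ≤ τ ^ m
  ^-antimono-≤ {τ} 0≤τ τ≤1 {n = n} (z≤n) = go n
    where
    go : ∀ n → τ ^ n ≤ 1ℚ
    go zero    = ℚₚ.≤-refl
    go (suc n) = subst (τ * τ ^ n ≤_) (ℚₚ.*-identityˡ 1ℚ) (*-mono 0≤τ 0≤1 τ≤1 (go n))
  ^-antimono-≤ 0≤τ τ≤1 (s≤s m≤n) = *-monoˡ-≤ 0≤τ (^-antimono-≤ 0≤τ τ≤1 m≤n)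

  ^-distrib-* : ∀ σ τ n → (σ * τ) ^ n ≡ σ ^ n * τ ^ n
  ^-distrib-* σ τ zero    = refl
  ^-distrib-* σ τ (suc n) = trans (cong (σ * τ *_) (^-distrib-* σ τ n))
    (solve 4 (λ s t x y → s :* t :* (x :* y) := s :* x :* (t :* y)) refl σ τ (σ ^ n) (τ ^ n))

  fromℕ : ℕ → ℚ
  fromℕ zero    = 0ℚ
  fromℕ (suc n) = 1ℚ + fromℕ n

  fromℕ-nonNeg : ∀ n → 0ℚ ≤ fromℕ n
  fromℕ-nonNeg zero    = ℚₚ.≤-refl
  fromℕ-nonNeg (suc n) = nonNeg+ 0≤1 (fromℕ-nonNeg n)

  toℚᵘ-fromℕ : ∀ n → toℚᵘ (fromℕ n) ℚᵘ.≃ ℚᵘ.mkℚᵘ (ℤ.+ n) 0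
  toℚᵘ-fromℕ zero    = ℚᵘₚ.≃-refl
  toℚᵘ-fromℕ (suc n) = ℚᵘₚ.≃-trans (ℚₚ.toℚᵘ-homo-+ 1ℚ (fromℕ n))
    (ℚᵘₚ.≃-trans (ℚᵘₚ.+-congʳ ℚᵘ.1ℚᵘ (toℚᵘ-fromℕ n))
      (ℚᵘ.*≡* (cong (ℤ._* ℤ.+ 1) (cong (λ k → ℤ.+ 1 ℤ.+ k) (ℤₚ.*-identityʳ (ℤ.+ n))))))

  archimedean : ∀ p → ∃ λ n → p ≤ fromℕ n
  archimedean p@(mkℚ -[1+ _ ] _ _) = 0 , ℚₚ.<⇒≤ (ℚₚ.negative⁻¹ p)
  archimedean   (mkℚ (ℤ.+ a)    _ _) = a , ℚₚ.toℚᵘ-cancel-≤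
    (ℚᵘₚ.≤-respʳ-≃ (ℚᵘₚ.≃-sym (toℚᵘ-fromℕ a))
      (ℚᵘ.*≤* (ℤₚ.*-monoˡ-≤-nonNeg (ℤ.+ a) (ℤ.+≤+ (s≤s z≤n)))))

  module _ {τ} (0≤τ : 0ℚ ≤ τ) (τ<1 : τ < 1ℚ) where
    private
      0<1-τ = p<q⇒0<q-p τ<1
      open ℚₚ.≤-Reasoning

    -- n τⁿ ≤ 1 + τ + ⋯ + τⁿ⁻¹ = (1 - τⁿ) / (1 - τ)
    n[1-τ]τⁿ≤1-τⁿ : ∀ n → fromℕ n * (1ℚ - τ) * τ ^ n ≤ 1ℚ - τ ^ n
    n[1-τ]τⁿ≤1-τⁿ zero = ℚₚ.≤-reflexive
      (solve 1 (λ t → con 0ℚ :* (con 1ℚ :- t) :* con 1ℚ := con 1ℚ :- con 1ℚ) refl τ)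
    n[1-τ]τⁿ≤1-τⁿ (suc n) = begin
      (1ℚ + k) * (1ℚ - τ) * (τ * t)
        ≡⟨ solve 3 (λ k τ t → (con 1ℚ :+ k) :* (con 1ℚ :- τ) :* (τ :* t) :=
             τ :* ((con 1ℚ :- τ) :* t :+ k :* (con 1ℚ :- τ) :* t)) refl k τ t ⟩
      τ * ((1ℚ - τ) * t + k * (1ℚ - τ) * t)
        ≤⟨ *-monoʳ-≤ (nonNeg+ (nonNeg* 0≤1-τ 0≤t) (nonNeg* (nonNeg* (fromℕ-nonNeg n) 0≤1-τ) 0≤t))
             (ℚₚ.<⇒≤ τ<1) ⟩
      1ℚ * ((1ℚ - τ) * t + k * (1ℚ - τ) * t)
        ≤⟨ *-monoˡ-≤ 0≤1 (ℚₚ.+-monoʳ-≤ ((1ℚ - τ) * t) (n[1-τ]τⁿ≤1-τⁿ n)) ⟩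
      1ℚ * ((1ℚ - τ) * t + (1ℚ - t))
        ≡⟨ solve 2 (λ τ t → con 1ℚ :* ((con 1ℚ :- τ) :* t :+ (con 1ℚ :- t)) :=
             con 1ℚ :- τ :* t) refl τ t ⟩
      1ℚ - τ * t ∎
      where
      k = fromℕ n
      t = τ ^ n
      0≤t = ^-nonNeg 0≤τ n
      0≤1-τ = ℚₚ.<⇒≤ 0<1-τ

    -- Since n (1 - τ) τ^n ≤ 1, every N ≥ A / (ε (1 - τ)) makes A τ^N ≤ ε.
    *^→0 : ∀ {A ε} → 0ℚ ≤ A → 0ℚ < ε → ∃ λ N → ∀ n → N ℕ.≤ n → A * τ ^ n ≤ ε
    *^→0 {A} {ε} 0≤A 0<ε = N , λ n N≤n → begin
      A * τ ^ n         ≤⟨ *-monoˡ-≤ 0≤A (^-antimono-≤ 0≤τ (ℚₚ.<⇒≤ τ<1) N≤n) ⟩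
      A * τ ^ N         ≡⟨ cong (_* τ ^ N) (sym (ℚₚ.*-identityʳ A)) ⟩
      A * 1ℚ * τ ^ N    ≡⟨ cong (λ r → A * r * τ ^ N) (sym (*-inv₀ (pos⇒≢0 0<δ))) ⟩
      A * (δ * inv₀ δ) * τ ^ N
        ≡⟨ solve 5 (λ a e t i h → a :* ((e :* t) :* i) :* h := e :* ((a :* i) :* t :* h))
             refl A ε (1ℚ - τ) (inv₀ δ) (τ ^ N) ⟩
      ε * (A * inv₀ δ * (1ℚ - τ) * τ ^ N)
        ≤⟨ *-monoˡ-≤ (ℚₚ.<⇒≤ 0<ε) (*-monoʳ-≤ (^-nonNeg 0≤τ N)
             (*-monoʳ-≤ (ℚₚ.<⇒≤ 0<1-τ) (proj₂ (archimedean (A * inv₀ δ))))) ⟩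
      ε * (fromℕ N * (1ℚ - τ) * τ ^ N)
        ≤⟨ *-monoˡ-≤ (ℚₚ.<⇒≤ 0<ε) (n[1-τ]τⁿ≤1-τⁿ N) ⟩
      ε * (1ℚ - τ ^ N)
        ≤⟨ *-monoˡ-≤ (ℚₚ.<⇒≤ 0<ε) (ℚₚ.+-monoʳ-≤ 1ℚ (ℚₚ.neg-antimono-≤ (^-nonNeg 0≤τ N))) ⟩
      ε * (1ℚ - 0ℚ)     ≡⟨ solve 1 (λ e → e :* (con 1ℚ :- con 0ℚ) := e) refl ε ⟩
      ε ∎
      where
      δ = ε * (1ℚ - τ)
      0<δ = pos* 0<ε 0<1-τ
      N = proj₁ (archimedean (A * inv₀ δ))

-- Finite sums over lists

module ListSum {A : Set} {_∙_ : A → A → A} {ε : A}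
  (isCommutativeMonoid : IsCommutativeMonoid _≡_ _∙_ ε) where
  open IsCommutativeMonoid isCommutativeMonoid using (assoc; identityˡ)

  ∑ : {I : Set} → (I → A) → List I → A
  ∑ f xs = List.foldr _∙_ ε (map f xs)

  module _ {I : Set} where

    ∑-cong-∈ : ∀ {f g : I → A} xs → (∀ {x} → x ∈ xs → f x ≡ g x) → ∑ f xs ≡ ∑ g xs
    ∑-cong-∈ []       h = refl
    ∑-cong-∈ (x ∷ xs) h = cong₂ _∙_ (h (here refl)) (∑-cong-∈ xs λ x∈ → h (there x∈))

    ∑-++ : ∀ (f : I → A) xs ys → ∑ f (xs ++ ys) ≡ ∑ f xs ∙ ∑ f ys
    ∑-++ f []       ys = sym (identityˡ (∑ f ys))
    ∑-++ f (x ∷ xs) ys = trans (cong (f x ∙_) (∑-++ f xs ys)) (sym (assoc (f x) _ _))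

    ∑-map : ∀ {J : Set} (f : I → A) (g : J → I) xs → ∑ f (map g xs) ≡ ∑ (λ x → f (g x)) xs
    ∑-map f g xs = cong (List.foldr _∙_ ε) (sym (Listₚ.map-∘ xs))

    ∑-↭ : ∀ (f : I → A) {xs ys} → xs ↭ ys → ∑ f xs ≡ ∑ f ys
    ∑-↭ f p = Permₛ.foldr-commMonoid (setoid A) isCommutativeMonoid (↭⇒↭ₛ (Permₚ.map⁺ f p))

module ℚ-Sums where
  open Rat hiding (ℚ; 0ℚ; 1ℚ; ½; mkℚ)
  open ℚ-Powers
  open ListSum ℚₚ.+-0-isCommutativeMonoid public

  module _ {I : Set} where

    ∑-mono : ∀ {f g : I → ℚ} xs → (∀ {x} → x ∈ xs → f x ≤ g x) → ∑ f xs ≤ ∑ g xs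
    ∑-mono []       h = ℚₚ.≤-refl
    ∑-mono (x ∷ xs) h = ℚₚ.+-mono-≤ (h (here refl)) (∑-mono xs λ x∈ → h (there x∈))

    ∑-nonNeg : ∀ {f : I → ℚ} → (∀ x → 0ℚ ≤ f x) → ∀ xs → 0ℚ ≤ ∑ f xs
    ∑-nonNeg h []       = ℚₚ.≤-refl
    ∑-nonNeg h (x ∷ xs) = nonNeg+ (h x) (∑-nonNeg h xs)

    ∑-*ˡ : ∀ c (f : I → ℚ) xs → ∑ (λ x → c * f x) xs ≡ c * ∑ f xs
    ∑-*ˡ c f []       = sym (ℚₚ.*-zeroʳ c)
    ∑-*ˡ c f (x ∷ xs) = trans (cong (_+_ (c * f x)) (∑-*ˡ c f xs)) (sym (ℚₚ.*-distribˡ-+ c (f x) (∑ f xs)))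

    ∑-⊆-≤ : ∀ {f : I → ℚ} → (∀ x → 0ℚ ≤ f x) → ∀ {xs ys} → Unique xs → xs ⊆ ys → ∑ f xs ≤ ∑ f ys
    ∑-⊆-≤ {f} 0≤f {xs} {ys} u xs⊆ys with zs , p ← Unique-⊆⇒↭ u xs⊆ys =
      subst (∑ f xs ≤_) (sym (trans (∑-↭ f p) (∑-++ f xs zs))) (p≤p+nonNeg (∑-nonNeg 0≤f zs))

  -- H is the sum of the geometric series 1 + τ + τ² + ⋯
  module _ {τ H} (0≤τ : 0ℚ ≤ τ) (τ≤1 : τ ≤ 1ℚ) (0≤H : 0ℚ ≤ H) (H≡1+τH : H ≡ 1ℚ + τ * H) where
    private
      g : ∀ {r} → Vec ℕ r → ℚ
      g v = τ ^ Vec.sum v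
      open ℚSolver.+-*-Solver
      open ℚₚ.≤-Reasoning

    ∑-box-≤ : ∀ r a d → ∑ g (box r a d) ≤ H ^ r
    -- Independent of d, hence usable for boxes of any size. The factor τ^a closes the induction:
    -- vectors with head a contribute at most τ^a H^r, the others at most τ^(a+1) H^(r+1), and H = 1
    -- + τ H adds these up to τ^a H^(r+1).
    ∑-box-≤′ : ∀ r a d → ∑ g (box (suc r) a d) ≤ τ ^ a * H ^ suc r

    ∑-box-≤ zero a d = ℚₚ.≤-refl
    ∑-box-≤ (suc r) a d = ℚₚ.≤-trans (∑-box-≤′ r a d)
      (subst (τ ^ a * H ^ suc r ≤_) (ℚₚ.*-identityˡ (H ^ suc r))
        (*-monoʳ-≤ (^-nonNeg 0≤H (suc r)) (^-antimono-≤ 0≤τ τ≤1 (z≤n {a}))))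

    ∑-box-≤′ r a zero = nonNeg* (^-nonNeg 0≤τ a) (^-nonNeg 0≤H (suc r))
    ∑-box-≤′ r a (suc d) = begin
      ∑ g (map (a ∷_) (box r a (suc d)) ++ box (suc r) (suc a) d)
        ≡⟨ ∑-++ g (map (a ∷_) (box r a (suc d))) (box (suc r) (suc a) d) ⟩
      ∑ g (map (a ∷_) (box r a (suc d))) + ∑ g (box (suc r) (suc a) d)
        ≡⟨ cong (_+ ∑ g (box (suc r) (suc a) d)) (trans (∑-map g (a ∷_) (box r a (suc d)))
             (trans (∑-cong-∈ (box r a (suc d)) (λ {v} _ → ^-homo-* τ a (Vec.sum v)))
               (∑-*ˡ (τ ^ a) g (box r a (suc d))))) ⟩
      τ ^ a * ∑ g (box r a (suc d)) + ∑ g (box (suc r) (suc a) d)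
        ≤⟨ ℚₚ.+-mono-≤ (*-monoˡ-≤ (^-nonNeg 0≤τ a) (∑-box-≤ r a (suc d))) (∑-box-≤′ r (suc a) d) ⟩
      τ ^ a * H ^ r + τ * τ ^ a * (H * H ^ r)
        ≡⟨ solve 4 (λ t x h y → x :* y :+ t :* x :* (h :* y) := x :* ((con 1ℚ :+ t :* h) :* y))
             refl τ (τ ^ a) H (H ^ r) ⟩
      τ ^ a * ((1ℚ + τ * H) * H ^ r)
        ≡⟨ cong (λ h → τ ^ a * (h * H ^ r)) (sym H≡1+τH) ⟩
      τ ^ a * H ^ suc r ∎

-- Commutative rings with a rational-valued norm

record NormedRing : Set₁ where
  infixl 6 _+_
  infixl 7 _*_
  infix 8 -_
  field
    Carrier : Set
    _+_ _*_ : Carrier → Carrier → Carrier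
    -_      : Carrier → Carrier
    0# 1#   : Carrier
    isCommutativeRing : IsCommutativeRing _≡_ _+_ _*_ -_ 0# 1#
    -- Rational values and mere submultiplicativity admit |Re| + |Im| on the Gaussian rationals; the
    -- Euclidean modulus would be irrational in general.
    ‖_‖       : Carrier → ℚ
    ‖‖-nonNeg : ∀ x → 0ℚ ℚ.≤ ‖ x ‖
    ‖0‖≡0     : ‖ 0# ‖ ≡ 0ℚ
    ‖-x‖≡‖x‖  : ∀ x → ‖ - x ‖ ≡ ‖ x ‖
    ‖1‖≤1     : ‖ 1# ‖ ℚ.≤ 1ℚ
    ‖+‖≤      : ∀ x y → ‖ x + y ‖ ℚ.≤ ‖ x ‖ ℚ.+ ‖ y ‖
    ‖*‖≤      : ∀ x y → ‖ x * y ‖ ℚ.≤ ‖ x ‖ ℚ.* ‖ y ‖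

  commutativeRing : CommutativeRing _ _
  commutativeRing = record { isCommutativeRing = isCommutativeRing }

  open CommutativeRing commutativeRing public
    using (commutativeSemiring; semiring; ring; +-abelianGroup; +-isCommutativeMonoid;
      *-identityˡ; *-identityʳ; +-identityʳ; +-identityˡ; *-assoc; *-comm; distribˡ; zeroʳ; -‿inverseʳ)
  open Exp semiring public using (_^_; ^-homo-*; ^-assocʳ)
  open ListSum +-isCommutativeMonoid public

  open RawSemiringOps (CommutativeSemiring.rawSemiring commutativeSemiring) public
    using () renaming (product to ∏)

  infixl 6 _-_
  _-_ : Carrier → Carrier → Carrier
  x - y = x + - y

  factor : Carrier → Carrier → ℕ → Carrier
  factor b q N = 1# + b * q ^ N

  cofactor : Carrier → ℕ → Carrier
  cofactor q N = 1# - q ^ N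

  open ℚ-Sums using () renaming (∑ to ∑ℚ)
  open SemiringSolver commutativeSemiring

  inverse-unique : ∀ {x y z} → x * y ≡ 1# → x * z ≡ 1# → y ≡ z
  inverse-unique {x} {y} {z} xy≡1 xz≡1 = begin
    y           ≡⟨ sym (*-identityˡ y) ⟩
    1# * y      ≡⟨ cong (_* y) (sym xz≡1) ⟩
    x * z * y   ≡⟨ solve 3 (λ x y z → x :* z :* y := x :* y :* z) refl x y z ⟩
    x * y * z   ≡⟨ cong (_* z) xy≡1 ⟩
    1# * z      ≡⟨ *-identityˡ z ⟩
    z           ∎
    where open ≡-Reasoning

  ∏-cong : ∀ {n} {x y : Fin n → Carrier} → (∀ i → x i ≡ y i) → ∏ x ≡ ∏ y
  ∏-cong {zero}  h = refl
  ∏-cong {suc n} h = cong₂ _*_ (h Fin.zero) (∏-cong λ i → h (Fin.suc i))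

  ∏-snoc : ∀ (h : ℕ → Carrier) n → ∏ {suc n} (λ i → h (toℕ i)) ≡ ∏ {n} (λ i → h (toℕ i)) * h n
  ∏-snoc h zero    = *-comm (h 0) 1#
  ∏-snoc h (suc n) = trans (cong (h 0 *_) (∏-snoc (λ i → h (suc i)) n)) (sym (*-assoc _ _ _))

  ∑-*ˡ : ∀ {I : Set} c (f : I → Carrier) xs → ∑ (λ x → c * f x) xs ≡ c * ∑ f xs
  ∑-*ˡ c f []       = sym (zeroʳ c)
  ∑-*ˡ c f (x ∷ xs) = trans (cong (_+_ (c * f x)) (∑-*ˡ c f xs)) (sym (distribˡ c (f x) (∑ f xs)))

  ‖∑‖≤ : ∀ {I : Set} (f : I → Carrier) xs → ‖ ∑ f xs ‖ ℚ.≤ ∑ℚ (λ x → ‖ f x ‖) xs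
  ‖∑‖≤ f []       = ℚₚ.≤-reflexive ‖0‖≡0
  ‖∑‖≤ f (x ∷ xs) = ℚₚ.≤-trans (‖+‖≤ (f x) (∑ f xs)) (ℚₚ.+-monoʳ-≤ ‖ f x ‖ (‖∑‖≤ f xs))

  ‖*‖-mono : ∀ {x y c d} → ‖ x ‖ ℚ.≤ c → ‖ y ‖ ℚ.≤ d → ‖ x * y ‖ ℚ.≤ c ℚ.* d
  ‖*‖-mono {x} {y} h k = ℚₚ.≤-trans (‖*‖≤ x y)
    (*-mono (‖‖-nonNeg x) (ℚₚ.≤-trans (‖‖-nonNeg y) k) h k)

  ‖x-x‖≡0 : ∀ x → ‖ x - x ‖ ≡ 0ℚ
  ‖x-x‖≡0 x = trans (cong ‖_‖ (-‿inverseʳ x)) ‖0‖≡0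

  ‖0-x‖≤ : ∀ x {c} → ‖ x ‖ ℚ.≤ c → ‖ 0# - x ‖ ℚ.≤ c
  ‖0-x‖≤ x h = subst (ℚ._≤ _) (sym (trans (cong ‖_‖ (+-identityˡ (- x))) (‖-x‖≡‖x‖ x))) h

  +-dist : ∀ {x y x′ y′ c d} → ‖ x - y ‖ ℚ.≤ c → ‖ x′ - y′ ‖ ℚ.≤ d →
    ‖ (x + x′) - (y + y′) ‖ ℚ.≤ c ℚ.+ d
  +-dist {x} {y} {x′} {y′} h k =
    subst (λ z → ‖ z ‖ ℚ.≤ _)
      (trans (solve 4 (λ x y x′ y′ → (x :+ y) :+ (x′ :+ y′) := (x :+ x′) :+ (y :+ y′)) refl x (- y) x′ (- y′))
        (cong (_+_ (x + x′)) (AbelianGroupₚ.⁻¹-∙-comm +-abelianGroup y y′)))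
      (ℚₚ.≤-trans (‖+‖≤ (x - y) (x′ - y′)) (ℚₚ.+-mono-≤ h k))

  *-dist : ∀ {w x y c d} → ‖ w ‖ ℚ.≤ c → ‖ x - y ‖ ℚ.≤ d → ‖ w * x - w * y ‖ ℚ.≤ c ℚ.* d
  *-dist {w} {x} {y} h k =
    subst (λ z → ‖ z ‖ ℚ.≤ _) (Ringₚ.x[y-z]≈xy-xz ring w x y) (‖*‖-mono h k)

-- What holds at all late positions with the same τ and B. Here `f⁻¹` and `g` stand for the inverses
-- of 1 + b q^N and 1 - q^N; they are constrained only from N = 1 on, as 1 - q^0 = 0.
record Controlled (R : NormedRing) (q b : NormedRing.Carrier R)
  (f⁻¹ g : ℕ → NormedRing.Carrier R) (τ B : ℚ) : Set where
  open NormedRing R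
  field
    f*f⁻¹    : ∀ N → 1 ℕ.≤ N → factor b q N * f⁻¹ N ≡ 1#
    [1-q^]*g : ∀ N → 1 ℕ.≤ N → cofactor q N * g N ≡ 1#
    ‖q^‖≤    : ∀ N → ‖ q ^ N ‖ ℚ.≤ B ℚ.* (τ ℚ.* τ) ℚ-Powers.^ N
    ‖f‖≤     : ∀ N → 1 ℕ.≤ N → ‖ factor b q N ‖ ℚ.≤ B
    ‖f⁻¹‖≤   : ∀ N → 1 ℕ.≤ N → ‖ f⁻¹ N ‖ ℚ.≤ B
    ‖g‖≤     : ∀ N → 1 ℕ.≤ N → ‖ g N ‖ ℚ.≤ B

-- Telescoping and the closed forms

shift-offset : ∀ X m a → suc (suc (X ℕ.+ m ℕ.+ a)) ≡ suc (X ℕ.+ a) ℕ.+ suc m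
shift-offset = solve 3 (λ X m a → con 2 :+ ((X :+ m) :+ a) := (con 1 :+ (X :+ a)) :+ (con 1 :+ m)) refl
  where open ℕSolver.+-*-Solver

1≤suc* : ∀ {m} r → 1 ℕ.≤ m → 1 ℕ.≤ suc r ℕ.* m
1≤suc* {m} r 1≤m = ℕₚ.≤-trans 1≤m (ℕₚ.m≤m+n m (r ℕ.* m))

module Telescoping (R : NormedRing) (m : ℕ) (q b : NormedRing.Carrier R)
  (f⁻¹ g : ℕ → NormedRing.Carrier R) where
  open NormedRing R
  open SemiringSolver commutativeSemiring

  f : ℕ → Carrier
  f N = factor b q N

  -- 1 / f X ⋯ f (X + l - 1)
  run : ℕ → ℕ → Carrier
  run X zero    = 1#
  run X (suc l) = f⁻¹ X * run (suc X) l

  -- 1 / (q^m ; q^m)_r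
  Q : ℕ → Carrier
  Q zero    = 1#
  Q (suc r) = g (suc r ℕ.* m) * Q r

  weight : ℕ → ℕ → Carrier
  weight X a = q ^ (m ℕ.* a) * run (suc (X ℕ.+ a)) (suc m)

  -- The offset X belongs to the second index of the pair: for a_{i+1} = a_i it is i m, and the
  -- value is the factor 1 + b q^(i m + 1 + a_i), which cancels one of its two copies in the
  -- denominator.
  collision : ∀ {r} → ℕ → ℕ → Vec ℕ r → Carrier
  collision X a []      = 1#
  collision X a (c ∷ _) = if does (c ℕₚ.≟ a) then f (suc (X ℕ.+ a)) else 1#

  -- The summand for a tail (a_{j+1} , … , a_n), where X = j m.  The repeated factor
  -- for a_{j+2} = a_{j+1} is attached to the second of the two indices.
  summand : ∀ {r} → ℕ → Vec ℕ r → Carrier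
  summand X []      = 1#
  summand X (a ∷ v) = weight X a * (collision (X ℕ.+ m) a v * summand (X ℕ.+ m) v)

  -- The values of partial r X a d and partial′ r X a d below as d → ∞.
  closed closed′ : ℕ → ℕ → ℕ → Carrier
  closed  r X a = q ^ (r ℕ.* m ℕ.* a) * Q r * run (suc (X ℕ.+ a)) (r ℕ.* m)
  closed′ r X a = q ^ (r ℕ.* m ℕ.* a) * Q r * run (suc (suc (X ℕ.+ a))) (r ℕ.* m)

  run-+ : ∀ X l l′ → run X (l ℕ.+ l′) ≡ run X l * run (X ℕ.+ l) l′
  run-+ X zero    l′ = trans (cong (λ Y → run Y l′) (sym (ℕₚ.+-identityʳ X))) (sym (*-identityˡ _))
  run-+ X (suc l) l′ = trans
    (cong (f⁻¹ X *_) (trans (run-+ (suc X) l l′)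
      (cong (λ Y → run (suc X) l * run Y l′) (sym (ℕₚ.+-suc X l)))))
    (sym (*-assoc _ _ _))

  collision-≡ : ∀ X a {r} (v : Vec ℕ r) → collision X a (a ∷ v) ≡ f (suc (X ℕ.+ a))
  collision-≡ X a v = cong (if_then f (suc (X ℕ.+ a)) else 1#) (dec-true (a ℕₚ.≟ a) refl)

  collision-≢ : ∀ X {a c r} (v : Vec ℕ r) → c ≢ a → collision X a (c ∷ v) ≡ 1#
  collision-≢ X {a} {c} v c≢a =
    cong (if_then f (suc (X ℕ.+ a)) else 1#) (dec-false (c ℕₚ.≟ a) c≢a)

  partial partial′ : ℕ → ℕ → ℕ → ℕ → Carrier
  partial  r X a d = ∑ (summand X) (box r a d)
  partial′ r X a d = ∑ (λ v → collision X a v * summand X v) (box r a d)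

  partial-suc : ∀ r X a d → partial (suc r) X a (suc d) ≡
    weight X a * partial′ r (X ℕ.+ m) a (suc d) + partial (suc r) X (suc a) d
  partial-suc r X a d = trans
    (∑-++ (summand X) (map (a ∷_) (box r a (suc d))) (box (suc r) (suc a) d))
    (cong (_+ partial (suc r) X (suc a) d)
      (trans (∑-map (summand X) (a ∷_) (box r a (suc d)))
             (∑-*ˡ (weight X a) _ (box r a (suc d)))))

  -- Only vectors with head a carry the repeated factor. The rest of the box starts above a, which
  -- is why `partial` rather than `partial′` remains as the second summand.
  partial′-suc : ∀ r X a d → partial′ (suc r) X a (suc d) ≡
    f (suc (X ℕ.+ a)) * (weight X a * partial′ r (X ℕ.+ m) a (suc d)) + partial (suc r) X (suc a) d
  partial′-suc r X a d = trans
    (∑-++ h (map (a ∷_) (box r a (suc d))) (box (suc r) (suc a) d))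
    (cong₂ _+_
      (trans (∑-map h (a ∷_) (box r a (suc d)))
        (trans (∑-cong-∈ (box r a (suc d)) λ {v} _ →
            cong (_* summand X (a ∷ v)) (collision-≡ X a v))
          (trans (∑-*ˡ (f (suc (X ℕ.+ a))) (λ v → summand X (a ∷ v)) (box r a (suc d)))
            (cong (f (suc (X ℕ.+ a)) *_) (∑-*ˡ (weight X a) _ (box r a (suc d)))))))
      (∑-cong-∈ (box (suc r) (suc a) d) off-diagonal))
    where
    h = λ (v : Vec ℕ (suc r)) → collision X a v * summand X v
    off-diagonal : ∀ {v} → v ∈ box (suc r) (suc a) d → h v ≡ summand X v
    off-diagonal {c ∷ v} v∈ = trans
      (cong (_* summand X (c ∷ v)) (collision-≢ X v (ℕₚ.<⇒≢ (head-box r (suc a) d v∈) ∘ sym)))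
      (*-identityˡ _)

  module _ (1≤m : 1 ℕ.≤ m) (f*f⁻¹ : ∀ N → 1 ℕ.≤ N → f N * f⁻¹ N ≡ 1#)
    -- The inverse of 1 - q^N in a form without subtraction, so that the telescoping equations
    -- become identities of commutative semirings, within reach of the solver.
    (g≡1+q^*g : ∀ N → 1 ℕ.≤ N → g N ≡ 1# + q ^ N * g N) where
    open ≡-Reasoning

    -- Together with `run-dropˡ` this expresses two overlapping runs of length l, starting at
    -- consecutive exponents, through their union of length l + 1, the common denominator for the
    -- telescoping.
    run-dropʳ : ∀ X l → run (suc X) l ≡ run (suc X) (suc l) * f (suc X ℕ.+ l)
    run-dropʳ X l = sym (begin
      run (suc X) (suc l) * f (suc X ℕ.+ l)
        ≡⟨ cong (λ k → run (suc X) k * f (suc X ℕ.+ l)) (ℕₚ.+-comm 1 l) ⟩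
      run (suc X) (l ℕ.+ 1) * f (suc X ℕ.+ l)
        ≡⟨ cong (_* f (suc X ℕ.+ l)) (run-+ (suc X) l 1) ⟩
      run (suc X) l * (f⁻¹ (suc X ℕ.+ l) * 1#) * f (suc X ℕ.+ l)
        ≡⟨ solve 3 (λ p i x → p :* (i :* con 1) :* x := p :* (x :* i)) refl
             (run (suc X) l) (f⁻¹ (suc X ℕ.+ l)) (f (suc X ℕ.+ l)) ⟩
      run (suc X) l * (f (suc X ℕ.+ l) * f⁻¹ (suc X ℕ.+ l))
        ≡⟨ cong (run (suc X) l *_) (f*f⁻¹ (suc X ℕ.+ l) (s≤s z≤n)) ⟩
      run (suc X) l * 1#
        ≡⟨ *-identityʳ _ ⟩
      run (suc X) l ∎)

    run-dropˡ : ∀ X l → run (suc (suc X)) l ≡ f (suc X) * run (suc X) (suc l)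
    run-dropˡ X l = sym (trans (sym (*-assoc _ _ _))
      (trans (cong (_* run (suc (suc X)) l) (f*f⁻¹ (suc X) (s≤s z≤n))) (*-identityˡ _)))

    module _ (r X a : ℕ) where
      private
        L = suc r ℕ.* m
        Y = X ℕ.+ a
        e = q ^ (L ℕ.* a)
        z = q ^ L
        y = q ^ suc Y
        p = run (suc Y) (suc L)

      -- The run of `weight X a` ends with the exponent X + m + a + 1, the one missing in `closed′`
      -- compared with `closed`. So the two runs are consecutive and join into one of length L + 1.
      weight*closed′ : weight X a * closed′ r (X ℕ.+ m) a ≡ e * Q r * p
      weight*closed′ = begin
        q ^ (m ℕ.* a) * run (suc Y) (suc m) *
          (q ^ (r ℕ.* m ℕ.* a) * Q r * run (suc (suc (X ℕ.+ m ℕ.+ a))) (r ℕ.* m))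
          ≡⟨ cong (λ k → q ^ (m ℕ.* a) * run (suc Y) (suc m) * (q ^ (r ℕ.* m ℕ.* a) * Q r * run k (r ℕ.* m)))
               (shift-offset X m a) ⟩
        q ^ (m ℕ.* a) * run (suc Y) (suc m) *
          (q ^ (r ℕ.* m ℕ.* a) * Q r * run (suc Y ℕ.+ suc m) (r ℕ.* m))
          ≡⟨ solve 5 (λ u p v c p′ → u :* p :* (v :* c :* p′) := u :* v :* c :* (p :* p′)) refl
               (q ^ (m ℕ.* a)) (run (suc Y) (suc m)) (q ^ (r ℕ.* m ℕ.* a)) (Q r) _ ⟩
        q ^ (m ℕ.* a) * q ^ (r ℕ.* m ℕ.* a) * Q r * (run (suc Y) (suc m) * run (suc Y ℕ.+ suc m) (r ℕ.* m))
          ≡⟨ cong₂ (λ s t → s * Q r * t)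
               (trans (sym (^-homo-* q (m ℕ.* a) _)) (cong (q ^_) (sym (ℕₚ.*-distribʳ-+ a m (r ℕ.* m)))))
               (sym (run-+ (suc Y) (suc m) (r ℕ.* m))) ⟩
        e * Q r * p ∎

      q^suc : q ^ (L ℕ.* suc a) ≡ z * e
      q^suc = trans (cong (q ^_) (ℕₚ.*-suc L a)) (^-homo-* q L (L ℕ.* a))

      f[Y+L] : f (suc Y ℕ.+ L) ≡ 1# + b * (y * z)
      f[Y+L] = cong (λ t → 1# + b * t) (^-homo-* q (suc Y) L)

      closed-next : closed (suc r) X (suc a) ≡ z * e * (g L * Q r) * (f (suc Y) * p)
      closed-next = cong₂ (λ s t → s * (g L * Q r) * t) q^suc
        (trans (cong (λ k → run (suc k) L) (ℕₚ.+-suc X a)) (run-dropˡ Y L))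

      closed-suc : closed (suc r) X a ≡
        weight X a * closed′ r (X ℕ.+ m) a + closed (suc r) X (suc a)
      closed-suc = begin
        e * (g L * Q r) * run (suc Y) L
          ≡⟨ cong (e * (g L * Q r) *_) (trans (run-dropʳ Y L) (cong (p *_) f[Y+L])) ⟩
        e * (g L * Q r) * (p * (1# + b * (y * z)))
          ≡⟨ solve 7 (λ e G c p b y z → e :* (G :* c) :* (p :* (con 1 :+ b :* (y :* z))) :=
               e :* (G :* c) :* p :+ e :* (G :* c) :* p :* b :* y :* z) refl e (g L) (Q r) p b y z ⟩
        e * (g L * Q r) * p + e * (g L * Q r) * p * b * y * z
          -- Only the summand free of b needs g = 1 + z g: the other one already contains z, and
          -- joins z g to form z g (1 + b y).
          ≡⟨ cong (λ G → e * (G * Q r) * p + e * (g L * Q r) * p * b * y * z) (g≡1+q^*g L (1≤suc* r 1≤m)) ⟩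
        e * ((1# + z * g L) * Q r) * p + e * (g L * Q r) * p * b * y * z
          ≡⟨ solve 7 (λ e G c p b y z →
               e :* ((con 1 :+ z :* G) :* c) :* p :+ e :* (G :* c) :* p :* b :* y :* z :=
               e :* c :* p :+ z :* e :* (G :* c) :* ((con 1 :+ b :* y) :* p)) refl e (g L) (Q r) p b y z ⟩
        e * Q r * p + z * e * (g L * Q r) * (f (suc Y) * p)
          ≡⟨ cong₂ _+_ (sym weight*closed′) (sym closed-next) ⟩
        weight X a * closed′ r (X ℕ.+ m) a + closed (suc r) X (suc a) ∎

      -- Without its first factor, the run on the left equals f (Y + 1) p, and so does the run of
      -- `closed` at a + 1. The equation thus reduces to g = 1 + z g, with no relation between
      -- different factors.
      closed′-suc : closed′ (suc r) X a ≡
        f (suc Y) * (weight X a * closed′ r (X ℕ.+ m) a) + closed (suc r) X (suc a)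
      closed′-suc = begin
        e * (g L * Q r) * run (suc (suc Y)) L
          ≡⟨ cong (e * (g L * Q r) *_) (run-dropˡ Y L) ⟩
        e * (g L * Q r) * (f (suc Y) * p)
          ≡⟨ cong (λ G → e * (G * Q r) * (f (suc Y) * p)) (g≡1+q^*g L (1≤suc* r 1≤m)) ⟩
        e * ((1# + z * g L) * Q r) * (f (suc Y) * p)
          ≡⟨ solve 6 (λ e G c p y z → e :* ((con 1 :+ z :* G) :* c) :* (y :* p) :=
               y :* (e :* c :* p) :+ z :* e :* (G :* c) :* (y :* p)) refl e (g L) (Q r) p (f (suc Y)) z ⟩
        f (suc Y) * (e * Q r * p) + z * e * (g L * Q r) * (f (suc Y) * p)
          ≡⟨ cong₂ (λ s t → f (suc Y) * s + t) (sym weight*closed′) (sym closed-next) ⟩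
        f (suc Y) * (weight X a * closed′ r (X ℕ.+ m) a) + closed (suc r) X (suc a) ∎

-- The summand and the closed form as products

module ℕ-Indices where
  open ℕSolver.+-*-Solver

  shift-block : ∀ X m j k a → X ℕ.+ (m ℕ.+ j ℕ.+ k ℕ.+ a) ≡ X ℕ.+ m ℕ.+ (j ℕ.+ k ℕ.+ a)
  shift-block = solve 5 (λ X m j k a → X :+ (m :+ j :+ k :+ a) := X :+ m :+ (j :+ k :+ a)) refl

  first-block : ∀ X k a → X ℕ.+ (suc k ℕ.+ a) ≡ suc (X ℕ.+ a) ℕ.+ k
  first-block = solve 3 (λ X k a → X :+ (con 1 :+ k :+ a) := con 1 :+ (X :+ a) :+ k) refl

  first-collision : ∀ X m a → X ℕ.+ (1 ℕ.* m ℕ.+ 1 ℕ.+ a) ≡ suc (X ℕ.+ m ℕ.+ a)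
  first-collision = solve 3 (λ X m a → X :+ (con 1 :* m :+ con 1 :+ a) := con 1 :+ (X :+ m :+ a)) refl

module Products (R : NormedRing) (m : ℕ) (q b : NormedRing.Carrier R)
  (f⁻¹ g : ℕ → NormedRing.Carrier R) where
  open NormedRing R
  open Telescoping R m q b f⁻¹ g
  open SemiringSolver commutativeSemiring
  open ℕ-Indices
  open ≡-Reasoning

  denominatorFactor : ∀ {r} → ℕ → Vec ℕ r → Fin r → Fin (suc m) → Carrier
  denominatorFactor X v j k = f (X ℕ.+ (toℕ j ℕ.* m ℕ.+ suc (toℕ k) ℕ.+ lookup v j))

  denominator : ∀ {r} → ℕ → Vec ℕ r → Carrier
  denominator X v = ∏ λ j → ∏ λ k → denominatorFactor X v j k

  repeated : ∀ {r} → ℕ → Vec ℕ (suc r) → Carrier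
  repeated {r} X v = ∏ {r} λ i →
    if does (lookup v (Fin.suc i) ℕₚ.≟ lookup v (inject₁ i))
    then f (X ℕ.+ (suc (toℕ i) ℕ.* m ℕ.+ 1 ℕ.+ lookup v (inject₁ i)))
    else 1#

  runs : ∀ {r} → ℕ → Vec ℕ r → Carrier
  runs X []      = 1#
  runs X (a ∷ v) = run (suc (X ℕ.+ a)) (suc m) * runs (X ℕ.+ m) v

  -- The repeated factor of the first two indices is the leading `collision`. For later pairs,
  -- lowering the offset from X + m to X while raising the position i by one leaves the exponents
  -- unchanged.
  summand-factored : ∀ X {r} (v : Vec ℕ (suc r)) →
    summand X v ≡ q ^ (m ℕ.* Vec.sum v) * runs X v * repeated X v
  summand-factored X (a ∷ []) = begin
    q ^ (m ℕ.* a) * run (suc (X ℕ.+ a)) (suc m) * (1# * 1#)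
      ≡⟨ cong (λ k → q ^ (m ℕ.* k) * run (suc (X ℕ.+ a)) (suc m) * (1# * 1#)) (sym (ℕₚ.+-identityʳ a)) ⟩
    q ^ (m ℕ.* (a ℕ.+ 0)) * run (suc (X ℕ.+ a)) (suc m) * (1# * 1#)
      ≡⟨ solve 2 (λ x p → x :* p :* (con 1 :* con 1) := x :* (p :* con 1) :* con 1) refl _ _ ⟩
    q ^ (m ℕ.* (a ℕ.+ 0)) * (run (suc (X ℕ.+ a)) (suc m) * 1#) * 1# ∎
  summand-factored X {suc r} (a ∷ v@(c ∷ _)) = begin
    q ^ (m ℕ.* a) * p * (collision (X ℕ.+ m) a v * summand (X ℕ.+ m) v)
      ≡⟨ cong₂ (λ s t → q ^ (m ℕ.* a) * p * (s * t))
           (cong (λ k → if does (c ℕₚ.≟ a) then f k else 1#) (sym (first-collision X m a)))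
           (summand-factored (X ℕ.+ m) v) ⟩
    q ^ (m ℕ.* a) * p * (C * (q ^ (m ℕ.* Vec.sum v) * runs (X ℕ.+ m) v * repeated (X ℕ.+ m) v))
      ≡⟨ solve 6 (λ x p C y s t → x :* p :* (C :* (y :* s :* t)) := x :* y :* (p :* s) :* (C :* t)) refl
           (q ^ (m ℕ.* a)) p C (q ^ (m ℕ.* Vec.sum v)) (runs (X ℕ.+ m) v) (repeated (X ℕ.+ m) v) ⟩
    q ^ (m ℕ.* a) * q ^ (m ℕ.* Vec.sum v) * (p * runs (X ℕ.+ m) v) * (C * repeated (X ℕ.+ m) v)
      ≡⟨ cong₂ (λ s t → s * (p * runs (X ℕ.+ m) v) * (C * t))
           (trans (sym (^-homo-* q (m ℕ.* a) (m ℕ.* Vec.sum v)))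
             (cong (q ^_) (sym (ℕₚ.*-distribˡ-+ m a (Vec.sum v)))))
           (∏-cong λ i → cong (λ k → if does (lookup v (Fin.suc i) ℕₚ.≟ lookup v (inject₁ i)) then f k else 1#)
             (sym (shift-block X m (suc (toℕ i) ℕ.* m) 1 (lookup v (inject₁ i))))) ⟩
    q ^ (m ℕ.* (a ℕ.+ Vec.sum v)) * (p * runs (X ℕ.+ m) v) * repeated X (a ∷ v) ∎
    where
    p = run (suc (X ℕ.+ a)) (suc m)
    C = if does (c ℕₚ.≟ a) then f (X ℕ.+ (1 ℕ.* m ℕ.+ 1 ℕ.+ a)) else 1#

  module _ (f*f⁻¹ : ∀ N → 1 ℕ.≤ N → factor b q N * f⁻¹ N ≡ 1#) where

    ∏*run : ∀ X l → ∏ {l} (λ k → f (suc X ℕ.+ toℕ k)) * run (suc X) l ≡ 1#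
    ∏*run X zero    = *-identityˡ 1#
    ∏*run X (suc l) = begin
      f (suc X ℕ.+ 0) * ∏ {l} (λ k → f (suc X ℕ.+ suc (toℕ k))) * (f⁻¹ (suc X) * run (suc (suc X)) l)
        ≡⟨ cong₂ (λ s t → f s * t * (f⁻¹ (suc X) * run (suc (suc X)) l)) (ℕₚ.+-identityʳ (suc X))
             (∏-cong {l} λ k → cong f (ℕₚ.+-suc (suc X) (toℕ k))) ⟩
      f (suc X) * P * (f⁻¹ (suc X) * run (suc (suc X)) l)
        ≡⟨ solve 4 (λ x y z w → x :* y :* (z :* w) := x :* z :* (y :* w)) refl (f (suc X)) P (f⁻¹ (suc X)) _ ⟩
      f (suc X) * f⁻¹ (suc X) * (P * run (suc (suc X)) l)
        ≡⟨ cong₂ _*_ (f*f⁻¹ (suc X) (s≤s z≤n)) (∏*run (suc X) l) ⟩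
      1# * 1#
        ≡⟨ *-identityˡ 1# ⟩
      1# ∎
      where P = ∏ {l} λ k → f (suc (suc X) ℕ.+ toℕ k)

    denominator*runs : ∀ X {r} (v : Vec ℕ r) → denominator X v * runs X v ≡ 1#
    denominator*runs X []      = *-identityˡ 1#
    denominator*runs X {suc r} (a ∷ v) = begin
      _
        ≡⟨ cong₂ (λ s t → s * t * (p * runs (X ℕ.+ m) v))
             (∏-cong {suc m} λ k → cong f (first-block X (toℕ k) a))
             (∏-cong {r} λ j → ∏-cong {suc m} λ k → cong f
               (shift-block X m (toℕ j ℕ.* m) (suc (toℕ k)) (lookup v j))) ⟩
      P * denominator (X ℕ.+ m) v * (p * runs (X ℕ.+ m) v)
        ≡⟨ solve 4 (λ x y z w → x :* y :* (z :* w) := x :* z :* (y :* w)) refl P (denominator (X ℕ.+ m) v) p _ ⟩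
      P * p * (denominator (X ℕ.+ m) v * runs (X ℕ.+ m) v)
        ≡⟨ cong₂ _*_ (∏*run (X ℕ.+ a) (suc m)) (denominator*runs (X ℕ.+ m) v) ⟩
      1# * 1#
        ≡⟨ *-identityˡ 1# ⟩
      1# ∎
      where
      p = run (suc (X ℕ.+ a)) (suc m)
      P = ∏ {suc m} λ k → f (suc (X ℕ.+ a) ℕ.+ toℕ k)

    module _ (1≤m : 1 ℕ.≤ m) ([1-q^]*g : ∀ N → 1 ℕ.≤ N → cofactor q N * g N ≡ 1#) where

      g≡1+q^*g : ∀ N → 1 ℕ.≤ N → g N ≡ 1# + q ^ N * g N
      g≡1+q^*g N 1≤N = sym (begin
        1# + q ^ N * g N
          ≡⟨ cong (_+ q ^ N * g N) (sym ([1-q^]*g N 1≤N)) ⟩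
        (1# - q ^ N) * g N + q ^ N * g N
          ≡⟨ solve 3 (λ x y g → (con 1 :+ y) :* g :+ x :* g := (con 1 :+ (x :+ y)) :* g) refl
               (q ^ N) (- q ^ N) (g N) ⟩
        (1# + (q ^ N - q ^ N)) * g N
          ≡⟨ cong (λ t → (1# + t) * g N) (-‿inverseʳ (q ^ N)) ⟩
        (1# + 0#) * g N
          ≡⟨ trans (cong (_* g N) (+-identityʳ 1#)) (*-identityˡ (g N)) ⟩
        g N ∎)

      ∏*Q : ∀ r → ∏ {r} (λ j → 1# - q ^ (suc (toℕ j) ℕ.* m)) * Q r ≡ 1#
      ∏*Q zero    = *-identityˡ 1#
      ∏*Q (suc r) = begin
        ∏ {suc r} (λ j → h (toℕ j)) * (g (suc r ℕ.* m) * Q r)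
          ≡⟨ cong (_* (g (suc r ℕ.* m) * Q r)) (∏-snoc h r) ⟩
        P * h r * (g (suc r ℕ.* m) * Q r)
          ≡⟨ solve 4 (λ x y z w → x :* y :* (z :* w) := (y :* z) :* (x :* w)) refl P (h r) (g (suc r ℕ.* m)) (Q r) ⟩
        h r * g (suc r ℕ.* m) * (P * Q r)
          ≡⟨ cong₂ _*_ ([1-q^]*g (suc r ℕ.* m) (1≤suc* r 1≤m)) (∏*Q r) ⟩
        1# * 1#
          ≡⟨ *-identityˡ 1# ⟩
        1# ∎
        where
        h : ℕ → Carrier
        h j = 1# - q ^ (suc j ℕ.* m)
        P = ∏ {r} λ j → h (toℕ j)

      -- Identifies `closed r 0 0` with the right-hand side of the theorem: at X = a = 0 the power
      -- of q is 1 and the run starts with 1 + b q.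
      ∏*∏*closed : ∀ r → ∏ {r} (λ j → 1# - q ^ (suc (toℕ j) ℕ.* m)) *
        ∏ {r ℕ.* m} (λ k → f (suc (toℕ k))) * closed r 0 0 ≡ 1#
      ∏*∏*closed r = begin
        P * P′ * (q ^ (r ℕ.* m ℕ.* 0) * Q r * run 1 (r ℕ.* m))
          ≡⟨ cong (λ k → P * P′ * (q ^ k * Q r * run 1 (r ℕ.* m))) (ℕₚ.*-zeroʳ (r ℕ.* m)) ⟩
        P * P′ * (1# * Q r * run 1 (r ℕ.* m))
          ≡⟨ solve 4 (λ x y z w → x :* y :* (con 1 :* z :* w) := (x :* z) :* (y :* w)) refl P P′ (Q r) _ ⟩
        P * Q r * (P′ * run 1 (r ℕ.* m))
          ≡⟨ cong₂ _*_ (∏*Q r) (∏*run 0 (r ℕ.* m)) ⟩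
        1# * 1#
          ≡⟨ *-identityˡ 1# ⟩
        1# ∎
        where
        P  = ∏ {r} λ j → 1# - q ^ (suc (toℕ j) ℕ.* m)
        P′ = ∏ {r ℕ.* m} λ k → f (suc (toℕ k))

-- Error estimates for finite partial sums

module ErrorConstants (m : ℕ) (B H : ℚ) where
  open Rat hiding (ℚ; 0ℚ; 1ℚ; ½; mkℚ)
  open ℚ-Powers

  -- W and K bound ‖weight X a‖ and ‖closed (suc r) X a‖ up to a factor τ^a, V bounds
  -- ‖summand X v‖ up to τ^(2 sum v), and D (for suc r) and D′ (for r) bound the
  -- distances of partial and partial′ from their limits up to τ^(a + d).
  W : ℚ
  W = B * B ^ suc m

  K D D′ V E : ℕ → ℚ
  K r = B * B ^ suc r * B ^ (suc r ℕ.* m)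
  D r = K r + H * (W * D′ r)
  D′ zero    = 0ℚ
  D′ (suc r) = B * (W * D′ r) + D r
  V zero    = 1ℚ
  V (suc r) = W * (B * V r)
  E r = D r + V (suc r) * H ^ suc r

  module _ (0≤B : 0ℚ ≤ B) (0≤H : 0ℚ ≤ H) where

    W-nonNeg : 0ℚ ≤ W
    W-nonNeg = nonNeg* 0≤B (^-nonNeg 0≤B (suc m))

    K-nonNeg : ∀ r → 0ℚ ≤ K r
    K-nonNeg r = nonNeg* (nonNeg* 0≤B (^-nonNeg 0≤B (suc r))) (^-nonNeg 0≤B (suc r ℕ.* m))

    D-nonNeg : ∀ r → 0ℚ ≤ D r
    D′-nonNeg : ∀ r → 0ℚ ≤ D′ r
    D-nonNeg r = nonNeg+ (K-nonNeg r) (nonNeg* 0≤H (nonNeg* W-nonNeg (D′-nonNeg r)))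
    D′-nonNeg zero    = ℚₚ.≤-refl
    D′-nonNeg (suc r) = nonNeg+ (nonNeg* 0≤B (nonNeg* W-nonNeg (D′-nonNeg r))) (D-nonNeg r)

    V-nonNeg : ∀ r → 0ℚ ≤ V r
    V-nonNeg zero    = 0≤1
    V-nonNeg (suc r) = nonNeg* W-nonNeg (nonNeg* 0≤B (V-nonNeg r))

    E-nonNeg : ∀ r → 0ℚ ≤ E r
    E-nonNeg r = nonNeg+ (D-nonNeg r) (nonNeg* (V-nonNeg (suc r)) (^-nonNeg 0≤H (suc r)))

module Truncation (R : NormedRing) (m : ℕ) (q b : NormedRing.Carrier R)
  (f⁻¹ g : ℕ → NormedRing.Carrier R) (τ B H : ℚ)
  (0≤τ : 0ℚ ℚ.≤ τ) (τ≤1 : τ ℚ.≤ 1ℚ) (1≤B : 1ℚ ℚ.≤ B) (0≤H : 0ℚ ℚ.≤ H)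
  (H≡1+τH : H ≡ 1ℚ ℚ.+ τ ℚ.* H) where

  open NormedRing R using (Carrier; ‖_‖; ‖1‖≤1; ‖+‖≤; ‖*‖-mono; ‖x-x‖≡0; ‖0-x‖≤; +-dist; *-dist;
    ∑-++; ∑-↭; ‖∑‖≤; ∑; 1#; 0#; commutativeSemiring; *-identityʳ; +-identityʳ)
    renaming (_^_ to _^ᴿ_; _-_ to _-ᴿ_; _*_ to _*ᴿ_; _+_ to _+ᴿ_; -_ to -ᴿ_)
  open Telescoping R m q b f⁻¹ g
  open ErrorConstants m B H
  open Rat hiding (ℚ; 0ℚ; 1ℚ; ½; mkℚ)
  open ℚ-Powers
  open ℚSolver.+-*-Solver
  open ℚₚ.≤-Reasoning

  module _ (1≤m : 1 ℕ.≤ m) (controlled : Controlled R q b f⁻¹ g τ B) where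
    open Controlled controlled

    private
      g≡1+q^*g : ∀ N → 1 ℕ.≤ N → g N ≡ 1# +ᴿ q ^ᴿ N *ᴿ g N
      g≡1+q^*g = Products.g≡1+q^*g R m q b f⁻¹ g f*f⁻¹ 1≤m [1-q^]*g

      0≤B : 0ℚ ≤ B
      0≤B = ℚₚ.≤-trans 0≤1 1≤B

      0≤τ² : 0ℚ ≤ τ * τ
      0≤τ² = nonNeg* 0≤τ 0≤τ

      τ²≤τ : τ * τ ≤ τ
      τ²≤τ = subst (τ * τ ≤_) (ℚₚ.*-identityʳ τ) (*-monoˡ-≤ 0≤τ τ≤1)

    ‖q^*‖≤ : ∀ j a → 1 ℕ.≤ j → ‖ q ^ᴿ (j ℕ.* a) ‖ ≤ B * (τ * τ) ^ a
    ‖q^*‖≤ (suc j) a _ = ℚₚ.≤-trans (‖q^‖≤ (suc j ℕ.* a))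
      (*-monoˡ-≤ 0≤B (^-antimono-≤ 0≤τ² (ℚₚ.≤-trans τ²≤τ τ≤1) (ℕₚ.m≤m+n a (j ℕ.* a))))

    ‖run‖≤ : ∀ X l → ‖ run (suc X) l ‖ ≤ B ^ l
    ‖run‖≤ X zero    = ‖1‖≤1
    ‖run‖≤ X (suc l) = ‖*‖-mono (‖f⁻¹‖≤ (suc X) (s≤s z≤n)) (‖run‖≤ (suc X) l)

    ‖Q‖≤ : ∀ r → ‖ Q r ‖ ≤ B ^ r
    ‖Q‖≤ zero    = ‖1‖≤1
    ‖Q‖≤ (suc r) = ‖*‖-mono (‖g‖≤ (suc r ℕ.* m) (1≤suc* r 1≤m)) (‖Q‖≤ r)

    ‖weight‖≤ : ∀ X a → ‖ weight X a ‖ ≤ W * (τ * τ) ^ a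
    ‖weight‖≤ X a = ℚₚ.≤-trans
      (‖*‖-mono (‖q^*‖≤ m a 1≤m) (‖run‖≤ (X ℕ.+ a) (suc m)))
      (ℚₚ.≤-reflexive (solve 3 (λ x y z → x :* y :* z := x :* z :* y) refl B ((τ * τ) ^ a) (B ^ suc m)))

    ‖weight‖≤′ : ∀ X a → ‖ weight X a ‖ ≤ W * τ ^ a
    ‖weight‖≤′ X a = ℚₚ.≤-trans (‖weight‖≤ X a) (*-monoˡ-≤ (W-nonNeg 0≤B 0≤H) (^-mono-≤ 0≤τ² τ²≤τ a))

    ‖closed‖≤ : ∀ r X a → ‖ closed (suc r) X a ‖ ≤ K r * τ ^ a
    ‖closed‖≤ r X a = begin
      ‖ closed (suc r) X a ‖
        ≤⟨ ‖*‖-mono (‖*‖-mono (‖q^*‖≤ (suc r ℕ.* m) a (1≤suc* r 1≤m)) (‖Q‖≤ (suc r)))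
             (‖run‖≤ (X ℕ.+ a) (suc r ℕ.* m)) ⟩
      B * (τ * τ) ^ a * B ^ suc r * B ^ (suc r ℕ.* m)
        ≡⟨ solve 4 (λ x y z w → x :* y :* z :* w := x :* z :* w :* y) refl B ((τ * τ) ^ a) (B ^ suc r) _ ⟩
      K r * (τ * τ) ^ a
        ≤⟨ *-monoˡ-≤ (K-nonNeg 0≤B 0≤H r) (^-mono-≤ 0≤τ² τ²≤τ a) ⟩
      K r * τ ^ a ∎

    -- For d = 0 the sum is empty and the error is the closed form itself, whence K. Each further
    -- head x from a on adds at most W τ^x D′ τ^(a+d), always with the same exponent a + d because
    -- the upper end of the box is fixed. These contributions form a geometric series; keeping the
    -- factor τ^a beside H lets H = 1 + τ H close the induction on d.
    partial-dist : ∀ r → (∀ X a d → ‖ partial′ r X a (suc d) -ᴿ closed′ r X a ‖ ≤ D′ r * τ ^ (a ℕ.+ suc d)) →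
      ∀ X a d → ‖ partial (suc r) X a d -ᴿ closed (suc r) X a ‖ ≤
        (K r + H * (W * D′ r) * τ ^ a) * τ ^ (a ℕ.+ d)
    partial-dist r h X a zero = begin
      ‖ 0# -ᴿ closed (suc r) X a ‖
        ≤⟨ ‖0-x‖≤ _ (‖closed‖≤ r X a) ⟩
      K r * τ ^ a
        ≤⟨ *-monoʳ-≤ (^-nonNeg 0≤τ a) (p≤p+nonNeg {p = K r} (nonNeg*
             (nonNeg* 0≤H (nonNeg* (W-nonNeg 0≤B 0≤H) (D′-nonNeg 0≤B 0≤H r))) (^-nonNeg 0≤τ a))) ⟩
      (K r + H * (W * D′ r) * τ ^ a) * τ ^ a
        ≡⟨ cong (λ k → (K r + H * (W * D′ r) * τ ^ a) * τ ^ k) (sym (ℕₚ.+-identityʳ a)) ⟩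
      (K r + H * (W * D′ r) * τ ^ a) * τ ^ (a ℕ.+ 0) ∎
    partial-dist r h X a (suc d) = begin
      ‖ partial (suc r) X a (suc d) -ᴿ closed (suc r) X a ‖
        ≡⟨ cong ‖_‖ (cong₂ _-ᴿ_ (partial-suc r X a d) (closed-suc 1≤m f*f⁻¹ g≡1+q^*g r X a)) ⟩
      ‖ (weight X a *ᴿ partial′ r (X ℕ.+ m) a (suc d) +ᴿ partial (suc r) X (suc a) d) -ᴿ
        (weight X a *ᴿ closed′ r (X ℕ.+ m) a +ᴿ closed (suc r) X (suc a)) ‖
        ≤⟨ +-dist (*-dist (‖weight‖≤′ X a) (h (X ℕ.+ m) a d)) (partial-dist r h X (suc a) d) ⟩
      W * τ ^ a * (D′ r * τ ^ (a ℕ.+ suc d)) +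
        (K r + H * (W * D′ r) * τ ^ suc a) * τ ^ (suc a ℕ.+ d)
        ≡⟨ cong (λ k → W * τ ^ a * (D′ r * τ ^ (a ℕ.+ suc d)) + (K r + H * (W * D′ r) * τ ^ suc a) * τ ^ k)
             (sym (ℕₚ.+-suc a d)) ⟩
      W * τ ^ a * (D′ r * τ ^ (a ℕ.+ suc d)) + (K r + H * (W * D′ r) * τ ^ suc a) * τ ^ (a ℕ.+ suc d)
        ≡⟨ solve 7 (λ W x D y K H t → W :* x :* (D :* y) :+ (K :+ H :* (W :* D) :* (t :* x)) :* y :=
             (K :+ (con 1ℚ :+ t :* H) :* (W :* D) :* x) :* y) refl W (τ ^ a) (D′ r) (τ ^ (a ℕ.+ suc d)) (K r) H τ ⟩
      (K r + (1ℚ + τ * H) * (W * D′ r) * τ ^ a) * τ ^ (a ℕ.+ suc d)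
        ≡⟨ cong (λ k → (K r + k * (W * D′ r) * τ ^ a) * τ ^ (a ℕ.+ suc d)) (sym H≡1+τH) ⟩
      (K r + H * (W * D′ r) * τ ^ a) * τ ^ (a ℕ.+ suc d) ∎

    partial-dist-D : ∀ r → (∀ X a d → ‖ partial′ r X a (suc d) -ᴿ closed′ r X a ‖ ≤ D′ r * τ ^ (a ℕ.+ suc d)) →
      ∀ X a d → ‖ partial (suc r) X a d -ᴿ closed (suc r) X a ‖ ≤ D r * τ ^ (a ℕ.+ d)
    partial-dist-D r h X a d = ℚₚ.≤-trans (partial-dist r h X a d)
      (*-monoʳ-≤ (^-nonNeg 0≤τ (a ℕ.+ d)) (ℚₚ.+-monoʳ-≤ (K r)
        (subst (H * (W * D′ r) * τ ^ a ≤_) (ℚₚ.*-identityʳ _)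
          (*-monoˡ-≤ (nonNeg* 0≤H (nonNeg* (W-nonNeg 0≤B 0≤H) (D′-nonNeg 0≤B 0≤H r)))
            (^-antimono-≤ 0≤τ τ≤1 (z≤n {a}))))))

    partial′-dist : ∀ r X a d → ‖ partial′ r X a (suc d) -ᴿ closed′ r X a ‖ ≤ D′ r * τ ^ (a ℕ.+ suc d)
    partial′-dist zero X a d = ℚₚ.≤-reflexive (trans
      (cong (λ x → ‖ x -ᴿ closed′ 0 X a ‖) (trans (+-identityʳ (1# *ᴿ 1#)) (sym (*-identityʳ (1# *ᴿ 1#)))))
      (trans (‖x-x‖≡0 (closed′ 0 X a)) (sym (ℚₚ.*-zeroˡ (τ ^ (a ℕ.+ suc d))))))
    partial′-dist (suc r) X a d = begin
      ‖ partial′ (suc r) X a (suc d) -ᴿ closed′ (suc r) X a ‖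
        ≡⟨ cong ‖_‖ (cong₂ _-ᴿ_ (partial′-suc r X a d) (closed′-suc 1≤m f*f⁻¹ g≡1+q^*g r X a)) ⟩
      ‖ (f N *ᴿ (weight X a *ᴿ partial′ r (X ℕ.+ m) a (suc d)) +ᴿ partial (suc r) X (suc a) d) -ᴿ
        (f N *ᴿ (weight X a *ᴿ closed′ r (X ℕ.+ m) a) +ᴿ closed (suc r) X (suc a)) ‖
        ≤⟨ +-dist (*-dist (‖f‖≤ N (s≤s z≤n)) (*-dist ‖w‖≤W (partial′-dist r (X ℕ.+ m) a d)))
             (partial-dist-D r (partial′-dist r) X (suc a) d) ⟩
      B * (W * (D′ r * τ ^ (a ℕ.+ suc d))) + D r * τ ^ (suc a ℕ.+ d)
        ≡⟨ cong (λ k → B * (W * (D′ r * τ ^ (a ℕ.+ suc d))) + D r * τ ^ k) (sym (ℕₚ.+-suc a d)) ⟩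
      B * (W * (D′ r * τ ^ (a ℕ.+ suc d))) + D r * τ ^ (a ℕ.+ suc d)
        ≡⟨ solve 5 (λ B W D y D₁ → B :* (W :* (D :* y)) :+ D₁ :* y := (B :* (W :* D) :+ D₁) :* y)
             refl B W (D′ r) (τ ^ (a ℕ.+ suc d)) (D r) ⟩
      D′ (suc r) * τ ^ (a ℕ.+ suc d) ∎
      where
      N = suc (X ℕ.+ a)
      ‖w‖≤W : ‖ weight X a ‖ ≤ W
      ‖w‖≤W = ℚₚ.≤-trans (‖weight‖≤′ X a) (subst (W * τ ^ a ≤_) (ℚₚ.*-identityʳ W)
        (*-monoˡ-≤ (W-nonNeg 0≤B 0≤H) (^-antimono-≤ 0≤τ τ≤1 (z≤n {a}))))

    ‖collision‖≤ : ∀ X a {r} (v : Vec ℕ r) → ‖ collision X a v ‖ ≤ B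
    ‖collision‖≤ X a [] = ℚₚ.≤-trans ‖1‖≤1 1≤B
    ‖collision‖≤ X a (c ∷ v) with does (c ℕₚ.≟ a)
    ... | true  = ‖f‖≤ (suc (X ℕ.+ a)) (s≤s z≤n)
    ... | false = ℚₚ.≤-trans ‖1‖≤1 1≤B

    ‖summand‖≤ : ∀ X {r} (v : Vec ℕ r) → ‖ summand X v ‖ ≤ V r * (τ * τ) ^ Vec.sum v
    ‖summand‖≤ X [] = ‖1‖≤1
    ‖summand‖≤ X {suc r} (a ∷ v) = begin
      ‖ summand X (a ∷ v) ‖
        ≤⟨ ‖*‖-mono (‖weight‖≤ X a) (‖*‖-mono (‖collision‖≤ (X ℕ.+ m) a v) (‖summand‖≤ (X ℕ.+ m) v)) ⟩
      W * (τ * τ) ^ a * (B * (V r * (τ * τ) ^ Vec.sum v))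
        ≡⟨ solve 5 (λ W x B V y → W :* x :* (B :* (V :* y)) := W :* (B :* V) :* (x :* y))
             refl W ((τ * τ) ^ a) B (V r) _ ⟩
      V (suc r) * ((τ * τ) ^ a * (τ * τ) ^ Vec.sum v)
        ≡⟨ cong (V (suc r) *_) (sym (^-homo-* (τ * τ) a (Vec.sum v))) ⟩
      V (suc r) * (τ * τ) ^ (a ℕ.+ Vec.sum v) ∎

    open ℚ-Sums using (∑-mono; ∑-box-≤; ∑-⊆-≤) renaming (∑ to ∑ℚ; ∑-*ˡ to ∑ℚ-*ˡ)

    -- With s the sum of the entries, one of the two factors τ^s is traded for τ^d, and the other is
    -- kept so that the terms can still be summed.
    ‖summand‖≤-tail : ∀ {r} d (v : Vec ℕ r) → d ℕ.≤ Vec.sum v →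
      ‖ summand 0 v ‖ ≤ V r * τ ^ d * τ ^ Vec.sum v
    ‖summand‖≤-tail {r} d v d≤ = begin
      ‖ summand 0 v ‖                           ≤⟨ ‖summand‖≤ 0 v ⟩
      V r * (τ * τ) ^ s                         ≡⟨ cong (V r *_) (^-distrib-* τ τ s) ⟩
      V r * (τ ^ s * τ ^ s)
        ≤⟨ *-monoˡ-≤ (V-nonNeg 0≤B 0≤H r) (*-monoʳ-≤ (^-nonNeg 0≤τ s) (^-antimono-≤ 0≤τ τ≤1 d≤)) ⟩
      V r * (τ ^ d * τ ^ s)                     ≡⟨ sym (ℚₚ.*-assoc (V r) (τ ^ d) (τ ^ s)) ⟩
      V r * τ ^ d * τ ^ s                       ∎
      where s = Vec.sum v

    -- The vectors outside the box may be arbitrarily large, so they are enclosed in a second box of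
    -- some size e. Its weighted sum is at most H^r whatever e is.
    ‖∑-tail‖≤ : ∀ {r} d (vs : List (Vec ℕ r)) → Unique vs → (∀ {v} → v ∈ vs → Sorted v) →
      (∀ {v} → v ∈ vs → v ∉ box r 0 d) → ‖ ∑ (summand 0) vs ‖ ≤ V r * H ^ r * τ ^ d
    ‖∑-tail‖≤ {r} d vs u s v∉ with e , vs⊆ ← box-bound vs s = begin
      ‖ ∑ (summand 0) vs ‖
        ≤⟨ ‖∑‖≤ (summand 0) vs ⟩
      ∑ℚ (λ v → ‖ summand 0 v ‖) vs
        ≤⟨ ∑-mono vs (λ {v} v∈ → ‖summand‖≤-tail d v (∉-box⇒≤sum d v (s v∈) (v∉ v∈))) ⟩
      ∑ℚ (λ v → c * τ ^ Vec.sum v) vs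
        ≡⟨ ∑ℚ-*ˡ c (λ v → τ ^ Vec.sum v) vs ⟩
      c * ∑ℚ (λ v → τ ^ Vec.sum v) vs
        ≤⟨ *-monoˡ-≤ 0≤c (∑-⊆-≤ (λ v → ^-nonNeg 0≤τ (Vec.sum v)) u vs⊆) ⟩
      c * ∑ℚ (λ v → τ ^ Vec.sum v) (box r 0 e)
        ≤⟨ *-monoˡ-≤ 0≤c (∑-box-≤ 0≤τ τ≤1 0≤H H≡1+τH r 0 e) ⟩
      V r * τ ^ d * H ^ r
        ≡⟨ solve 3 (λ x y z → x :* y :* z := x :* z :* y) refl (V r) (τ ^ d) (H ^ r) ⟩
      V r * H ^ r * τ ^ d ∎
      where
      c = V r * τ ^ d
      0≤c = nonNeg* (V-nonNeg 0≤B 0≤H r) (^-nonNeg 0≤τ d)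

    ∑-dist : ∀ r d (vs : List (Vec ℕ (suc r))) → Unique vs → (∀ {v} → v ∈ vs → Sorted v) →
      box (suc r) 0 d ⊆ vs → ‖ ∑ (summand 0) vs -ᴿ closed (suc r) 0 0 ‖ ≤ E r * τ ^ d
    ∑-dist r d vs u s box⊆ with ws , p ← Unique-⊆⇒↭ (box-Unique (suc r) 0 d) box⊆ = begin
      ‖ ∑ (summand 0) vs -ᴿ closed (suc r) 0 0 ‖
        ≡⟨ cong (λ x → ‖ x -ᴿ closed (suc r) 0 0 ‖)
             (trans (∑-↭ (summand 0) p) (∑-++ (summand 0) (box (suc r) 0 d) ws)) ⟩
      ‖ (partial (suc r) 0 0 d +ᴿ ∑ (summand 0) ws) -ᴿ closed (suc r) 0 0 ‖
        ≡⟨ cong ‖_‖ (R-solve 3 (λ x y z → (x ⊕ y) ⊕ z ≣ (x ⊕ z) ⊕ y) refl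
             (partial (suc r) 0 0 d) (∑ (summand 0) ws) (-ᴿ closed (suc r) 0 0)) ⟩
      ‖ (partial (suc r) 0 0 d -ᴿ closed (suc r) 0 0) +ᴿ ∑ (summand 0) ws ‖
        ≤⟨ ‖+‖≤ _ _ ⟩
      ‖ partial (suc r) 0 0 d -ᴿ closed (suc r) 0 0 ‖ + ‖ ∑ (summand 0) ws ‖
        ≤⟨ ℚₚ.+-mono-≤ (partial-dist-D r (partial′-dist r) 0 0 d)
             (‖∑-tail‖≤ d ws (Unique-++ʳ (box (suc r) 0 d) u′)
               (λ v∈ → s (∈-resp-↭ (↭-sym p) (∈-++⁺ʳ (box (suc r) 0 d) v∈)))
               (λ v∈ v∈box → Unique-++⇒Disjoint (box (suc r) 0 d) u′ (v∈box , v∈))) ⟩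
      D r * τ ^ d + V (suc r) * H ^ suc r * τ ^ d
        ≡⟨ sym (ℚₚ.*-distribʳ-+ (τ ^ d) (D r) _) ⟩
      E r * τ ^ d ∎
      where
      u′ = Unique-resp-↭ p u
      open SemiringSolver commutativeSemiring using ()
        renaming (solve to R-solve; _:+_ to _⊕_; _:=_ to _≣_)

-- Gaussian rationals

module ℚ-Absolute where
  open Rat hiding (ℚ; 0ℚ; 1ℚ; ½; mkℚ)
  open ℚ-Powers
  open ℚSolver.+-*-Solver
  open ℚₚ.≤-Reasoning

  0≤p*p : ∀ p → 0ℚ ≤ p * p
  0≤p*p p with ℚₚ.≤-total 0ℚ p
  ... | inj₁ 0≤p = nonNeg* 0≤p 0≤p
  ... | inj₂ p≤0 = subst (0ℚ ≤_) (solve 1 (λ p → :- p :* :- p := p :* p) refl p) (nonNeg* 0≤-p 0≤-p)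
    where 0≤-p = ℚₚ.neg-antimono-≤ p≤0

  ∣p∣*∣p∣≡p*p : ∀ p → ∣ p ∣ * ∣ p ∣ ≡ p * p
  ∣p∣*∣p∣≡p*p p = trans (sym (ℚₚ.∣p*q∣≡∣p∣*∣q∣ p p)) (ℚₚ.0≤p⇒∣p∣≡p (0≤p*p p))

  square-cancel-≤ : ∀ {p q} → 0ℚ ≤ q → p * p ≤ q * q → p ≤ q
  square-cancel-≤ {p} {q} 0≤q p²≤q² = ℚₚ.≮⇒≥ λ q<p → ℚₚ.<-irrefl refl (begin-strict
    q * q <⟨ ℚₚ.≤-<-trans (*-monoˡ-≤ 0≤q (ℚₚ.<⇒≤ q<p))
               (ℚₚ.*-monoˡ-<-pos p ⦃ ℚ.positive (ℚₚ.≤-<-trans 0≤q q<p) ⦄ q<p) ⟩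
    p * p ≤⟨ p²≤q² ⟩
    q * q ∎)

record ℚ[i] : Set where
  constructor _,i_
  field
    Re Im : ℚ

module Gaussian where
  open Rat hiding (ℚ; 0ℚ; 1ℚ; ½; mkℚ)
  open ℚ[i] public
  open ℚ-Powers using (*-monoʳ-≤; 0≤1; ^-nonNeg; p≤q⇒0≤q-p)
    renaming (_^_ to _^ℚ_; ^-distrib-* to ^ℚ-distrib-*; ^-antimono-≤ to ^ℚ-antimono-≤;
      ^-mono-≤ to ^ℚ-mono-≤)
  open ℚ-Absolute
  open ℚSolver.+-*-Solver
  open ℚₚ.≤-Reasoning

  infix 8 ⊖_
  infixl 6 _⊕_
  infixl 7 _⊗_
  _⊕_ _⊗_ : ℚ[i] → ℚ[i] → ℚ[i]
  z ⊕ w = (Re z + Re w) ,i (Im z + Im w)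
  z ⊗ w = (Re z * Re w - Im z * Im w) ,i (Re z * Im w + Im z * Re w)

  ⊖_ : ℚ[i] → ℚ[i]
  ⊖ z = (- Re z) ,i (- Im z)

  norm² ‖_‖ : ℚ[i] → ℚ
  norm² z = Re z * Re z + Im z * Im z
  ‖ z ‖ = ∣ Re z ∣ + ∣ Im z ∣

  -- Computes the terms of the complex reciprocal exactly, including the value 0 where `norm²`
  -- vanishes, so division commutes with evaluation at a position by definition.
  inv : ℚ[i] → ℚ[i]
  inv z = (Re z * inv₀ (norm² z)) ,i (- (Im z * inv₀ (norm² z)))

  isCommutativeRing : IsCommutativeRing _≡_ _⊕_ _⊗_ ⊖_ (0ℚ ,i 0ℚ) (1ℚ ,i 0ℚ)
  isCommutativeRing = record
    { isRing = record
      { +-isAbelianGroup = record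
        { isGroup = record
          { isMonoid = record
            { isSemigroup = record
              { isMagma = record { isEquivalence = isEquivalence ; ∙-cong = cong₂ _⊕_ }
              ; assoc = λ x y z → cong₂ _,i_ (ℚₚ.+-assoc (Re x) (Re y) (Re z)) (ℚₚ.+-assoc (Im x) (Im y) (Im z)) }
            ; identity = (λ x → cong₂ _,i_ (ℚₚ.+-identityˡ (Re x)) (ℚₚ.+-identityˡ (Im x)))
                       , (λ x → cong₂ _,i_ (ℚₚ.+-identityʳ (Re x)) (ℚₚ.+-identityʳ (Im x))) }
          ; inverse = (λ x → cong₂ _,i_ (ℚₚ.+-inverseˡ (Re x)) (ℚₚ.+-inverseˡ (Im x)))
                    , (λ x → cong₂ _,i_ (ℚₚ.+-inverseʳ (Re x)) (ℚₚ.+-inverseʳ (Im x)))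
          ; ⁻¹-cong = cong ⊖_ }
        ; comm = λ x y → cong₂ _,i_ (ℚₚ.+-comm (Re x) (Re y)) (ℚₚ.+-comm (Im x) (Im y)) }
      ; *-cong = cong₂ _⊗_
      ; *-assoc = λ x y z → cong₂ _,i_
          (solve 6 (λ a b c d e f → (a :* c :- b :* d) :* e :- (a :* d :+ b :* c) :* f :=
              a :* (c :* e :- d :* f) :- b :* (c :* f :+ d :* e)) refl (Re x) (Im x) (Re y) (Im y) (Re z) (Im z))
          (solve 6 (λ a b c d e f → (a :* c :- b :* d) :* f :+ (a :* d :+ b :* c) :* e :=
              a :* (c :* f :+ d :* e) :+ b :* (c :* e :- d :* f)) refl (Re x) (Im x) (Re y) (Im y) (Re z) (Im z))
      ; *-identity = (λ x → cong₂ _,i_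
            (solve 2 (λ a b → con 1ℚ :* a :- con 0ℚ :* b := a) refl (Re x) (Im x))
            (solve 2 (λ a b → con 1ℚ :* b :+ con 0ℚ :* a := b) refl (Re x) (Im x)))
          , (λ x → cong₂ _,i_
            (solve 2 (λ a b → a :* con 1ℚ :- b :* con 0ℚ := a) refl (Re x) (Im x))
            (solve 2 (λ a b → a :* con 0ℚ :+ b :* con 1ℚ := b) refl (Re x) (Im x)))
      ; distrib = (λ x y z → cong₂ _,i_
            (solve 6 (λ a b c d e f → a :* (c :+ e) :- b :* (d :+ f) :=
                (a :* c :- b :* d) :+ (a :* e :- b :* f)) refl (Re x) (Im x) (Re y) (Im y) (Re z) (Im z))
            (solve 6 (λ a b c d e f → a :* (d :+ f) :+ b :* (c :+ e) :=
                (a :* d :+ b :* c) :+ (a :* f :+ b :* e)) refl (Re x) (Im x) (Re y) (Im y) (Re z) (Im z)))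
          , (λ x y z → cong₂ _,i_
            (solve 6 (λ a b c d e f → (c :+ e) :* a :- (d :+ f) :* b :=
                (c :* a :- d :* b) :+ (e :* a :- f :* b)) refl (Re x) (Im x) (Re y) (Im y) (Re z) (Im z))
            (solve 6 (λ a b c d e f → (c :+ e) :* b :+ (d :+ f) :* a :=
                (c :* b :+ d :* a) :+ (e :* b :+ f :* a)) refl (Re x) (Im x) (Re y) (Im y) (Re z) (Im z)))
      }
    ; *-comm = λ x y → cong₂ _,i_
        (solve 4 (λ a b c d → a :* c :- b :* d := c :* a :- d :* b) refl (Re x) (Im x) (Re y) (Im y))
        (solve 4 (λ a b c d → a :* d :+ b :* c := c :* b :+ d :* a) refl (Re x) (Im x) (Re y) (Im y))
    }

  ‖⊗‖≤ : ∀ z w → ‖ z ⊗ w ‖ ≤ ‖ z ‖ * ‖ w ‖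
  ‖⊗‖≤ (a ,i b) (c ,i d) = begin
    ∣ a * c - b * d ∣ + ∣ a * d + b * c ∣
      ≤⟨ ℚₚ.+-mono-≤ (ℚₚ.∣p-q∣≤∣p∣+∣q∣ (a * c) (b * d)) (ℚₚ.∣p+q∣≤∣p∣+∣q∣ (a * d) (b * c)) ⟩
    (∣ a * c ∣ + ∣ b * d ∣) + (∣ a * d ∣ + ∣ b * c ∣)
      ≡⟨ cong₂ _+_ (cong₂ _+_ (ℚₚ.∣p*q∣≡∣p∣*∣q∣ a c) (ℚₚ.∣p*q∣≡∣p∣*∣q∣ b d))
           (cong₂ _+_ (ℚₚ.∣p*q∣≡∣p∣*∣q∣ a d) (ℚₚ.∣p*q∣≡∣p∣*∣q∣ b c)) ⟩
    (∣ a ∣ * ∣ c ∣ + ∣ b ∣ * ∣ d ∣) + (∣ a ∣ * ∣ d ∣ + ∣ b ∣ * ∣ c ∣)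
      ≡⟨ solve 4 (λ a b c d → (a :* c :+ b :* d) :+ (a :* d :+ b :* c) := (a :+ b) :* (c :+ d))
           refl (∣ a ∣) (∣ b ∣) (∣ c ∣) (∣ d ∣) ⟩
    (∣ a ∣ + ∣ b ∣) * (∣ c ∣ + ∣ d ∣) ∎

  normedRing : NormedRing
  normedRing = record
    { Carrier = ℚ[i] ; _+_ = _⊕_ ; _*_ = _⊗_ ; -_ = ⊖_ ; 0# = 0ℚ ,i 0ℚ ; 1# = 1ℚ ,i 0ℚ
    ; isCommutativeRing = isCommutativeRing
    ; ‖_‖ = ‖_‖
    ; ‖‖-nonNeg = λ z → nonNeg+ (ℚₚ.0≤∣p∣ (Re z)) (ℚₚ.0≤∣p∣ (Im z))
    ; ‖0‖≡0 = refl
    ; ‖-x‖≡‖x‖ = λ z → cong₂ _+_ (ℚₚ.∣-p∣≡∣p∣ (Re z)) (ℚₚ.∣-p∣≡∣p∣ (Im z))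
    ; ‖1‖≤1 = ℚₚ.≤-refl
    ; ‖+‖≤ = λ z w → subst (‖ z ⊕ w ‖ ≤_)
        (solve 4 (λ a b c d → (a :+ c) :+ (b :+ d) := (a :+ b) :+ (c :+ d)) refl
          (∣ Re z ∣) (∣ Im z ∣) (∣ Re w ∣) (∣ Im w ∣))
        (ℚₚ.+-mono-≤ (ℚₚ.∣p+q∣≤∣p∣+∣q∣ (Re z) (Re w)) (ℚₚ.∣p+q∣≤∣p∣+∣q∣ (Im z) (Im w)))
    ; ‖*‖≤ = ‖⊗‖≤
    }

  open NormedRing normedRing public using (_^_; ‖‖-nonNeg)

  norm²-nonNeg : ∀ z → 0ℚ ≤ norm² z
  norm²-nonNeg z = nonNeg+ (0≤p*p (Re z)) (0≤p*p (Im z))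

  norm²-⊗ : ∀ z w → norm² (z ⊗ w) ≡ norm² z * norm² w
  norm²-⊗ (a ,i b) (c ,i d) = solve 4 (λ a b c d →
    (a :* c :- b :* d) :* (a :* c :- b :* d) :+ (a :* d :+ b :* c) :* (a :* d :+ b :* c) :=
    (a :* a :+ b :* b) :* (c :* c :+ d :* d)) refl a b c d

  norm²-^ : ∀ z n → norm² (z ^ n) ≡ norm² z ^ℚ n
  norm²-^ z zero    = refl
  norm²-^ z (suc n) = trans (norm²-⊗ z (z ^ n)) (cong (norm² z *_) (norm²-^ z n))

  norm²-abs : ∀ z → norm² z ≡ ∣ Re z ∣ * ∣ Re z ∣ + ∣ Im z ∣ * ∣ Im z ∣
  norm²-abs z = sym (cong₂ _+_ (∣p∣*∣p∣≡p*p (Re z)) (∣p∣*∣p∣≡p*p (Im z)))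

  -- From (a + b)² + (a - b)² = 2 (a² + b²). Together with `norm²≤‖z‖²` this passes between `norm²`,
  -- which is multiplicative, and the norm, which satisfies the triangle inequality, without square
  -- roots.
  ‖z‖²≤2norm² : ∀ z → ‖ z ‖ * ‖ z ‖ ≤ norm² z + norm² z
  ‖z‖²≤2norm² z = begin
    ‖ z ‖ * ‖ z ‖
      ≤⟨ p≤p+nonNeg (0≤p*p (a - b)) ⟩
    ‖ z ‖ * ‖ z ‖ + (a - b) * (a - b)
      ≡⟨ solve 2 (λ a b → (a :+ b) :* (a :+ b) :+ (a :- b) :* (a :- b) :=
           (a :* a :+ b :* b) :+ (a :* a :+ b :* b)) refl a b ⟩
    (a * a + b * b) + (a * a + b * b)
      ≡⟨ cong (λ n → n + n) (sym (norm²-abs z)) ⟩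
    norm² z + norm² z ∎
    where
    a = ∣ Re z ∣
    b = ∣ Im z ∣

  norm²≤‖z‖² : ∀ z → norm² z ≤ ‖ z ‖ * ‖ z ‖
  norm²≤‖z‖² z = begin
    norm² z                                 ≡⟨ norm²-abs z ⟩
    a * a + b * b                           ≤⟨ p≤p+nonNeg (nonNeg+ 0≤ab 0≤ab) ⟩
    (a * a + b * b) + (a * b + a * b)
      ≡⟨ solve 2 (λ a b → (a :* a :+ b :* b) :+ (a :* b :+ a :* b) := (a :+ b) :* (a :+ b)) refl a b ⟩
    ‖ z ‖ * ‖ z ‖                           ∎
    where
    a = ∣ Re z ∣
    b = ∣ Im z ∣
    0≤ab = nonNeg* (ℚₚ.0≤∣p∣ (Re z)) (ℚₚ.0≤∣p∣ (Im z))

  ⊗-inv : ∀ z → norm² z ≢ 0ℚ → z ⊗ inv z ≡ 1ℚ ,i 0ℚ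
  ⊗-inv (a ,i b) N≢0 = cong₂ _,i_
    (trans (solve 3 (λ a b i → a :* (a :* i) :- b :* (:- (b :* i)) := (a :* a :+ b :* b) :* i) refl a b i)
      (*-inv₀ N≢0))
    (solve 3 (λ a b i → a :* (:- (b :* i)) :+ b :* (a :* i) := con 0ℚ) refl a b i)
    where i = inv₀ (a * a + b * b)

  inv-unique : ∀ z w → z ⊗ w ≡ 1ℚ ,i 0ℚ → inv z ≡ w
  inv-unique z w zw≡1 = NormedRing.inverse-unique normedRing {z} (⊗-inv z N≢0) zw≡1
    where
    N≢0 : norm² z ≢ 0ℚ
    N≢0 N≡0 = ℚₚ.<⇒≢ 0<1 (trans (sym (ℚₚ.*-zeroˡ (norm² w)))
      (trans (cong (_* norm² w) (sym N≡0)) (trans (sym (norm²-⊗ z w)) (cong norm² zw≡1))))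

  module _ {z c} (0<c : 0ℚ < c) (c≤‖z‖ : c ≤ ‖ z ‖) where
    private
      0<2N : 0ℚ < norm² z + norm² z
      0<2N = ℚₚ.<-≤-trans (pos* 0<c 0<c) (ℚₚ.≤-trans
        (*-mono (ℚₚ.<⇒≤ 0<c) (‖‖-nonNeg z) c≤‖z‖ c≤‖z‖) (‖z‖²≤2norm² z))

    norm²-pos : 0ℚ < norm² z
    norm²-pos = ℚₚ.≰⇒> λ (N≤0 : norm² z ≤ 0ℚ) → ℚₚ.<-irrefl refl (ℚₚ.<-≤-trans 0<2N (ℚₚ.+-mono-≤ N≤0 N≤0))

    -- The norm of the inverse is ‖z‖ / `norm² z`, and `norm² z` ≥ ‖z‖² / 2, so it is at most 2 /
    -- ‖z‖.
    ‖inv‖≤ : ‖ inv z ‖ ≤ (1ℚ + 1ℚ) * inv₀ c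
    ‖inv‖≤ = begin
      ‖ inv z ‖
        ≡⟨ cong₂ _+_ (∣p*i∣ (Re z)) (trans (ℚₚ.∣-p∣≡∣p∣ (Im z * i)) (∣p*i∣ (Im z))) ⟩
      ∣ Re z ∣ * i + ∣ Im z ∣ * i
        ≡⟨ sym (ℚₚ.*-distribʳ-+ i (∣ Re z ∣) (∣ Im z ∣)) ⟩
      ‖ z ‖ * i
        ≡⟨ sym (ℚₚ.*-identityˡ (‖ z ‖ * i)) ⟩
      1ℚ * (‖ z ‖ * i)
        ≡⟨ cong (_* (‖ z ‖ * i)) (sym (*-inv₀ (pos⇒≢0 0<c))) ⟩
      c * inv₀ c * (‖ z ‖ * i)
        ≡⟨ solve 4 (λ c d z i → c :* d :* (z :* i) := c :* z :* (i :* d)) refl c (inv₀ c) (‖ z ‖) i ⟩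
      c * ‖ z ‖ * (i * inv₀ c)
        ≤⟨ *-monoʳ-≤ (nonNeg* 0≤i (ℚₚ.<⇒≤ (inv₀-pos 0<c)))
             (ℚₚ.≤-trans (*-monoʳ-≤ (‖‖-nonNeg z) c≤‖z‖) (‖z‖²≤2norm² z)) ⟩
      (norm² z + norm² z) * (i * inv₀ c)
        ≡⟨ solve 3 (λ n i d → (n :+ n) :* (i :* d) := (n :* i :+ n :* i) :* d) refl (norm² z) i (inv₀ c) ⟩
      (norm² z * i + norm² z * i) * inv₀ c
        ≡⟨ cong (λ n → (n + n) * inv₀ c) (*-inv₀ (pos⇒≢0 norm²-pos)) ⟩
      (1ℚ + 1ℚ) * inv₀ c ∎
      where
      i = inv₀ (norm² z)
      0≤i = ℚₚ.<⇒≤ (inv₀-pos norm²-pos)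
      ∣p*i∣ : ∀ p → ∣ p * i ∣ ≡ ∣ p ∣ * i
      ∣p*i∣ p = trans (ℚₚ.∣p*q∣≡∣p∣*∣q∣ p i) (cong (∣ p ∣ *_) (ℚₚ.0≤p⇒∣p∣≡p 0≤i))

  module _ {q σ} (0≤σ : 0ℚ ≤ σ) (norm²q≤σ² : norm² q ≤ σ * σ) where

    norm²-^≤ : ∀ n → norm² (q ^ n) ≤ σ ^ℚ n * σ ^ℚ n
    norm²-^≤ n = subst₂ _≤_ (sym (norm²-^ q n)) (^ℚ-distrib-* σ σ n)
      (^ℚ-mono-≤ (norm²-nonNeg q) norm²q≤σ² n)

    -- Submultiplicativity would not give decay, since ‖q‖ can exceed 1 although |q| < 1. The powers
    -- are therefore estimated through `norm²`, at the cost of the constant 2, a rational bound for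
    -- √2.
    ‖^‖≤ : ∀ n → ‖ q ^ n ‖ ≤ (1ℚ + 1ℚ) * σ ^ℚ n
    ‖^‖≤ n = square-cancel-≤ (nonNeg* 0≤2 0≤s) (begin
      ‖ q ^ n ‖ * ‖ q ^ n ‖         ≤⟨ ‖z‖²≤2norm² (q ^ n) ⟩
      norm² (q ^ n) + norm² (q ^ n) ≤⟨ ℚₚ.+-mono-≤ (norm²-^≤ n) (norm²-^≤ n) ⟩
      s * s + s * s                 ≤⟨ p≤p+nonNeg (nonNeg+ (nonNeg* 0≤s 0≤s) (nonNeg* 0≤s 0≤s)) ⟩
      (s * s + s * s) + (s * s + s * s)
        ≡⟨ solve 1 (λ s → (s :* s :+ s :* s) :+ (s :* s :+ s :* s) :=
             (con (1ℚ + 1ℚ) :* s) :* (con (1ℚ + 1ℚ) :* s)) refl s ⟩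
      (1ℚ + 1ℚ) * s * ((1ℚ + 1ℚ) * s) ∎)
      where
      s = σ ^ℚ n
      0≤s = ^-nonNeg 0≤σ n
      0≤2 = nonNeg+ 0≤1 0≤1

    module _ (σ≤1 : σ ≤ 1ℚ) where

      1-σ≤Re[1-q^] : ∀ n → 1 ℕ.≤ n → 1ℚ - σ ≤ Re (NormedRing.cofactor normedRing q n)
      1-σ≤Re[1-q^] n 1≤n = ℚₚ.+-monoʳ-≤ 1ℚ (ℚₚ.neg-antimono-≤ (square-cancel-≤ {Re (q ^ n)} 0≤σ (begin
        Re z * Re z          ≤⟨ p≤p+nonNeg (0≤p*p (Im z)) ⟩
        norm² z              ≤⟨ norm²-^≤ n ⟩
        σ ^ℚ n * σ ^ℚ n      ≤⟨ *-mono (^-nonNeg 0≤σ n) 0≤σ σⁿ≤σ σⁿ≤σ ⟩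
        σ * σ                ∎)))
        where
        z = q ^ n
        σⁿ≤σ = subst (σ ^ℚ n ≤_) (ℚₚ.*-identityʳ σ) (^ℚ-antimono-≤ 0≤σ σ≤1 1≤n)

      1-σ≤‖1-q^‖ : ∀ n → 1 ℕ.≤ n → 1ℚ - σ ≤ ‖ NormedRing.cofactor normedRing q n ‖
      1-σ≤‖1-q^‖ n 1≤n = ℚₚ.≤-trans (1-σ≤Re[1-q^] n 1≤n)
        (ℚₚ.≤-trans (p≤∣p∣ _) (p≤p+nonNeg (ℚₚ.0≤∣p∣ _)))

      [1-σ]²≤norm²[1-q^] : ∀ n → 1 ℕ.≤ n →
        (1ℚ - σ) * (1ℚ - σ) ≤ norm² (NormedRing.cofactor normedRing q n)
      [1-σ]²≤norm²[1-q^] n 1≤n = ℚₚ.≤-trans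
        (*-mono 0≤1-σ (ℚₚ.≤-trans 0≤1-σ (1-σ≤Re[1-q^] n 1≤n)) (1-σ≤Re[1-q^] n 1≤n) (1-σ≤Re[1-q^] n 1≤n))
        (p≤p+nonNeg (0≤p*p (Im (NormedRing.cofactor normedRing q n))))
        where 0≤1-σ = p≤q⇒0≤q-p σ≤1

-- Bounds uniform in the position

module UniformBounds where
  private
    module G = NormedRing Gaussian.normedRing
  open Rat hiding (ℚ; 0ℚ; 1ℚ; ½; mkℚ)
  open ℚ-Powers using (*-monoˡ-≤; 0≤1; ^-nonNeg; p≤q⇒0≤q-p; p<q⇒0<q-p)
    renaming (_^_ to _^ℚ_; ^-mono-≤ to ^ℚ-mono-≤; ^-antimono-≤ to ^ℚ-antimono-≤)
  open ℚ-Absolute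
  open Gaussian
  open Bisection using (lower; width; lower-nonNeg; <upper²; width→0)
  open ℚSolver.+-*-Solver
  open ℚₚ.≤-Reasoning

  -- The hypothesis concerns the lower ends of the bisection brackets for the square root. Once a
  -- bracket is shorter than ε/2, half of the gap ε to 1 pays for its width, and the upper end is at
  -- most σ = 1 - ε/2.
  eventually-< : ∀ x → Cauchy x → ∀ {ε} → 0ℚ < ε →
    Eventually (λ n → lower (x n ⊔ 0ℚ) n + ε ≤ 1ℚ) →
    ∃ λ σ → 0ℚ ≤ σ × σ < 1ℚ × Eventually λ n → x n ≤ σ * σ
  eventually-< x cx {ε} 0<ε (M , h) =
    1ℚ - ε * ½ , p≤q⇒0≤q-p ε½≤1 , σ<1 , M ℕ.⊔ N , λ n ≤n → x≤σ² n (ℕₚ.m⊔n≤o⇒m≤o M N ≤n) (ℕₚ.m⊔n≤o⇒n≤o M N ≤n)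
    where
    0<ε½ = pos* 0<ε 0<½
    N = proj₁ (width→0 x cx 0<ε½)
    ε½≤1 : ε * ½ ≤ 1ℚ
    ε½≤1 = begin
      ε * ½                        ≤⟨ p≤p+nonNeg (ℚₚ.<⇒≤ 0<ε½) ⟩
      ε * ½ + ε * ½                ≡⟨ half ε ⟩
      ε                            ≤⟨ p≤p+nonNeg (lower-nonNeg (ℚₚ.p≤q⊔p (x M) 0ℚ) M) ⟩
      ε + lower (x M ⊔ 0ℚ) M       ≡⟨ ℚₚ.+-comm ε _ ⟩
      lower (x M ⊔ 0ℚ) M + ε       ≤⟨ h M ℕₚ.≤-refl ⟩
      1ℚ                           ∎
    σ<1 : 1ℚ - ε * ½ < 1ℚ
    σ<1 = subst (1ℚ - ε * ½ <_) (ℚₚ.+-identityʳ 1ℚ) (ℚₚ.+-monoʳ-< 1ℚ (ℚₚ.neg-antimono-< 0<ε½))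
    x≤σ² : ∀ n → M ℕ.≤ n → N ℕ.≤ n → x n ≤ (1ℚ - ε * ½) * (1ℚ - ε * ½)
    x≤σ² n M≤n N≤n = begin
      x n               ≤⟨ ℚₚ.p≤p⊔q (x n) 0ℚ ⟩
      p                 ≤⟨ ℚₚ.<⇒≤ (<upper² 0≤p n) ⟩
      (l + w) * (l + w) ≤⟨ *-mono 0≤l+w (p≤q⇒0≤q-p ε½≤1) l+w≤ l+w≤ ⟩
      (1ℚ - ε * ½) * (1ℚ - ε * ½) ∎
      where
      p = x n ⊔ 0ℚ
      l = lower p n
      w = width p n
      0≤p = ℚₚ.p≤q⊔p (x n) 0ℚ
      0≤l+w = nonNeg+ (lower-nonNeg 0≤p n) (ℚₚ.<⇒≤ (Bisection.width-pos 0≤p n))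
      l+w≤ : l + w ≤ 1ℚ - ε * ½
      l+w≤ = begin
        l + w                      ≤⟨ ℚₚ.+-monoʳ-≤ l (ℚₚ.<⇒≤ (proj₂ (width→0 x cx 0<ε½) n N≤n)) ⟩
        l + ε * ½                  ≡⟨ solve 2 (λ l h → l :+ h := (l :+ (h :+ h)) :- h) refl l (ε * ½) ⟩
        (l + (ε * ½ + ε * ½)) - ε * ½ ≡⟨ cong (λ e → (l + e) - ε * ½) (half ε) ⟩
        (l + ε) - ε * ½            ≤⟨ ℚₚ.+-monoˡ-≤ (- (ε * ½)) (h n M≤n) ⟩
        1ℚ - ε * ½                 ∎

  lower-≤ : ∀ {p η} → 0ℚ ≤ η → p ≤ η * η → ∀ n → lower (p ⊔ 0ℚ) n ≤ η
  lower-≤ {p} {η} 0≤η p≤η² n = square-cancel-≤ 0≤η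
    (ℚₚ.≤-trans (Bisection.lower²≤ (ℚₚ.p≤q⊔p p 0ℚ) n) (ℚₚ.⊔-lub p≤η² (0≤p*p η)))

  module _ {σ} (0≤σ : 0ℚ ≤ σ) (σ<1 : σ < 1ℚ) where

    -- A rational substitute for √σ: the arithmetic mean of 1 and σ dominates their geometric mean
    -- and is still below 1. It supplies the squared decay rate in `Controlled`.
    mid : ℚ
    mid = (1ℚ + σ) * ½

    mid-nonNeg : 0ℚ ≤ mid
    mid-nonNeg = nonNeg* (nonNeg+ 0≤1 0≤σ) (ℚₚ.<⇒≤ 0<½)

    mid<1 : mid < 1ℚ
    mid<1 = ℚₚ.*-monoˡ-<-pos ½ (ℚₚ.+-monoʳ-< 1ℚ σ<1)

    -- mid² - σ = ((1 - σ) / 2)²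
    σ≤mid² : σ ≤ mid * mid
    σ≤mid² = subst (σ ≤_)
      (solve 1 (λ s → s :+ (con 1ℚ :- s) :* con ½ :* ((con 1ℚ :- s) :* con ½) :=
        (con 1ℚ :+ s) :* con ½ :* ((con 1ℚ :+ s) :* con ½)) refl σ)
      (p≤p+nonNeg (0≤p*p ((1ℚ - σ) * ½)))

  geometric-sum : ∀ {τ} → τ < 1ℚ → inv₀ (1ℚ - τ) ≡ 1ℚ + τ * inv₀ (1ℚ - τ)
  geometric-sum {τ} τ<1 = begin-equality
    H                       ≡⟨ solve 2 (λ t h → h := (con 1ℚ :- t) :* h :+ t :* h) refl τ H ⟩
    (1ℚ - τ) * H + τ * H    ≡⟨ cong (_+ τ * H) (*-inv₀ (pos⇒≢0 (p<q⇒0<q-p τ<1))) ⟩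
    1ℚ + τ * H              ∎
    where H = inv₀ (1ℚ - τ)

  2ℚ : ℚ
  2ℚ = 1ℚ + 1ℚ

  0≤2 : 0ℚ ≤ 2ℚ
  0≤2 = nonNeg+ 0≤1 0≤1

  factor⁻¹ : ℚ[i] → ℚ[i] → ℕ → ℚ[i]
  factor⁻¹ b q N = inv (G.factor b q N)

  cofactor⁻¹ : ℚ[i] → ℕ → ℚ[i]
  cofactor⁻¹ q N = inv (G.cofactor q N)

  inverse-bounded : ∀ z w {c} → w ≡ inv z → 0ℚ < c → c ≤ ‖ z ‖ → z G.* w ≡ G.1# × ‖ w ‖ ≤ 2ℚ * inv₀ c
  inverse-bounded z w refl 0<c c≤‖z‖ = ⊗-inv z (pos⇒≢0 (norm²-pos {z} 0<c c≤‖z‖)) , ‖inv‖≤ {z} 0<c c≤‖z‖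

  -- A sum in place of a maximum. The summands bound the factors 1 + b q^N, the constant in the
  -- decay of q^N, the inverses of the factors, and the inverses of 1 - q^N.
  bound : ℚ → ℚ → ℚ → ℚ
  bound σ β c = (1ℚ + β * 2ℚ) + (2ℚ + (2ℚ * inv₀ c + 2ℚ * inv₀ (1ℚ - σ)))

  p≤q+p : ∀ {p q} → 0ℚ ≤ q → p ≤ q + p
  p≤q+p {p} {q} 0≤q = subst (p ≤_) (ℚₚ.+-comm p q) (p≤p+nonNeg 0≤q)

  module _ {σ β c} (0≤σ : 0ℚ ≤ σ) (σ<1 : σ < 1ℚ) (0≤β : 0ℚ ≤ β) (0<c : 0ℚ < c) where
    private
      0≤1/c : 0ℚ ≤ 2ℚ * inv₀ c
      0≤1/c = nonNeg* 0≤2 (ℚₚ.<⇒≤ (inv₀-pos 0<c))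
      0≤1/[1-σ] : 0ℚ ≤ 2ℚ * inv₀ (1ℚ - σ)
      0≤1/[1-σ] = nonNeg* 0≤2 (ℚₚ.<⇒≤ (inv₀-pos (p<q⇒0<q-p σ<1)))
      0≤1+2β : 0ℚ ≤ 1ℚ + β * 2ℚ
      0≤1+2β = nonNeg+ 0≤1 (nonNeg* 0≤β 0≤2)
      0≤rest : 0ℚ ≤ 2ℚ * inv₀ c + 2ℚ * inv₀ (1ℚ - σ)
      0≤rest = nonNeg+ 0≤1/c 0≤1/[1-σ]
      B = bound σ β c
      τ = mid 0≤σ σ<1

    1+2β≤bound : 1ℚ + β * 2ℚ ≤ B
    1+2β≤bound = p≤p+nonNeg (nonNeg+ 0≤2 0≤rest)

    2≤bound : 2ℚ ≤ B
    2≤bound = ℚₚ.≤-trans (p≤p+nonNeg 0≤rest) (p≤q+p 0≤1+2β)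

    2/c≤bound : 2ℚ * inv₀ c ≤ B
    2/c≤bound = ℚₚ.≤-trans (p≤p+nonNeg 0≤1/[1-σ]) (ℚₚ.≤-trans (p≤q+p 0≤2) (p≤q+p 0≤1+2β))

    2/[1-σ]≤bound : 2ℚ * inv₀ (1ℚ - σ) ≤ B
    2/[1-σ]≤bound = ℚₚ.≤-trans (p≤q+p 0≤1/c) (ℚₚ.≤-trans (p≤q+p 0≤2) (p≤q+p 0≤1+2β))

    1≤bound : 1ℚ ≤ B
    1≤bound = ℚₚ.≤-trans (p≤p+nonNeg (nonNeg* 0≤β 0≤2)) 1+2β≤bound

    module _ {q b} (norm²q≤ : norm² q ≤ σ * σ) (‖b‖≤β : ‖ b ‖ ≤ β) where

      ‖bq^‖≤ : ∀ N → ‖ b ⊗ q ^ N ‖ ≤ β * 2ℚ * σ ^ℚ N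
      ‖bq^‖≤ N = subst (‖ b ⊗ q ^ N ‖ ≤_) (sym (ℚₚ.*-assoc β 2ℚ (σ ^ℚ N)))
        (NormedRing.‖*‖-mono normedRing {b} {q ^ N} ‖b‖≤β (‖^‖≤ {q} 0≤σ norm²q≤ N))

      -- 1 ≤ ‖1 + b q^N‖ + ‖b q^N‖
      1≤2‖1+bq^‖ : ∀ N → β * 2ℚ * σ ^ℚ N ≤ ½ → ½ ≤ ‖ G.factor b q N ‖
      1≤2‖1+bq^‖ N h = begin
        1ℚ - ½                  ≤⟨ ℚₚ.+-monoʳ-≤ 1ℚ (ℚₚ.neg-antimono-≤ (ℚₚ.≤-trans (‖bq^‖≤ N) h)) ⟩
        1ℚ - ‖ x ‖              ≤⟨ ℚₚ.+-monoˡ-≤ (- ‖ x ‖) 1≤ ⟩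
        (‖ (1ℚ ,i 0ℚ) ⊕ x ‖ + ‖ x ‖) - ‖ x ‖
          ≡⟨ solve 2 (λ a b → (a :+ b) :- b := a) refl (‖ (1ℚ ,i 0ℚ) ⊕ x ‖) (‖ x ‖) ⟩
        ‖ (1ℚ ,i 0ℚ) ⊕ x ‖      ∎
        where
        x = b ⊗ q ^ N
        1≤ : 1ℚ ≤ ‖ (1ℚ ,i 0ℚ) ⊕ x ‖ + ‖ x ‖
        1≤ = begin
          1ℚ                              ≤⟨ p≤∣p∣ 1ℚ ⟩
          ∣ 1ℚ ∣                          ≡⟨ cong ∣_∣ (solve 1 (λ a → con 1ℚ := (con 1ℚ :+ a) :+ :- a) refl (Re x)) ⟩
          ∣ (1ℚ + Re x) + - Re x ∣        ≤⟨ ℚₚ.∣p+q∣≤∣p∣+∣q∣ (1ℚ + Re x) (- Re x) ⟩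
          ∣ 1ℚ + Re x ∣ + ∣ - Re x ∣      ≡⟨ cong (∣ 1ℚ + Re x ∣ +_) (ℚₚ.∣-p∣≡∣p∣ (Re x)) ⟩
          ∣ 1ℚ + Re x ∣ + ∣ Re x ∣
            ≤⟨ ℚₚ.+-mono-≤ (p≤p+nonNeg {p = ∣ 1ℚ + Re x ∣} (ℚₚ.0≤∣p∣ (0ℚ + Im x)))
                 (p≤p+nonNeg {p = ∣ Re x ∣} (ℚₚ.0≤∣p∣ (Im x))) ⟩
          ‖ (1ℚ ,i 0ℚ) ⊕ x ‖ + ‖ x ‖      ∎

      controlled : (∀ N → 1 ℕ.≤ N → c ≤ ‖ G.factor b q N ‖) →
        Controlled normedRing q b (factor⁻¹ b q) (cofactor⁻¹ q) τ B
      controlled c≤ = record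
        { f*f⁻¹    = λ N 1≤N → proj₁ (factor-inverse N 1≤N)
        ; [1-q^]*g = λ N 1≤N → proj₁ (cofactor-inverse N 1≤N)
        ; ‖q^‖≤    = λ N → ℚₚ.≤-trans (‖^‖≤ {q} 0≤σ norm²q≤ N)
            (*-mono 0≤2 (^-nonNeg (0≤p*p τ) N) 2≤bound (^ℚ-mono-≤ 0≤σ (σ≤mid² 0≤σ σ<1) N))
        ; ‖f‖≤     = λ N _ → ℚₚ.≤-trans (NormedRing.‖+‖≤ normedRing (1ℚ ,i 0ℚ) (b ⊗ q ^ N))
            (ℚₚ.≤-trans (ℚₚ.+-monoʳ-≤ 1ℚ (ℚₚ.≤-trans (‖bq^‖≤ N) (β2σ^≤ N))) 1+2β≤bound)
        ; ‖f⁻¹‖≤   = λ N 1≤N → ℚₚ.≤-trans (proj₂ (factor-inverse N 1≤N)) 2/c≤bound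
        ; ‖g‖≤     = λ N 1≤N → ℚₚ.≤-trans (proj₂ (cofactor-inverse N 1≤N)) 2/[1-σ]≤bound
        }
        where
        factor-inverse : ∀ N → 1 ℕ.≤ N →
          G.factor b q N G.* factor⁻¹ b q N ≡ G.1# × ‖ factor⁻¹ b q N ‖ ≤ 2ℚ * inv₀ c
        factor-inverse N 1≤N = inverse-bounded (G.factor b q N) (factor⁻¹ b q N) refl 0<c (c≤ N 1≤N)
        cofactor-inverse : ∀ N → 1 ℕ.≤ N →
          G.cofactor q N G.* cofactor⁻¹ q N ≡ G.1# × ‖ cofactor⁻¹ q N ‖ ≤ 2ℚ * inv₀ (1ℚ - σ)
        cofactor-inverse N 1≤N = inverse-bounded (G.cofactor q N) (cofactor⁻¹ q N) refl (p<q⇒0<q-p σ<1)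
          (1-σ≤‖1-q^‖ {q} 0≤σ norm²q≤ (ℚₚ.<⇒≤ σ<1) N 1≤N)
        β2σ^≤ : ∀ N → β * 2ℚ * σ ^ℚ N ≤ β * 2ℚ
        β2σ^≤ N = subst (β * 2ℚ * σ ^ℚ N ≤_) (ℚₚ.*-identityʳ (β * 2ℚ))
          (*-monoˡ-≤ (nonNeg* 0≤β 0≤2) (^ℚ-antimono-≤ 0≤σ (ℚₚ.<⇒≤ σ<1) (z≤n {N})))

  -- A lower bound for ‖z‖² is turned into one for ‖z‖ by capping it at ½ ≤ 1.
  ⊓½≤‖‖ : ∀ {c} z → 0ℚ < c → c ≤ norm² z → c ⊓ ½ ≤ ‖ z ‖
  ⊓½≤‖‖ {c} z 0<c c≤ = square-cancel-≤ (‖‖-nonNeg z) (begin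
    d * d         ≤⟨ *-monoˡ-≤ (ℚₚ.⊓-glb (ℚₚ.<⇒≤ 0<c) (ℚₚ.<⇒≤ 0<½)) (ℚₚ.≤-trans (ℚₚ.p⊓q≤q c ½) ½≤1) ⟩
    d * 1ℚ        ≡⟨ ℚₚ.*-identityʳ d ⟩
    d             ≤⟨ ℚₚ.p⊓q≤p c ½ ⟩
    c             ≤⟨ c≤ ⟩
    norm² z       ≤⟨ norm²≤‖z‖² z ⟩
    ‖ z ‖ * ‖ z ‖ ∎)
    where
    d = c ⊓ ½
    ½≤1 : ½ ≤ 1ℚ
    ½≤1 = p≤p+nonNeg {½} {½} (ℚₚ.<⇒≤ 0<½)

  ⊓-pos : ∀ {p q} → 0ℚ < p → 0ℚ < q → 0ℚ < p ⊓ q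
  ⊓-pos {p} {q} 0<p 0<q with ℚₚ.⊓-sel p q
  ... | inj₁ eq = subst (0ℚ <_) (sym eq) 0<p
  ... | inj₂ eq = subst (0ℚ <_) (sym eq) 0<q

-- From complex numbers to the terms of their sequences

open import Data.Nat.Base using (_≤_)
open import Defs

-- Statements below avoid powers of complex numbers inside larger expressions (by
-- naming them or hiding them in a definition like this one): such expressions make
-- the conversion checker compare proofs of the Cauchy property.
∏∏ : ∀ {n l} → (Fin n → Fin l → ℂ) → ℂ
∏∏ z = ∏ λ j → ∏ λ k → z j k

-- To be applied to the map φ taking a complex number to the k-th term of its
-- sequence.
module Evaluation (R : NormedRing) (φ : ℂ → NormedRing.Carrier R)
  (φ-1   : φ 1ℂ ≡ NormedRing.1# R)
  (φ-+   : ∀ z w → φ (z + w) ≡ NormedRing._+_ R (φ z) (φ w))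
  (φ-*   : ∀ z w → φ (z * w) ≡ NormedRing._*_ R (φ z) (φ w))
  (φ-neg : ∀ z → φ (- z) ≡ NormedRing.-_ R (φ z))
  (φ-/   : ∀ z w w#0 w⁻¹ → NormedRing._*_ R (φ w) w⁻¹ ≡ NormedRing.1# R →
           φ (z / (w , w#0)) ≡ NormedRing._*_ R (φ z) w⁻¹)
  (φ-^   : ∀ z n → φ (z ^ n) ≡ NormedRing._^_ R (φ z) n)
  (φ-∏   : ∀ {n} (z : Fin n → ℂ) → φ (∏ z) ≡ NormedRing.∏ R (λ i → φ (z i)))
  where
  private
    module G = NormedRing R
  open ≡-Reasoning

  φ-- : ∀ z w → φ (z - w) ≡ φ z G.- φ w
  φ-- z w = trans (φ-+ z (- w)) (cong (φ z G.+_) (φ-neg w))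

  φ-if : ∀ (c : Bool) z → φ (if c then z else 1ℂ) ≡ (if c then φ z else G.1#)
  φ-if true  z = refl
  φ-if false z = φ-1

  φ-1-* : ∀ x y → φ (1ℂ - x * y) ≡ G.1# G.- φ x G.* φ y
  φ-1-* x y = trans (φ-- 1ℂ (x * y)) (cong₂ G._-_ φ-1 (φ-* x y))

  φ-qPochhammer : ∀ x y n → φ (qPochhammer x y n) ≡ G.∏ {n} (λ j → G.1# G.- φ x G.* φ y G.^ toℕ j)
  φ-qPochhammer x y n = trans (φ-∏ {n} (λ j → 1ℂ - x * y ^ toℕ j)) (G.∏-cong {n} λ j →
    trans (φ-1-* x (y ^ toℕ j)) (cong (λ t → G.1# G.- φ x G.* t) (φ-^ y (toℕ j))))

  q^m*[q^m]^j : ∀ x m j → x G.^ m G.* (x G.^ m) G.^ j ≡ x G.^ (suc j ℕ.* m)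
  q^m*[q^m]^j x m j = trans (G.^-assocʳ x m (suc j)) (cong (x G.^_) (ℕₚ.*-comm m (suc j)))

  1+bq^suc : ∀ b q j → G.1# G.- φ (- b * q) G.* φ q G.^ j ≡ G.1# G.+ φ b G.* φ q G.^ suc j
  1+bq^suc b q j = cong (G.1# G.+_) (begin
    G.- (φ (- b * q) G.* φ q G.^ j)
      ≡⟨ cong (λ x → G.- (x G.* φ q G.^ j)) (trans (φ-* (- b) q) (cong (G._* φ q) (φ-neg b))) ⟩
    G.- (G.- φ b G.* φ q G.* φ q G.^ j)
      ≡⟨ cong G.-_ (G.*-assoc _ _ _) ⟩
    G.- (G.- φ b G.* φ q G.^ suc j)
      ≡⟨ cong G.-_ (sym (Ringₚ.-‿distribˡ-* G.ring (φ b) _)) ⟩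
    G.- (G.- (φ b G.* φ q G.^ suc j))
      ≡⟨ Ringₚ.-‿involutive G.ring _ ⟩
    φ b G.* φ q G.^ suc j ∎)

  φ-∏∏ : ∀ {n l} (z : Fin n → Fin l → ℂ) → φ (∏∏ z) ≡ G.∏ (λ j → G.∏ λ k → φ (z j k))
  φ-∏∏ {n} {l} z = trans (φ-∏ {n} (λ j → ∏ λ k → z j k)) (G.∏-cong {n} λ j → φ-∏ {l} (λ k → z j k))

  module _ (q b : ℂ) (b≠ : ∀ N → 1 ℕ.≤ N → (1ℂ + b * q ^ N) #0) (m : ℕ) (f⁻¹ g : ℕ → G.Carrier) where
    open Telescoping R m (φ q) (φ b) f⁻¹ g using (f; summand; closed)
    open Products R m (φ q) (φ b) f⁻¹ g using
      (denominator; repeated; runs; summand-factored; denominator*runs; ∏*∏*closed)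

    φ-factor : ∀ N → φ (Series.factor q b b≠ m N) ≡ G.factor (φ b) (φ q) N
    φ-factor N = trans (φ-+ 1ℂ (b * q ^ N))
      (cong₂ G._+_ φ-1 (trans (φ-* b (q ^ N)) (cong (φ b G.*_) (φ-^ q N))))

    φ-denominator : ∀ {n} (v : Vec ℕ n) → φ (Series.denominator q b b≠ m v) ≡ denominator 0 v
    φ-denominator {n} v = trans (φ-∏∏ (Series.denominatorFactor q b b≠ m v))
      (G.∏-cong {n} λ j → G.∏-cong {suc m} λ k → φ-factor (toℕ j ℕ.* m ℕ.+ suc (toℕ k) ℕ.+ lookup v j))

    φ-repeated : ∀ {n} (v : Vec ℕ (suc n)) → φ (Series.repeated q b b≠ m v) ≡ repeated 0 v
    φ-repeated {n} v = trans
      (φ-∏ {n} (λ i →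
        if does (lookup v (Fin.suc i) ℕₚ.≟ lookup v (inject₁ i))
        then Series.factor q b b≠ m (suc (toℕ i) ℕ.* m ℕ.+ 1 ℕ.+ lookup v (inject₁ i))
        else 1ℂ))
      (G.∏-cong {n} λ i →
        let coincide = does (lookup v (Fin.suc i) ℕₚ.≟ lookup v (inject₁ i))
            N = suc (toℕ i) ℕ.* m ℕ.+ 1 ℕ.+ lookup v (inject₁ i)
        in trans (φ-if coincide (Series.factor q b b≠ m N))
             (cong (λ x → if coincide then x else G.1#) (φ-factor N)))

    module _ (f*f⁻¹ : ∀ N → 1 ℕ.≤ N → G.factor (φ b) (φ q) N G.* f⁻¹ N ≡ G.1#) where

      φ-term : ∀ {n} (t : Tuple (suc n)) → φ (Series.term q b b≠ m t) ≡ summand 0 (Tuple.entries t)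
      φ-term (tuple v _) = begin
        φ ((q ^ (m ℕ.* Vec.sum v) / (Series.denominator q b b≠ m v , Series.denominator#0 q b b≠ m v)) *
          Series.repeated q b b≠ m v)
          ≡⟨ φ-* (q ^ (m ℕ.* Vec.sum v) / (Series.denominator q b b≠ m v , Series.denominator#0 q b b≠ m v))
               (Series.repeated q b b≠ m v) ⟩
        φ (q ^ (m ℕ.* Vec.sum v) / (Series.denominator q b b≠ m v , Series.denominator#0 q b b≠ m v)) G.*
          φ (Series.repeated q b b≠ m v)
          ≡⟨ cong₂ G._*_
               (φ-/ (q ^ (m ℕ.* Vec.sum v)) (Series.denominator q b b≠ m v) (Series.denominator#0 q b b≠ m v)
                 (runs 0 v)
                 (trans (cong (G._* runs 0 v) (φ-denominator v)) (denominator*runs f*f⁻¹ 0 v)))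
               (φ-repeated v) ⟩
        φ (q ^ (m ℕ.* Vec.sum v)) G.* runs 0 v G.* repeated 0 v
          ≡⟨ cong (λ x → x G.* runs 0 v G.* repeated 0 v) (φ-^ q (m ℕ.* Vec.sum v)) ⟩
        φ q G.^ (m ℕ.* Vec.sum v) G.* runs 0 v G.* repeated 0 v
          ≡⟨ sym (summand-factored 0 v) ⟩
        summand 0 v ∎

      module _ (1≤m : 1 ℕ.≤ m) ([1-q^]*g : ∀ N → 1 ℕ.≤ N → G.cofactor (φ q) N G.* g N ≡ G.1#) where

        φ-limit : ∀ n w D → φ w ≡ φ q G.^ m →
          D ≡ qPochhammer w w n * qPochhammer (- b * q) q (m ℕ.* n) →
          (D#0 : D #0) → φ (1ℂ / (D , D#0)) ≡ closed n 0 0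
        φ-limit n w D φw D≡ D#0 = begin
          φ (1ℂ / (D , D#0))
            ≡⟨ φ-/ 1ℂ D D#0 (closed n 0 0)
                 (trans (cong (G._* closed n 0 0) φ-D) (∏*∏*closed f*f⁻¹ 1≤m [1-q^]*g n)) ⟩
          φ 1ℂ G.* closed n 0 0        ≡⟨ cong (G._* closed n 0 0) φ-1 ⟩
          G.1# G.* closed n 0 0        ≡⟨ G.*-identityˡ (closed n 0 0) ⟩
          closed n 0 0                 ∎
          where
          φ-D : φ D ≡ G.∏ {n} (λ j → G.1# G.- φ q G.^ (suc (toℕ j) ℕ.* m)) G.*
            G.∏ {n ℕ.* m} (λ j → f (suc (toℕ j)))
          φ-D = trans (cong φ D≡)
            (trans (φ-* (qPochhammer w w n) (qPochhammer (- b * q) q (m ℕ.* n))) (cong₂ G._*_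
              (trans (φ-qPochhammer w w n) (G.∏-cong {n} λ j →
                cong (λ x → G.1# G.- x) (trans (cong (λ x → x G.* x G.^ toℕ j) φw) (q^m*[q^m]^j (φ q) m (toℕ j)))))
              (trans (φ-qPochhammer (- b * q) q (m ℕ.* n))
                (trans (G.∏-cong {m ℕ.* n} λ j → 1+bq^suc b q (toℕ j))
                  (cong (λ l → G.∏ {l} λ j → f (suc (toℕ j))) (ℕₚ.*-comm m n))))))

entries-injective : ∀ {n} {s t : Tuple n} → Tuple.entries s ≡ Tuple.entries t → s ≡ t
entries-injective refl = refl

-- The ordering stored in a tuple is irrelevant and cannot be projected for use; decidability allows
-- it to be recomputed.
entries-sorted : ∀ {n} (ts : List (Tuple n)) {v} → v ∈ map Tuple.entries ts → Sorted v
entries-sorted ts v∈ with tuple v s , _ , refl ← ∈-map⁻ Tuple.entries v∈ =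
  recompute (linked? ℕₚ._≤?_ v) s

fromVecs : ∀ {n} (vs : List (Vec ℕ n)) → (∀ {v} → v ∈ vs → Sorted v) → List (Tuple n)
fromVecs []       s = []
fromVecs (v ∷ vs) s = tuple v (s (here refl)) ∷ fromVecs vs (λ v∈ → s (there v∈))

map-entries-fromVecs : ∀ {n} (vs : List (Vec ℕ n)) (s : ∀ {v} → v ∈ vs → Sorted v) →
  map Tuple.entries (fromVecs vs s) ≡ vs
map-entries-fromVecs []       s = refl
map-entries-fromVecs (v ∷ vs) s = cong (v ∷_) (map-entries-fromVecs vs (λ v∈ → s (there v∈)))

⊆-entries : ∀ {n} (vs : List (Vec ℕ n)) (s : ∀ {v} → v ∈ vs → Sorted v) {ts} →
  fromVecs vs s ⊆ ts → vs ⊆ map Tuple.entries ts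
⊆-entries vs s {ts} h = subst (_⊆ map Tuple.entries ts) (map-entries-fromVecs vs s) (Subsetₚ.map⁺ Tuple.entries h)

module Terms where
  open Gaussian using (normedRing; norm²; inv-unique; _⊗_; _⊕_)
  private
    module G = NormedRing normedRing

  infixl 9 _at_
  _at_ : ℂ → ℕ → ℚ[i]
  z at k = Real.seq (re z) k ,i Real.seq (im z) k

  /-at : ∀ k z w w#0 w⁻¹ → w at k ⊗ w⁻¹ ≡ G.1# → (z / (w , w#0)) at k ≡ z at k ⊗ w⁻¹
  /-at k z w w#0 w⁻¹ h = cong (z at k ⊗_) (inv-unique (w at k) w⁻¹ h)

  ^-at : ∀ k z n → (z ^ n) at k ≡ (z at k) G.^ n
  ^-at k z zero    = refl
  ^-at k z (suc n) = cong (z at k ⊗_) (^-at k z n)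

  ∏-at : ∀ k {n} (z : Fin n → ℂ) → (∏ z) at k ≡ G.∏ (λ i → z i at k)
  ∏-at k {zero}  z = refl
  ∏-at k {suc n} z = cong (z Fin.zero at k ⊗_) (∏-at k (λ i → z (Fin.suc i)))

  sumOver-at : ∀ k {I : Set} (f : I → ℂ) xs → sumOver f xs at k ≡ G.∑ (λ x → f x at k) xs
  sumOver-at k f []       = refl
  sumOver-at k f (x ∷ xs) = cong (f x at k ⊕_) (sumOver-at k f xs)

  module At (k : ℕ) = Evaluation normedRing (_at k) refl
    (λ _ _ → refl) (λ _ _ → refl) (λ _ → refl) (/-at k) (^-at k) (∏-at k)

  #0⇒norm²≥ : ∀ z → z #0 → ∃ λ c → 0ℚ ℚ.< c × Eventually λ k → c ℚ.≤ norm² (z at k)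
  #0⇒norm²≥ z (c , 0<c , K , h) = c , 0<c , K , λ k K≤k →
    subst (ℚ._≤ norm² (z at k)) (ℚₚ.+-identityˡ c) (h k K≤k)

  norm²≥⇒#0 : ∀ z {c} → 0ℚ ℚ.< c → Eventually (λ k → c ℚ.≤ norm² (z at k)) → z #0
  norm²≥⇒#0 z {c} 0<c (K , h) = c , 0<c , K , λ k K≤k →
    subst (ℚ._≤ norm² (z at k)) (sym (ℚₚ.+-identityˡ c)) (h k K≤k)

-- Uniform control and convergence

module Limit (q b : ℂ) (∣q∣<1 : ∣ q ∣ < 1ℝ) (b≠ : ∀ N → 1 ℕ.≤ N → (1ℂ + b * q ^ N) #0) where
  open Gaussian using (normedRing; norm²; ‖_‖; _⊗_; _⊕_; ⊖_; norm²≤‖z‖²; ‖‖-nonNeg;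
    [1-σ]²≤norm²[1-q^])
  open ℚ-Powers using (*^→0; p<q⇒0<q-p)
  open UniformBounds
  open Terms
  private
    module G = NormedRing normedRing

  factor : ℕ → ℂ
  factor N = 1ℂ + b * q ^ N

  factor#0 : ∀ N → 1 ℕ.≤ N → factor N #0
  factor#0 N 1≤N = b≠ N 1≤N

  factor-at : ∀ N k → factor N at k ≡ G.factor (b at k) (q at k) N
  factor-at N k = cong (λ x → G.1# G.+ b at k G.* x) (^-at k q N)

  modulus : ∃ λ σ → 0ℚ ℚ.≤ σ × σ ℚ.< 1ℚ × Eventually λ k → norm² (q at k) ℚ.≤ σ ℚ.* σ
  modulus = eventually-< (Real.seq ∣ q ∣²) (Real.cauchy ∣ q ∣²) (proj₁ (proj₂ ∣q∣<1)) (proj₂ (proj₂ ∣q∣<1))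

  -- Each factor has its own lower bound and its own threshold for k; for finitely many factors a
  -- minimum and a maximum suffice. The condition c ≤ 1/2 is carried along so that the same c also
  -- serves for the factors with large N.
  factors-bounded-below : ∀ N₀ → ∃ λ c → 0ℚ ℚ.< c × c ℚ.≤ ½ ×
    Eventually λ k → ∀ N → 1 ℕ.≤ N → N ℕ.< N₀ → c ℚ.≤ ‖ G.factor (b at k) (q at k) N ‖
  factors-bounded-below zero = ½ , 0<½ , ℚₚ.≤-refl , 0 , λ _ _ _ _ ()
  factors-bounded-below (suc zero) = ½ , 0<½ , ℚₚ.≤-refl , 0 , λ { _ _ _ (s≤s z≤n) (s≤s ()) }
  factors-bounded-below (suc (suc n)) =
    let c , 0<c , c≤½ , K , h = factors-bounded-below (suc n)
        c′ , 0<c′ , K′ , h′ = #0⇒norm²≥ (factor (suc n)) (factor#0 (suc n) (s≤s z≤n))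
        d = c′ ℚ.⊓ ½
    in c ℚ.⊓ d , ⊓-pos 0<c (⊓-pos 0<c′ 0<½) , ℚₚ.≤-trans (ℚₚ.p⊓q≤p c d) c≤½ , K ℕ.⊔ K′ ,
      λ k ≤k N 1≤N N<2+n → step {c} {c′} k 0<c′ (h k (ℕₚ.m⊔n≤o⇒m≤o K K′ ≤k))
        (h′ k (ℕₚ.m⊔n≤o⇒n≤o K K′ ≤k)) N 1≤N (ℕ.s≤s⁻¹ N<2+n)
    where
    step : ∀ {c c′} k → 0ℚ ℚ.< c′ → (∀ N → 1 ℕ.≤ N → N ℕ.< suc n → c ℚ.≤ ‖ G.factor (b at k) (q at k) N ‖) →
      c′ ℚ.≤ norm² (factor (suc n) at k) →
      ∀ N → 1 ℕ.≤ N → N ℕ.≤ suc n → c ℚ.⊓ (c′ ℚ.⊓ ½) ℚ.≤ ‖ G.factor (b at k) (q at k) N ‖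
    step {c} {c′} k 0<c′ h h′ N 1≤N N≤1+n with ℕₚ.m≤n⇒m<n∨m≡n N≤1+n
    ... | inj₁ N<1+n = ℚₚ.≤-trans (ℚₚ.p⊓q≤p c _) (h N 1≤N N<1+n)
    ... | inj₂ refl  = ℚₚ.≤-trans (ℚₚ.p⊓q≤q c _) (⊓½≤‖‖ (G.factor (b at k) (q at k) (suc n)) 0<c′
      (subst (λ z → c′ ℚ.≤ norm² z) (factor-at (suc n) k) h′))

  private
    σ = proj₁ modulus
    0≤σ = proj₁ (proj₂ modulus)
    σ<1 = proj₁ (proj₂ (proj₂ modulus))
    norm²q≤ = proj₂ (proj₂ (proj₂ modulus))

  τ : ℚ
  τ = mid 0≤σ σ<1

  module _ where
    private
      bounded-re = Cauchy-Lemmas.bounded (Real.seq (re b)) (Real.cauchy (re b))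
      bounded-im = Cauchy-Lemmas.bounded (Real.seq (im b)) (Real.cauchy (im b))
      β = proj₁ bounded-re ℚ.+ proj₁ bounded-im
      0≤β = nonNeg+ (ℚₚ.<⇒≤ (proj₁ (proj₂ bounded-re))) (ℚₚ.<⇒≤ (proj₁ (proj₂ bounded-im)))
      -- From N₀ on the norm of b q^N is at most 1/2 at every late position, which keeps 1 + b q^N
      -- at least 1/2 away from 0.
      far = *^→0 0≤σ σ<1 (nonNeg* 0≤β 0≤2) 0<½
      N₀ = proj₁ far
      near = factors-bounded-below N₀
      c = proj₁ near
      0<c = proj₁ (proj₂ near)
      c≤½ = proj₁ (proj₂ (proj₂ near))
      K₁ = proj₁ norm²q≤
      K₂ = proj₁ (proj₂ (proj₂ bounded-re))
      K₃ = proj₁ (proj₂ (proj₂ bounded-im))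
      K₄ = proj₁ (proj₂ (proj₂ (proj₂ near)))

    B : ℚ
    B = bound σ β c

    1≤B : 1ℚ ℚ.≤ B
    1≤B = 1≤bound 0≤σ σ<1 0≤β 0<c

    eventually-controlled : Eventually λ k →
      Controlled normedRing (q at k) (b at k) (factor⁻¹ (b at k) (q at k)) (cofactor⁻¹ (q at k)) τ B
    eventually-controlled = (K₁ ℕ.⊔ K₂) ℕ.⊔ (K₃ ℕ.⊔ K₄) , λ k ≤k →
      let ≤k₁₂ = ℕₚ.m⊔n≤o⇒m≤o (K₁ ℕ.⊔ K₂) (K₃ ℕ.⊔ K₄) ≤k
          ≤k₃₄ = ℕₚ.m⊔n≤o⇒n≤o (K₁ ℕ.⊔ K₂) (K₃ ℕ.⊔ K₄) ≤k
          norm²≤ = proj₂ norm²q≤ k (ℕₚ.m⊔n≤o⇒m≤o K₁ K₂ ≤k₁₂)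
          ‖b‖≤β = ℚₚ.+-mono-≤ (proj₂ (proj₂ (proj₂ bounded-re)) k (ℕₚ.m⊔n≤o⇒n≤o K₁ K₂ ≤k₁₂))
                              (proj₂ (proj₂ (proj₂ bounded-im)) k (ℕₚ.m⊔n≤o⇒m≤o K₃ K₄ ≤k₃₄))
          near-k = proj₂ (proj₂ (proj₂ (proj₂ near))) k (ℕₚ.m⊔n≤o⇒n≤o K₃ K₄ ≤k₃₄)
      in controlled 0≤σ σ<1 0≤β 0<c {q at k} {b at k} norm²≤ ‖b‖≤β (λ N 1≤N → c≤ k norm²≤ ‖b‖≤β near-k N 1≤N)
      where
      c≤ : ∀ k → norm² (q at k) ℚ.≤ σ ℚ.* σ → ‖ b at k ‖ ℚ.≤ β →
        (∀ N → 1 ℕ.≤ N → N ℕ.< N₀ → c ℚ.≤ ‖ G.factor (b at k) (q at k) N ‖) →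
        ∀ N → 1 ℕ.≤ N → c ℚ.≤ ‖ G.factor (b at k) (q at k) N ‖
      c≤ k norm²≤ ‖b‖≤β near-k N 1≤N with N ℕₚ.<? N₀
      ... | yes N<N₀ = near-k N 1≤N N<N₀
      ... | no N≮N₀ = ℚₚ.≤-trans c≤½
        (1≤2‖1+bq^‖ 0≤σ σ<1 0≤β 0<c {q at k} {b at k} norm²≤ ‖b‖≤β N (proj₂ far N (ℕₚ.≮⇒≥ N≮N₀)))

  module _ (m : ℕ) (1≤m : 1 ℕ.≤ m) (w : ℂ) (w≡q^m : w ≡ q ^ m) where

    w-at : ∀ k → w at k ≡ (q at k) G.^ m
    w-at k = trans (cong (_at k) w≡q^m) (^-at k q m)

    1-q^#0 : ∀ j → (1ℂ - w * w ^ j) #0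
    1-q^#0 j = norm²≥⇒#0 (1ℂ - w * w ^ j) (pos* (p<q⇒0<q-p σ<1) (p<q⇒0<q-p σ<1))
      (proj₁ norm²q≤ , λ k K≤k → subst (λ z → (1ℚ ℚ.- σ) ℚ.* (1ℚ ℚ.- σ) ℚ.≤ norm² z) (sym (e k))
        ([1-σ]²≤norm²[1-q^] {q at k} 0≤σ (proj₂ norm²q≤ k K≤k) (ℚₚ.<⇒≤ σ<1) (suc j ℕ.* m) (1≤suc* j 1≤m)))
      where
      e : ∀ k → (1ℂ - w * w ^ j) at k ≡ G.cofactor (q at k) (suc j ℕ.* m)
      e k = trans (At.φ-1-* k w (w ^ j)) (cong (λ x → G.1# ⊕ ⊖ x)
        (trans (cong (w at k ⊗_) (^-at k w j))
          (trans (cong (λ x → x ⊗ x G.^ j) (w-at k)) (At.q^m*[q^m]^j k (q at k) m j))))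

    1+bq^suc#0 : ∀ j → (1ℂ - - b * q * q ^ j) #0
    1+bq^suc#0 j =
      let c , 0<c , K , h = #0⇒norm²≥ (factor (suc j)) (factor#0 (suc j) (s≤s z≤n))
      in norm²≥⇒#0 (1ℂ - - b * q * q ^ j) 0<c (K , λ k K≤k →
        subst (λ z → c ℚ.≤ norm² z) (trans (factor-at (suc j) k) (sym (e k))) (h k K≤k))
      where
      e : ∀ k → (1ℂ - - b * q * q ^ j) at k ≡ G.factor (b at k) (q at k) (suc j)
      e k = trans (At.φ-1-* k (- b * q) (q ^ j))
        (trans (cong (λ x → G.1# ⊕ ⊖ ((- b * q) at k ⊗ x)) (^-at k q j)) (At.1+bq^suc k b q j))

    denominator#0 : ∀ n l → (qPochhammer w w n * qPochhammer (- b * q) q l) #0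
    denominator#0 n l = *-#0 {qPochhammer w w n} {qPochhammer (- b * q) q l}
      (∏-#0 {n} (λ j → 1ℂ - w * w ^ toℕ j) (λ j → 1-q^#0 (toℕ j)))
      (∏-#0 {l} (λ j → 1ℂ - - b * q * q ^ toℕ j) (λ j → 1+bq^suc#0 (toℕ j)))

    module _ (n-1 : ℕ) (D : ℂ)
      (D≡ : D ≡ qPochhammer w w (suc n-1) * qPochhammer (- b * q) q (m ℕ.* suc n-1)) (D#0 : D #0) where
      private
        H = inv₀ (1ℚ ℚ.- τ)
        τ<1 = mid<1 0≤σ σ<1
        0≤τ = mid-nonNeg 0≤σ σ<1
        0≤H = ℚₚ.<⇒≤ (inv₀-pos (p<q⇒0<q-p τ<1))
        E = ErrorConstants.E m B H n-1
        0≤E = ErrorConstants.E-nonNeg m B H (ℚₚ.≤-trans (ℚₚ.<⇒≤ 0<1) 1≤B) 0≤H n-1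
        term = Series.term q b b≠ m {n-1}
        S = 1ℂ / (D , D#0)

      distance : ∀ k →
        Controlled normedRing (q at k) (b at k) (factor⁻¹ (b at k) (q at k)) (cofactor⁻¹ (q at k)) τ B →
        ∀ d (F : List (Tuple (suc n-1))) → Unique F → box (suc n-1) 0 d ⊆ map Tuple.entries F →
        ‖ (sumOver term F - S) at k ‖ ℚ.≤ E ℚ.* τ ℚ-Powers.^ d
      distance k ctrl d F u box⊆ = subst (λ z → G.‖ z ‖ ℚ.≤ E ℚ.* τ ℚ-Powers.^ d) (sym sum-S-at)
        (Truncation.∑-dist normedRing m (q at k) (b at k) (factor⁻¹ (b at k) (q at k)) (cofactor⁻¹ (q at k))
          τ B H 0≤τ (ℚₚ.<⇒≤ τ<1) 1≤B 0≤H (geometric-sum τ<1) 1≤m ctrl n-1 d (map Tuple.entries F)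
          (Uniqueₚ.map⁺ entries-injective u) (entries-sorted F) box⊆)
        where
        open Telescoping normedRing m (q at k) (b at k) (factor⁻¹ (b at k) (q at k)) (cofactor⁻¹ (q at k))
          using (summand; closed)
        sum-at : sumOver term F at k ≡ G.∑ (summand 0) (map Tuple.entries F)
        sum-at = trans (sumOver-at k term F)
          (trans (G.∑-cong-∈ F (λ {t} _ → At.φ-term k q b b≠ m (factor⁻¹ (b at k) (q at k)) (cofactor⁻¹ (q at k))
              (Controlled.f*f⁻¹ ctrl) t))
            (sym (G.∑-map (summand 0) Tuple.entries F)))
        S-at : S at k ≡ closed (suc n-1) 0 0
        S-at = At.φ-limit k q b b≠ m (factor⁻¹ (b at k) (q at k)) (cofactor⁻¹ (q at k))
          (Controlled.f*f⁻¹ ctrl) 1≤m (Controlled.[1-q^]*g ctrl) (suc n-1) w D (w-at k) D≡ D#0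
        sum-S-at : (sumOver term F - S) at k ≡ G.∑ (summand 0) (map Tuple.entries F) G.- closed (suc n-1) 0 0
        sum-S-at = trans (At.φ-- k (sumOver term F) S) (cong₂ G._-_ sum-at S-at)

      hasSum : HasSum term S
      hasSum ε 0<ε = F₀ , λ F u F₀⊆F →
        -- One half of the gap e between 0 and ε bounds the error; the other half is the gap which
        -- the strict inequality of reals has to exhibit.
        e ℚ.* ½ , 0<e½ , K ℕ.⊔ proj₁ eventually-controlled , λ k ≤k →
          close F u F₀⊆F k (ℕₚ.m⊔n≤o⇒m≤o K _ ≤k)
            (proj₂ eventually-controlled k (ℕₚ.m⊔n≤o⇒n≤o K _ ≤k))
        where
        e = proj₁ 0<ε
        0<e½ = pos* (proj₁ (proj₂ 0<ε)) 0<½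
        K = proj₁ (proj₂ (proj₂ 0<ε))
        e≤ε = proj₂ (proj₂ (proj₂ 0<ε))
        -- The size d of the box depends only on E, τ and e, so one F₀ works for every F and every
        -- late position.
        small = *^→0 0≤τ τ<1 0≤E 0<e½
        d = proj₁ small
        box-sorted : ∀ {v} → v ∈ box (suc n-1) 0 d → Sorted v
        box-sorted v∈ = Linked.tail (∈-box⁻ (suc n-1) 0 d v∈)
        F₀ : List (Tuple (suc n-1))
        F₀ = fromVecs (box (suc n-1) 0 d) box-sorted
        close : ∀ F → Unique F → F₀ ⊆ F → ∀ k → K ℕ.≤ k →
          Controlled normedRing (q at k) (b at k) (factor⁻¹ (b at k) (q at k)) (cofactor⁻¹ (q at k)) τ B →
          Real.seq ∣ sumOver term F - S ∣ k ℚ.+ e ℚ.* ½ ℚ.≤ Real.seq ε k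
        close F u F₀⊆F k K≤k ctrl = begin
          Real.seq ∣ sumOver term F - S ∣ k ℚ.+ e ℚ.* ½
            ≤⟨ ℚₚ.+-monoˡ-≤ (e ℚ.* ½) (lower-≤ (ℚₚ.<⇒≤ 0<e½) (ℚₚ.≤-trans
                 (norm²≤‖z‖² ((sumOver term F - S) at k))
                 (*-mono (‖‖-nonNeg ((sumOver term F - S) at k)) (ℚₚ.<⇒≤ 0<e½) ‖‖≤ ‖‖≤)) k) ⟩
          e ℚ.* ½ ℚ.+ e ℚ.* ½   ≡⟨ half e ⟩
          e                     ≡⟨ sym (ℚₚ.+-identityˡ e) ⟩
          0ℚ ℚ.+ e              ≤⟨ e≤ε k K≤k ⟩
          Real.seq ε k          ∎
          where
          open ℚₚ.≤-Reasoning
          ‖‖≤ = ℚₚ.≤-trans (distance k ctrl d F u (⊆-entries (box (suc n-1) 0 d) box-sorted F₀⊆F))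
            (proj₂ small d ℕₚ.≤-refl)

converges : ∀ q b → ∣ q ∣ < 1ℝ → (b≠ : ∀ (N : ℕ) → 1 ≤ N → (1ℂ + b * q ^ N) #0) →
  ∀ m → 1 ≤ m → ∀ w → w ≡ q ^ m → ∀ n-1 D →
  D ≡ qPochhammer w w (suc n-1) * qPochhammer (- b * q) q (m ℕ.* suc n-1) →
  Σ[ D#0 ∈ D #0 ] HasSum {Tuple (suc n-1)} (Series.term q b b≠ m) (1ℂ / (D , D#0))
converges q b ∣q∣<1 b≠ m 1≤m w w≡ n-1 D D≡ =
  D#0 , Limit.hasSum q b ∣q∣<1 b≠ m 1≤m w w≡ n-1 D D≡ D#0
  where
  D#0 : D #0
  D#0 = subst _#0 (sym D≡) (Limit.denominator#0 q b ∣q∣<1 b≠ m 1≤m w w≡ (suc n-1) (m ℕ.* suc n-1))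

lemma4 : (q b : ℂ) → ∣ q ∣ < 1ℝ →
    (b≠ : ∀ (N : ℕ) → 1 ≤ N → (1ℂ + b * q ^ N) #0) →
    (m-1 n-1 : ℕ) →
    let m = suc m-1
        n = suc n-1
        D = qPochhammer (q ^ m) (q ^ m) n * qPochhammer (- b * q) q (m ℕ.* n)
    in Σ[ D#0 ∈ D #0 ] HasSum {Tuple n} (Series.term q b b≠ m) (1ℂ / (D , D#0))
lemma4 q b ∣q∣<1 b≠ m-1 n-1 =
  let result = converges q b ∣q∣<1 b≠ (suc m-1) (s≤s z≤n) _ refl n-1 _ refl in result
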